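{- Let $c,d,\nu$ be positive numbers satisfying $c\ge 8\nu$ and $d\ge 4\nu$. Let $G$ be a graph of order $n$ with minimum degree $\delta(G)\ge(1/2+c)n$. Assume that the edges of $G$ are labelled by either $+1$ or $-1$, via $f:E(G)\to\{ -1,1\}$, such that the number of $\nu$-balanced vertices is at least $(3/4+d)n$. Then there exists a Hamilton cycle $H$ in $G$ with discrepancy at least $\nu^2n/500$, i.e. $\left|\sum_{e\in E(H)}f(e)\right|\ge \nu^2 n/500$.
   Context: All graphs are finite and simple. Given a graph $G$ on $n$ vertices with an edge labeling $f:E(G)\to\{ -1,1\}$ and a real number $\nu>0$, a vertex is $\nu$-balanced if it is incident to at least $\nu n$ edges with label $+1$ and to at least $\nu n$ edges with label $-1$. The discrepancy of a subgraph $H$ is the absolute value of the sum of the labels of its edges. -}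

module Defs where

open import Data.Fin using (Fin; toℕ)
open import Data.Fin.Properties using (nonZeroIndex)
open import Data.Fin.Subset using (Subset; _∈_; ∣_∣)
open import Data.Integer using (+_; _◃_)
import Data.Integer as ℤ
import Data.Integer.Properties as ℤ
open import Data.List using (length; filter; map; allFin)
open import Data.List.Extrema.Nat using (min)
open import Data.Nat using (ℕ; suc; NonZero; _⊔_) renaming (_≤_ to _≤ℕ_)
open import Data.Nat.DivMod using (_mod_)
import Data.Nat.Properties as ℕ
open import Data.Product using (Σ; ∃; ∃-syntax; _×_; _,_)
open import Data.Rational using (ℚ; 0ℚ; 1ℚ; ½)
import Data.Rational as ℚ
import Data.Rational.Properties as ℚ
open import Data.Rational.Solver using (module +-*-Solver)
open import Data.Sign using (Sign)
import Data.Sign.Properties as Sign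
open import Algebra.Properties.CommutativeMonoid.Sum ℤ.+-0-commutativeMonoid using (sum)
open import Function.Definitions using (Injective)
open import Level using (0ℓ)
open import Relation.Binary.Core using (Rel)
open import Relation.Binary.Definitions using (Symmetric; Decidable)
open import Relation.Binary.PropositionalEquality
open import Relation.Nullary using (¬_; yes; no)
import Relation.Unary as U

------------------------------------------------------------------------
-- Real numbers: Cauchy sequences of rationals.  The real equality (limits
-- agree) is never needed below, only the order.

IsCauchy : (ℕ → ℚ) → Set
IsCauchy x = ∀ ε → 0ℚ ℚ.< ε →
  ∃[ N ] (∀ m n → N ≤ℕ m → N ≤ℕ n → ℚ.∣ x m ℚ.- x n ∣ ℚ.< ε)

record ℝ : Set where
  constructor mkℝ
  field
    seq    : ℕ → ℚ
    cauchy : IsCauchy seq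

open ℝ public

private
  half-pos : ∀ ε → 0ℚ ℚ.< ε → 0ℚ ℚ.< ε ℚ.* ½
  half-pos ε 0<ε = subst (ℚ._< ε ℚ.* ½) (ℚ.*-zeroˡ ½) (ℚ.*-monoˡ-<-pos ½ 0<ε)

  halves : ∀ ε → ε ℚ.* ½ ℚ.+ ε ℚ.* ½ ≡ ε
  halves ε = trans (sym (ℚ.*-distribˡ-+ ε ½ ½)) (ℚ.*-identityʳ ε)

  +-rearrange : ∀ a b c d → (a ℚ.+ b) ℚ.- (c ℚ.+ d) ≡ (a ℚ.- c) ℚ.+ (b ℚ.- d)
  +-rearrange = solve 4 (λ a b c d →
    (a :+ b) :- (c :+ d) := (a :- c) :+ (b :- d)) refl
    where open +-*-Solver

  *-rearrange : ∀ a b c d →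
    a ℚ.* b ℚ.- c ℚ.* d ≡ a ℚ.* (b ℚ.- d) ℚ.+ d ℚ.* (a ℚ.- c)
  *-rearrange = solve 4 (λ a b c d →
    a :* b :- c :* d := a :* (b :- d) :+ d :* (a :- c)) refl
    where open +-*-Solver

  cancel-middle : ∀ a b → a ≡ (a ℚ.- b) ℚ.+ b
  cancel-middle = solve 2 (λ a b → a := (a :- b) :+ b) refl
    where open +-*-Solver

  abstract
    +-cauchy : ∀ {x y} → IsCauchy x → IsCauchy y → IsCauchy (λ n → x n ℚ.+ y n)
    +-cauchy {x} {y} cx cy ε 0<ε
      with cx (ε ℚ.* ½) (half-pos ε 0<ε) | cy (ε ℚ.* ½) (half-pos ε 0<ε)
    ... | M , p | N , q = M ⊔ N , λ m n M⊔N≤m M⊔N≤n → begin-strict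
        ℚ.∣ (x m ℚ.+ y m) ℚ.- (x n ℚ.+ y n) ∣
          ≡⟨ cong ℚ.∣_∣ (+-rearrange (x m) (y m) (x n) (y n)) ⟩
        ℚ.∣ (x m ℚ.- x n) ℚ.+ (y m ℚ.- y n) ∣
          ≤⟨ ℚ.∣p+q∣≤∣p∣+∣q∣ (x m ℚ.- x n) (y m ℚ.- y n) ⟩
        ℚ.∣ x m ℚ.- x n ∣ ℚ.+ ℚ.∣ y m ℚ.- y n ∣
          <⟨ ℚ.+-mono-< (p m n (ℕ.m⊔n≤o⇒m≤o M N M⊔N≤m) (ℕ.m⊔n≤o⇒m≤o M N M⊔N≤n))
                        (q m n (ℕ.m⊔n≤o⇒n≤o M N M⊔N≤m) (ℕ.m⊔n≤o⇒n≤o M N M⊔N≤n)) ⟩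
        ε ℚ.* ½ ℚ.+ ε ℚ.* ½
          ≡⟨ halves ε ⟩
        ε ∎
      where open ℚ.≤-Reasoning

  eventually-bounded : ∀ {x} → IsCauchy x →
    ∃[ B ] (ℚ.Positive B × ∃[ N ] (∀ n → N ≤ℕ n → ℚ.∣ x n ∣ ℚ.≤ B))
  eventually-bounded {x} cx with cx 1ℚ (ℚ.positive⁻¹ 1ℚ)
  ... | N , p =
      1ℚ ℚ.+ ℚ.∣ x N ∣
    , ℚ.pos+nonNeg⇒pos 1ℚ ℚ.∣ x N ∣ {{ℚ.∣-∣-nonNeg (x N)}}
    , N
    , λ n N≤n → begin
        ℚ.∣ x n ∣                             ≡⟨ cong ℚ.∣_∣ (cancel-middle (x n) (x N)) ⟩
        ℚ.∣ (x n ℚ.- x N) ℚ.+ x N ∣           ≤⟨ ℚ.∣p+q∣≤∣p∣+∣q∣ (x n ℚ.- x N) (x N) ⟩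
        ℚ.∣ x n ℚ.- x N ∣ ℚ.+ ℚ.∣ x N ∣       ≤⟨ ℚ.+-monoˡ-≤ ℚ.∣ x N ∣ (ℚ.<⇒≤ (p n N N≤n ℕ.≤-refl)) ⟩
        1ℚ ℚ.+ ℚ.∣ x N ∣                      ∎
    where open ℚ.≤-Reasoning

  scaled : ∀ B → ℚ.Positive B → ∀ η → 0ℚ ℚ.< η →
    ∃[ δ ] (0ℚ ℚ.< δ × B ℚ.* δ ≡ η)
  scaled B B>0 η 0<η = δ , δ>0 , eq
    where
    instance
      posB = B>0
      nzB  = ℚ.pos⇒nonZero B
    δ = ℚ.1/ B ℚ.* η
    δ>0 : 0ℚ ℚ.< δ
    δ>0 = ℚ.positive⁻¹ δ
      {{ℚ.pos*pos⇒pos (ℚ.1/ B) {{ℚ.1/pos⇒pos B}} η {{ℚ.positive 0<η}}}}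
    eq : B ℚ.* δ ≡ η
    eq = trans (sym (ℚ.*-assoc B (ℚ.1/ B) η))
               (trans (cong (ℚ._* η) (ℚ.*-inverseʳ B)) (ℚ.*-identityˡ η))

  *-small : ∀ B a b δ η → ℚ.Positive B → B ℚ.* δ ≡ η →
    ℚ.∣ a ∣ ℚ.≤ B → ℚ.∣ b ∣ ℚ.< δ → ℚ.∣ a ℚ.* b ∣ ℚ.< η
  *-small B a b δ η B>0 eq a≤B b<δ = begin-strict
      ℚ.∣ a ℚ.* b ∣             ≡⟨ ℚ.∣p*q∣≡∣p∣*∣q∣ a b ⟩
      ℚ.∣ a ∣ ℚ.* ℚ.∣ b ∣       ≤⟨ ℚ.*-monoʳ-≤-nonNeg ℚ.∣ b ∣ {{ℚ.∣-∣-nonNeg b}} a≤B ⟩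
      B ℚ.* ℚ.∣ b ∣             <⟨ ℚ.*-monoʳ-<-pos B {{B>0}} b<δ ⟩
      B ℚ.* δ                   ≡⟨ eq ⟩
      η                         ∎
    where open ℚ.≤-Reasoning

  *-close : ∀ a b c d B C β γ ε → ℚ.Positive B → ℚ.Positive C →
    B ℚ.* β ≡ ε ℚ.* ½ → C ℚ.* γ ≡ ε ℚ.* ½ →
    ℚ.∣ a ∣ ℚ.≤ B → ℚ.∣ d ∣ ℚ.≤ C → ℚ.∣ b ℚ.- d ∣ ℚ.< β → ℚ.∣ a ℚ.- c ∣ ℚ.< γ →
    ℚ.∣ a ℚ.* b ℚ.- c ℚ.* d ∣ ℚ.< ε
  *-close a b c d B C β γ ε B>0 C>0 Bβ≡ε/2 Cγ≡ε/2 a≤B d≤C b-d<β a-c<γ = begin-strict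
      ℚ.∣ a ℚ.* b ℚ.- c ℚ.* d ∣
        ≡⟨ cong ℚ.∣_∣ (*-rearrange a b c d) ⟩
      ℚ.∣ a ℚ.* (b ℚ.- d) ℚ.+ d ℚ.* (a ℚ.- c) ∣
        ≤⟨ ℚ.∣p+q∣≤∣p∣+∣q∣ (a ℚ.* (b ℚ.- d)) (d ℚ.* (a ℚ.- c)) ⟩
      ℚ.∣ a ℚ.* (b ℚ.- d) ∣ ℚ.+ ℚ.∣ d ℚ.* (a ℚ.- c) ∣
        <⟨ ℚ.+-mono-< (*-small B a (b ℚ.- d) β (ε ℚ.* ½) B>0 Bβ≡ε/2 a≤B b-d<β)
                      (*-small C d (a ℚ.- c) γ (ε ℚ.* ½) C>0 Cγ≡ε/2 d≤C a-c<γ) ⟩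
      ε ℚ.* ½ ℚ.+ ε ℚ.* ½
        ≡⟨ halves ε ⟩
      ε ∎
    where open ℚ.≤-Reasoning

  abstract
    *-cauchy : ∀ {x y} → IsCauchy x → IsCauchy y → IsCauchy (λ n → x n ℚ.* y n)
    *-cauchy {x} {y} cx cy ε 0<ε =
      let B , B>0 , K , x≤B = eventually-bounded {x} cx
          C , C>0 , L , y≤C = eventually-bounded {y} cy
          β , β>0 , Bβ≡ε/2  = scaled B B>0 (ε ℚ.* ½) (half-pos ε 0<ε)
          γ , γ>0 , Cγ≡ε/2  = scaled C C>0 (ε ℚ.* ½) (half-pos ε 0<ε)
          M , p             = cy β β>0
          N , q             = cx γ γ>0
      in (K ⊔ L) ⊔ (M ⊔ N) , λ m n m≥ n≥ →
        let mKL = ℕ.m⊔n≤o⇒m≤o (K ⊔ L) (M ⊔ N) m≥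
            nKL = ℕ.m⊔n≤o⇒m≤o (K ⊔ L) (M ⊔ N) n≥
            mMN = ℕ.m⊔n≤o⇒n≤o (K ⊔ L) (M ⊔ N) m≥
            nMN = ℕ.m⊔n≤o⇒n≤o (K ⊔ L) (M ⊔ N) n≥
        in *-close (x m) (y m) (x n) (y n) B C β γ ε B>0 C>0 Bβ≡ε/2 Cγ≡ε/2
             (x≤B m (ℕ.m⊔n≤o⇒m≤o K L mKL)) (y≤C n (ℕ.m⊔n≤o⇒n≤o K L nKL))
             (p m n (ℕ.m⊔n≤o⇒m≤o M N mMN) (ℕ.m⊔n≤o⇒m≤o M N nMN))
             (q m n (ℕ.m⊔n≤o⇒n≤o M N mMN) (ℕ.m⊔n≤o⇒n≤o M N nMN))

fromℚ : ℚ → ℝ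
fromℚ q = mkℝ (λ _ → q) λ ε 0<ε →
  0 , λ _ _ _ _ → subst (λ t → ℚ.∣ t ∣ ℚ.< ε) (sym (ℚ.+-inverseʳ q)) 0<ε

fromℕ : ℕ → ℝ
fromℕ k = fromℚ (+ k ℚ./ 1)

infixl 6 _+_
infixl 7 _*_
infix  4 _<_ _≤_

_+_ : ℝ → ℝ → ℝ
x + y = mkℝ (λ n → seq x n ℚ.+ seq y n) (+-cauchy {seq x} {seq y} (cauchy x) (cauchy y))

_*_ : ℝ → ℝ → ℝ
x * y = mkℝ (λ n → seq x n ℚ.* seq y n) (*-cauchy {seq x} {seq y} (cauchy x) (cauchy y))

-- The sequences must eventually be separated by a fixed positive rational;
-- termwise strict inequality alone would not separate the limits.
_<_ : ℝ → ℝ → Set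
x < y = ∃[ ε ] (0ℚ ℚ.< ε × ∃[ N ] (∀ n → N ≤ℕ n → seq x n ℚ.+ ε ℚ.≤ seq y n))

_≤_ : ℝ → ℝ → Set
x ≤ y = ¬ (y < x)

------------------------------------------------------------------------
-- Finite simple graphs

record Graph (n : ℕ) : Set₁ where
  field
    Adj     : Rel (Fin n) 0ℓ
    adj?    : Decidable Adj
    adj-sym : Symmetric Adj
    no-loop : ∀ v → ¬ Adj v v

open Graph public

#_ : ∀ {n} {P : U.Pred (Fin n) 0ℓ} → U.Decidable P → ℕ
#_ {n} P? = length (filter P? (allFin n))

degree : ∀ {n} → Graph n → Fin n → ℕ
degree G v = # adj? G v

-- Every degree is below n, so for n ≥ 1 the default value n of the empty
-- minimum is never attained and δ G is the minimum degree.
δ : ∀ {n} → Graph n → ℕ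
δ {n} G = min n (map (degree G) (allFin n))

-- A {-1,1}-labelling of the edges.  The symmetry law, applied twice, also
-- makes the label independent of the proof of adjacency.
record Labelling {n} (G : Graph n) : Set where
  field
    label     : ∀ u v → Adj G u v → Sign
    label-sym : ∀ u v (p : Adj G u v) (q : Adj G v u) → label u v p ≡ label v u q

open Labelling public

module _ {n} {G : Graph n} (f : Labelling G) where

  HasLabel : Sign → Fin n → Fin n → Set
  HasLabel s v u = Σ (Adj G v u) λ p → label f v u p ≡ s

  hasLabel? : ∀ s v → U.Decidable (HasLabel s v)
  hasLabel? s v u with adj? G v u
  ... | no ¬p = no λ (p , _) → ¬p p
  ... | yes p with label f v u p Sign.≟ s
  ...   | yes e = yes (p , e)
  ...   | no ¬e = no λ (q , e) →
          ¬e (trans (label-sym f v u p (adj-sym G q))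
                    (trans (sym (label-sym f v u q (adj-sym G q))) e))

  labelDegree : Sign → Fin n → ℕ
  labelDegree s v = # hasLabel? s v

  Balanced : ℝ → Fin n → Set
  Balanced ν v = (ν * fromℕ n ≤ fromℕ (labelDegree Sign.+ v))
               × (ν * fromℕ n ≤ fromℕ (labelDegree Sign.- v))

-- "The number of v satisfying P is at least x", for a P that need not be
-- decidable (inequalities between reals are not).
AtLeast : ∀ {n} → ℝ → (Fin n → Set) → Set
AtLeast {n} x P = ∃ λ (S : Subset n) → (∀ {v} → v ∈ S → P v) × x ≤ fromℕ ∣ S ∣

------------------------------------------------------------------------
-- Hamilton cycles

next : ∀ {n} → Fin n → Fin n
next {n} i = _mod_ (suc (toℕ i)) n {{nonZeroIndex i}}

-- A cyclic ordering of all the vertices, successive ones being adjacent.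
-- By 3 ≤ n, the n edges {order i , order (next i)} are pairwise distinct.
record HamiltonCycle {n} (G : Graph n) : Set where
  field
    3≤n       : 3 ≤ℕ n
    order     : Fin n → Fin n
    injective : Injective _≡_ _≡_ order
    adjacent  : ∀ i → Adj G (order i) (order (next i))

open HamiltonCycle public

discrepancy : ∀ {n} {G : Graph n} → Labelling G → HamiltonCycle G → ℕ
discrepancy f H =
  ℤ.∣ sum (λ i → label f (order H i) (order H (next i)) (adjacent H i) ◃ 1) ∣

{-# OPTIONS --safe #-}
module Submission where

-- For a triangle vab let T = f(va) + f(vb) - f(ab), the change of the label sum when v is inserted
-- into the edge ab of a cycle.  A gadget is a vertex v with two disjoint edges ab and cd in its
-- neighbourhood such that the two values of T differ.  Given k disjoint gadgets, remove their
-- vertices v, take a Hamilton cycle of the rest that contains all the edges ab and cd (it exists by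
-- Dirac's argument), and reinsert each v into ab or into cd: the two extreme choices have label sums
-- that differ by at least 2k.
--
-- Suppose only few disjoint gadgets exist, and delete a maximal family of them.  In what remains T
-- depends on v only, and an edge uv has label + or - according to whether T(u) + T(v) is 2 or -2.  As
-- any two vertices have a common neighbour, either T takes only the values 1 and -3, or only -1 and 3.
-- In the first case every - edge meets a vertex with T = -3, all of whose edges are -; the second case
-- is symmetric.  Such vertices are not balanced, so there are fewer than n/4 of them, and a Hamilton
-- cycle has at most two edges at each: every Hamilton cycle has large discrepancy.
--
-- When νn is small only a nonzero label sum is needed, but then the minimum degree may be as small as
-- (n + 1)/2, which is too little to force ab and cd into one cycle.  If it is (n + 1)/2, then n is odd;
-- otherwise a Hamilton cycle of G - v has at least three edges inside N(v), all with the same T, and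
-- rerouting it through any chord cd inside N(v) keeps one of them.

import Data.Integer.Properties as ℤ

-- The quantitative bookkeeping is done in integers. Let q be the minimum of 2δ - n, 4|S| - 3n and
-- the least label degree m over S; a late term a of the sequence ν satisfies an < q + 1. A family
-- of k gadgets costs k deleted apexes and 4k protected ends, so Dirac's count becomes n + 5k ≤ 2δ.
-- If there is no such family, a set X with |X| ≤ 5k blocks all gadgets, and counting the
-- exceptional vertices needs 3n + 4|X| + k ≤ 4|S|, that is, a surplus of 21k. Taking k = ⌊q/25⌋
-- meets every demand and leaves q < 50k; together with a < 2 this yields the factor 1/500. For q <
-- 25 one unit of discrepancy is enough. In that last case the degrees pay for protecting one vertex
-- only. A rerouting through the chord cd can then fail, but only if the links leaving c and d lie
-- among exactly three suitable links of the cycle. The mirror image of the cycle adds the two links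
-- entering c and d, which makes four.

module Combinatorics where

  open import Algebra.Properties.CommutativeMonoid.Sum ℤ.+-0-commutativeMonoid
    using (sum-cong-≗) renaming (sum to sumℤ)
  open import Data.Bool using (Bool; true; false; not; _∧_; _∨_; if_then_else_)
  import Data.Bool.Properties as Bool
  open import Data.Fin using (Fin; zero; suc; _≟_; toℕ)
  open import Data.Fin.Properties using (any?; toℕ-fromℕ<; toℕ<n; toℕ-injective; nonZeroIndex)
  open import Data.Fin.Subset using (Subset; ∣_∣) renaming (_∈_ to _∈ˢ_)
  open import Data.Fin.Subset.Properties using () renaming (_∈?_ to _∈ˢ?_)
  import Data.Integer as ℤ
  import Data.Integer.Tactic.RingSolver as ℤ-Solver
  open import Data.List using (List; []; _∷_; _++_; _∷ʳ_; reverse; length; map; filter; allFin; concatMap; InitLast; initLast; _∷ʳ′_)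
  open import Data.List.Extrema.Nat using (min; min≤v⁺; min≤⊤; min≤xs; argmin-all)
  open import Data.List.Membership.Propositional using (_∈_; _∉_; lose)
  open import Data.List.Membership.Propositional.Properties
    using (∈-allFin; ∈-∃++; ∈-++⁺ˡ; ∈-++⁺ʳ; ∈-map⁺; ∈-filter⁺; ∈-filter⁻; ∈-concatMap⁺)
  open import Data.List.Properties
    using (++-assoc; unfold-reverse; reverse-++; length-++; length-tabulate; length-map; map-∘; map-tabulate; ∷-injectiveʳ)
  open import Data.List.Relation.Binary.Permutation.Propositional as ↭
    using (_↭_; ↭-sym; ↭-trans; ↭-refl; ↭-reflexive; ↭⇒↭ₛ)
  open import Data.List.Relation.Binary.Permutation.Propositional.Properties as ↭
    using (++-comm; ↭-reverse; ↭-length; shift; shifts; ∈-resp-↭; ∷↭∷ʳ)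
  import Data.List.Relation.Binary.Permutation.Setoid.Properties as ↭ₛ
  open import Data.List.Relation.Unary.All as All using (All; []; _∷_)
  import Data.List.Relation.Unary.All.Properties as All
  open import Data.List.Relation.Unary.AllPairs as AllPairs using (AllPairs; []; _∷_)
  import Data.List.Relation.Unary.AllPairs.Properties as AllPairs
  open import Data.List.Relation.Unary.Any using (here; there)
  open import Data.List.Relation.Unary.Any.Properties using (map⁺)
  import Data.List.Relation.Unary.Unique.DecPropositional as DecUnique
  open import Data.List.Relation.Unary.Unique.Propositional using (Unique)
  open import Data.List.Relation.Unary.Unique.Propositional.Properties using (allFin⁺)
  open import Data.Nat as ℕ using (ℕ; zero; suc; _+_; _*_; _∸_; _≤_; _<_; z≤n; s≤s; s≤s⁻¹; _<?_; _≤?_; NonZero; _/_; _%_)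
  open import Data.Nat.DivMod using (m≡m%n+[m/n]*n; m%n<n; m<n⇒m%n≡m; n%n≡0)
  open import Data.Nat.ListAction using (sum)
  open import Data.Nat.ListAction.Properties using (sum-↭)
  open import Data.Nat.Properties hiding (_≟_)
  open import Data.Nat.Tactic.RingSolver using (solve-∀)
  open import Data.Product using (Σ; ∃; ∃₂; _×_; _,_; proj₁; proj₂)
  import Data.Sign as Sign
  open import Data.Sum using (_⊎_; inj₁; inj₂)
  open import Data.Vec as Vec using ([]; _∷_)
  open import Data.Vec.Properties using (lookup⇒[]=)
  open import Function using (_∘_; id; mk⇔)
  open import Level using (0ℓ)
  open import Relation.Binary.PropositionalEquality
  open import Relation.Nullary using (Dec; yes; no; contradiction; does; ¬_; ¬?)
  open import Relation.Nullary.Decidable using (dec-true; dec-false; does-⇔; decidable-stable; _×-dec_; _⊎-dec_)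
  import Relation.Unary as U
  open import Defs hiding (_+_; _*_; _<_; _≤_; δ)
  import Defs

  private variable
    A : Set

  -- Counting, and edge weights of walks and cycles.

  ⟦_⟧ : Bool → ℕ
  ⟦ true ⟧  = 1
  ⟦ false ⟧ = 0

  ⟦⟧≤1 : ∀ b → ⟦ b ⟧ ≤ 1
  ⟦⟧≤1 true  = ≤-refl
  ⟦⟧≤1 false = z≤n

  witness : ∀ {P : Set} (d : Dec P) → ⟦ does d ⟧ ≢ 0 → P
  witness (yes p) _  = p
  witness (no _)  ≢0 = contradiction refl ≢0

  Fin⇒0< : ∀ {n} → Fin n → 0 < n
  Fin⇒0< zero    = s≤s z≤n
  Fin⇒0< (suc _) = s≤s z≤n

  ∑ : (A → ℕ) → List A → ℕ
  ∑ h xs = sum (map h xs)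

  ∑-↭ : ∀ (h : A → ℕ) {xs ys} → xs ↭ ys → ∑ h xs ≡ ∑ h ys
  ∑-↭ h p = sum-↭ (↭.map⁺ h p)

  ∑-mono : ∀ {h k : A → ℕ} → (∀ x → h x ≤ k x) → ∀ xs → ∑ h xs ≤ ∑ k xs
  ∑-mono h≤k []       = z≤n
  ∑-mono h≤k (x ∷ xs) = +-mono-≤ (h≤k x) (∑-mono h≤k xs)

  interchange : ∀ a b c d → (a + b) + (c + d) ≡ (a + c) + (b + d)
  interchange = solve-∀

  ∑-+ : ∀ (h k : A → ℕ) xs → ∑ (λ x → h x + k x) xs ≡ ∑ h xs + ∑ k xs
  ∑-+ h k []       = refl
  ∑-+ h k (x ∷ xs) rewrite ∑-+ h k xs = interchange (h x) (k x) (∑ h xs) (∑ k xs)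

  ∑-1 : ∀ (xs : List A) → ∑ (λ _ → 1) xs ≡ length xs
  ∑-1 []       = refl
  ∑-1 (x ∷ xs) = cong suc (∑-1 xs)

  ∑-++ : ∀ (h : A → ℕ) xs ys → ∑ h (xs ++ ys) ≡ ∑ h xs + ∑ h ys
  ∑-++ h []       ys = refl
  ∑-++ h (x ∷ xs) ys rewrite ∑-++ h xs ys = sym (+-assoc (h x) (∑ h xs) (∑ h ys))

  ∑-∷ʳ : ∀ (h : A → ℕ) xs y → ∑ h (xs ∷ʳ y) ≡ ∑ h xs + h y
  ∑-∷ʳ h xs y = trans (∑-++ h xs (y ∷ [])) (cong (∑ h xs +_) (+-identityʳ (h y)))

  -- Edge multisets of walks and cycles are compared through their total weights: an identity between
  -- them is stated for all (symmetric) weights w.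
  along : (A → A → ℕ) → A → List A → A → ℕ
  along w x []       y = w x y
  along w x (z ∷ zs) y = w x z + along w z zs y

  along-++ : ∀ (w : A → A → ℕ) x ys z zs y →
    along w x (ys ++ z ∷ zs) y ≡ along w x ys z + along w z zs y
  along-++ w x []       z zs y = refl
  along-++ w x (u ∷ us) z zs y =
    trans (cong (w x u +_) (along-++ w u us z zs y)) (sym (+-assoc (w x u) _ _))

  along-reverse : ∀ {w : A → A → ℕ} → (∀ u v → w u v ≡ w v u) → ∀ x ys y →
    along w x ys y ≡ along w y (reverse ys) x
  along-reverse         w-comm x []       y = w-comm x y
  along-reverse {w = w} w-comm x (z ∷ zs) y = begin
    w x z + along w z zs y                     ≡⟨ +-comm (w x z) _ ⟩
    along w z zs y + w x z                     ≡⟨ cong₂ _+_ (along-reverse w-comm z zs y) (w-comm x z) ⟩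
    along w y (reverse zs) z + w z x           ≡⟨ along-++ w y (reverse zs) z [] x ⟨
    along w y (reverse zs ∷ʳ z) x              ≡⟨ cong (λ l → along w y l x) (unfold-reverse z zs) ⟨
    along w y (reverse (z ∷ zs)) x             ∎
    where open ≡-Reasoning

  along-mono : ∀ {w w′ : A → A → ℕ} → (∀ u v → w u v ≤ w′ u v) → ∀ x ys y →
    along w x ys y ≤ along w′ x ys y
  along-mono w≤w′ x []       y = w≤w′ x y
  along-mono w≤w′ x (z ∷ zs) y = +-mono-≤ (w≤w′ x z) (along-mono w≤w′ z zs y)

  along-+ : ∀ (w w′ : A → A → ℕ) x ys y →
    along (λ u v → w u v + w′ u v) x ys y ≡ along w x ys y + along w′ x ys y
  along-+ w w′ x []       y = refl
  along-+ w w′ x (z ∷ zs) y rewrite along-+ w w′ z zs y =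
    interchange (w x z) (w′ x z) (along w z zs y) (along w′ z zs y)

  along-ends : ∀ (h : A → ℕ) x ys y →
    along (λ u v → h u + h v) x ys y ≡ h x + (∑ h ys + ∑ h ys) + h y
  along-ends h x []       y = cong (_+ h y) (sym (+-identityʳ (h x)))
  along-ends h x (z ∷ zs) y rewrite along-ends h z zs y = lemma (h x) (h z) (∑ h zs) (h y)
    where
    lemma : ∀ a b s c → (a + b) + ((b + (s + s)) + c) ≡ (a + ((b + s) + (b + s))) + c
    lemma = solve-∀

  along-1 : ∀ (x : A) ys y → along (λ _ _ → 1) x ys y ≡ suc (length ys)
  along-1 x []       y = refl
  along-1 x (z ∷ zs) y = cong suc (along-1 z zs y)

  along-0 : ∀ (x : A) ys y → along (λ _ _ → 0) x ys y ≡ 0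
  along-0 x []       y = refl
  along-0 x (z ∷ zs) y = along-0 z zs y

  infixr 5 _⟲_
  record Cycle (A : Set) : Set where
    constructor _⟲_
    field
      base : A
      rest : List A

  vertices : Cycle A → List A
  vertices (x ⟲ xs) = x ∷ xs

  ∮ : (A → A → ℕ) → Cycle A → ℕ
  ∮ w (x ⟲ xs) = along w x xs x

  infix 4 _≃_
  record _≃_ (C D : Cycle A) : Set where
    constructor _&_
    field
      vertices-↭ : vertices C ↭ vertices D
      ∮-≡        : ∀ w → ∮ w C ≡ ∮ w D
  open _≃_ public

  ≃-refl : {C : Cycle A} → C ≃ C
  ≃-refl = ↭-refl & λ _ → refl

  ≃-trans : {C D E : Cycle A} → C ≃ D → D ≃ E → C ≃ E
  ≃-trans (p & f) (q & g) = ↭-trans p q & λ w → trans (f w) (g w)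

  rotate : ∀ (x : A) ys z zs → (x ⟲ ys ++ z ∷ zs) ≃ (z ⟲ zs ++ x ∷ ys)
  rotate x ys z zs = ++-comm (x ∷ ys) (z ∷ zs) & λ w → begin
    along w x (ys ++ z ∷ zs) x        ≡⟨ along-++ w x ys z zs x ⟩
    along w x ys z + along w z zs x   ≡⟨ +-comm (along w x ys z) _ ⟩
    along w z zs x + along w x ys z   ≡⟨ along-++ w z zs x ys z ⟨
    along w z (zs ++ x ∷ ys) z        ∎
    where open ≡-Reasoning

  -- A link is exhibited by turning the cycle until the link is its closing step, from the last
  -- vertex `source` back to the base `target`; there a vertex can be inserted or the cycle cut
  -- open.
  record Link (P : A → A → Set) (C : Cycle A) : Set where
    constructor link
    field
      {source target} : A
      inner           : List A
      rotated         : C ≃ (target ⟲ inner ∷ʳ source)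
      holds           : P source target

  private
    -- The walk x, `ms`, y is still to be searched and `acc` collects the vertices already passed,
    -- so every unsuccessful step is a rotation of the same cycle.
    link-along : ∀ {w w′ : A → A → ℕ} x ms y acc →
      along w x ms y < along w′ x ms y →
      Link (λ u v → w u v < w′ u v) (x ⟲ ms ++ y ∷ acc)
    link-along x [] y acc lt = link acc (rotate x [] y acc) lt
    link-along {w = w} {w′} x (m ∷ ms) y acc lt with w x m <? w′ x m
    ... | yes now = link (ms ++ y ∷ acc) (rotate x [] m (ms ++ y ∷ acc)) now
    ... | no ¬now with link-along m ms y (acc ∷ʳ x) lt′
      where
      lt′ : along w m ms y < along w′ m ms y
      lt′ = ≰⇒> λ ge → <⇒≱ lt (+-mono-≤ (≮⇒≥ ¬now) ge)
    ...   | link inner (p & f) h = link inner (≃-trans shifted (p & f)) h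
      where
      shifted : (x ⟲ m ∷ ms ++ y ∷ acc) ≃ (m ⟲ ms ++ y ∷ (acc ∷ʳ x))
      shifted = subst (λ l → (x ⟲ m ∷ ms ++ y ∷ acc) ≃ (m ⟲ l))
                      (++-assoc ms (y ∷ acc) (x ∷ []))
                      (rotate x [] m (ms ++ y ∷ acc))

  find-link : ∀ {w w′ : A → A → ℕ} x m ms → let C = x ⟲ m ∷ ms in
    ∮ w C < ∮ w′ C → Link (λ u v → w u v < w′ u v) C
  find-link {w = w} {w′} x m ms lt with w x m <? w′ x m
  ... | yes now = link ms (rotate x [] m ms) now
  ... | no ¬now with link-along m ms x [] (≰⇒> λ ge → <⇒≱ lt (+-mono-≤ (≮⇒≥ ¬now) ge))
  ...   | link inner r h = link inner (≃-trans (rotate x [] m ms) r) h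

  record Crossing (P Q : A → Bool) (xs : List A) : Set where
    constructor crossing
    field
      before     : List A
      {left right} : A
      after      : List A
      split      : xs ≡ before ++ left ∷ right ∷ after
      left-Q     : Q left ≡ true
      right-P    : P right ≡ true

  private
    -- Without a crossing, each pair of neighbouring positions carries at most one of Q on the left
    -- and P on the right; the last position adds at most one more for Q.
    crossing-or-few : ∀ (P Q : A → Bool) u ms → Crossing P Q (u ∷ ms) ⊎
      ∑ (⟦_⟧ ∘ P) ms + ∑ (⟦_⟧ ∘ Q) (u ∷ ms) ≤ suc (length ms)
    crossing-or-few P Q u [] = inj₂ (subst (_≤ 1) (sym (+-identityʳ _)) (⟦⟧≤1 (Q u)))
    crossing-or-few P Q u (v ∷ ms) with crossing-or-few P Q v ms
    ... | inj₁ (crossing bs as eq q p) = inj₁ (crossing (u ∷ bs) as (cong (u ∷_) eq) q p)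
    ... | inj₂ le with Q u in qu | P v in pv
    ...   | true  | true  = inj₁ (crossing [] ms refl qu pv)
    ...   | true  | false = inj₂ (≤-trans (≤-reflexive (+-suc _ _)) (s≤s le))
    ...   | false | true  = inj₂ (s≤s le)
    ...   | false | false = inj₂ (m≤n⇒m≤1+n le)

  crossing-exists : ∀ (P Q : A → Bool) ms →
    2 + length ms ≤ ∑ (⟦_⟧ ∘ P) ms + ∑ (⟦_⟧ ∘ Q) ms → Crossing P Q ms
  crossing-exists P Q [] ()
  crossing-exists P Q (u ∷ ms) many with crossing-or-few P Q u ms
  ... | inj₁ c  = c
  ... | inj₂ le = contradiction (≤-trans many (≤-trans
          (≤-reflexive (+-assoc ⟦ P u ⟧ _ _)) (+-mono-≤ (⟦⟧≤1 (P u)) le))) (<-irrefl refl)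

  Unique-resp-↭ : ∀ {A : Set} {xs ys : List A} → xs ↭ ys → Unique xs → Unique ys
  Unique-resp-↭ p = ↭ₛ.Unique-resp-↭ (setoid _) (↭⇒↭ₛ p)

  insert-link : ∀ {A : Set} {C : Cycle A} {a b ms} (z : A) → C ≃ (b ⟲ ms ∷ʳ a) →
    ∀ w → ∮ w (z ⟲ b ∷ ms ∷ʳ a) + w a b ≡ ∮ w C + (w a z + w z b)
  insert-link {C = C} {a} {b} {ms} z (_ & same) w = begin
    (w z b + along w b (ms ∷ʳ a) z) + w a b      ≡⟨ cong (λ s → (w z b + s) + w a b) (along-++ w b ms a [] z) ⟩
    (w z b + (along w b ms a + w a z)) + w a b   ≡⟨ lemma (w z b) (along w b ms a) (w a z) (w a b) ⟩
    (along w b ms a + w a b) + (w a z + w z b)   ≡⟨ cong (_+ (w a z + w z b)) (along-++ w b ms a [] b) ⟨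
    along w b (ms ∷ʳ a) b + (w a z + w z b)      ≡⟨ cong (_+ (w a z + w z b)) (same w) ⟨
    ∮ w C + (w a z + w z b)                      ∎
    where
    open ≡-Reasoning
    lemma : ∀ p q r s → (p + (q + r)) + s ≡ (q + s) + (r + p)
    lemma = solve-∀

  module _ {n : ℕ} where

    mem : Fin n → List (Fin n) → Bool
    mem z []      = false
    mem z (c ∷ Z) = does (z ≟ c) ∨ mem z Z

    mem-false : ∀ {z Z} → mem z Z ≡ false → z ∉ Z
    mem-false {z} {c ∷ Z} m z∈ with z ≟ c
    mem-false {z} {c ∷ Z} m (here z≡c) | no z≢c = z≢c z≡c
    mem-false {z} {c ∷ Z} m (there z∈) | no z≢c = mem-false m z∈

    ∈⇒mem : ∀ {z Z} → z ∈ Z → mem z Z ≡ true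
    ∈⇒mem {z} {Z} z∈ with mem z Z in eq
    ... | true  = refl
    ... | false = contradiction z∈ (mem-false eq)

    ∑-≟-absent : ∀ {c : Fin n} {xs} → All (c ≢_) xs → ∑ (λ z → ⟦ does (z ≟ c) ⟧) xs ≡ 0
    ∑-≟-absent [] = refl
    ∑-≟-absent {c} {x ∷ xs} (c≢x ∷ ps) rewrite dec-false (x ≟ c) (c≢x ∘ sym) = ∑-≟-absent ps

    ∑-≟ : ∀ (c : Fin n) {xs} → Unique xs → ∑ (λ z → ⟦ does (z ≟ c) ⟧) xs ≤ 1
    ∑-≟ c [] = z≤n
    ∑-≟ c {x ∷ xs} (x∉ ∷ u) with x ≟ c
    ... | yes refl = ≤-reflexive (cong suc (∑-≟-absent x∉))
    ... | no  _    = ∑-≟ c u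

    ∑-mem : ∀ Z {xs} → Unique xs → ∑ (λ z → ⟦ mem z Z ⟧) xs ≤ length Z
    ∑-mem []      {xs} u = ≤-reflexive (zeros xs)
      where
      zeros : ∀ xs → ∑ (λ _ → 0) xs ≡ 0
      zeros []       = refl
      zeros (_ ∷ xs) = zeros xs
    ∑-mem (c ∷ Z) {xs} u = begin
      ∑ (λ z → ⟦ does (z ≟ c) ∨ mem z Z ⟧) xs                 ≤⟨ ∑-mono (λ z → ∨≤+ (does (z ≟ c)) (mem z Z)) xs ⟩
      ∑ (λ z → ⟦ does (z ≟ c) ⟧ + ⟦ mem z Z ⟧) xs             ≡⟨ ∑-+ _ _ xs ⟩
      ∑ (λ z → ⟦ does (z ≟ c) ⟧) xs + ∑ (λ z → ⟦ mem z Z ⟧) xs ≤⟨ +-mono-≤ (∑-≟ c u) (∑-mem Z u) ⟩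
      suc (length Z)                                          ∎
      where
      open ≤-Reasoning
      ∨≤+ : ∀ a b → ⟦ a ∨ b ⟧ ≤ ⟦ a ⟧ + ⟦ b ⟧
      ∨≤+ true  b = s≤s z≤n
      ∨≤+ false b = ≤-refl

  Comm : {A : Set} → (A → A → ℕ) → Set
  Comm w = ∀ u v → w u v ≡ w v u

  mem-++ : ∀ {n} (z : Fin n) X Y → mem z (X ++ Y) ≡ mem z X ∨ mem z Y
  mem-++ z []      Y = refl
  mem-++ z (c ∷ X) Y with does (z ≟ c)
  ... | true  = refl
  ... | false = mem-++ z X Y

  ∨-false : ∀ {a b} → a ∨ b ≡ false → a ≡ false × b ≡ false
  ∨-false {false} {false} _ = refl , refl

  -- A linear inequality by certificate: `a ≤ b` is the goal with `m` added to both sides, and the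
  -- two equations are usually ring identities.
  ≤-by : ∀ {x y a b} m → a ≤ b → x + m ≡ a → b ≡ y + m → x ≤ y
  ≤-by m a≤b refl refl = +-cancelʳ-≤ m _ _ a≤b

  abstract
    complement : ∀ {A : Set} (ys : List A) {xs} → Unique ys → All (_∈ xs) ys → ∃ λ zs → xs ↭ ys ++ zs
    complement []       {xs} _        _         = xs , ↭-refl
    complement (y ∷ ys) {xs} (y∉ ∷ u) (y∈ ∷ ∈s) with ∈-∃++ y∈
    ... | ps , qs , refl with complement ys {ps ++ qs} u (All.zipWith other (y∉ , ∈s))
      where
      other : ∀ {z} → y ≢ z × z ∈ ps ++ y ∷ qs → z ∈ ps ++ qs
      other (y≢z , z∈) with ∈-resp-↭ (shift y ps qs) z∈
      ... | here z≡y = contradiction (sym z≡y) y≢z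
      ... | there z∈ = z∈
    ...   | zs , p = zs , ↭-trans (shift y ps qs) (↭.prep y p)

  along-consecutive : ∀ {A : Set} (w : A → A → ℕ) {x xs} y {a b} ps qs →
    x ∷ xs ≡ ps ++ a ∷ b ∷ qs → w a b ≤ along w x xs y
  along-consecutive w y {a} {b} [] qs refl = m≤m+n (w a b) _
  along-consecutive w y (x ∷ []) qs refl = ≤-trans (along-consecutive w y [] qs refl) (m≤n+m _ (w x _))
  along-consecutive w y (x ∷ z ∷ ps) qs refl = ≤-trans (along-consecutive w y (z ∷ ps) qs refl) (m≤n+m _ (w x z))

  module _ {n : ℕ} where

    same-edge? : ∀ (p q u v : Fin n) → Dec ((u ≡ p × v ≡ q) ⊎ (u ≡ q × v ≡ p))
    same-edge? p q u v = (u ≟ p ×-dec v ≟ q) ⊎-dec (u ≟ q ×-dec v ≟ p)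

    -- As a weight this counts the passages through the undirected edge pq, so `1 ≤ ∮ (edge p q) C`
    -- expresses that C contains it.
    edge : Fin n → Fin n → Fin n → Fin n → ℕ
    edge p q u v = ⟦ does (same-edge? p q u v) ⟧

    edge-comm : ∀ p q → Comm (edge p q)
    edge-comm p q u v = cong ⟦_⟧ (does-⇔ (mk⇔ turn turn) (same-edge? p q u v) (same-edge? p q v u))
      where
      turn : ∀ {u v} → (u ≡ p × v ≡ q) ⊎ (u ≡ q × v ≡ p) → (v ≡ p × u ≡ q) ⊎ (v ≡ q × u ≡ p)
      turn (inj₁ (u≡p , v≡q)) = inj₂ (v≡q , u≡p)
      turn (inj₂ (u≡q , v≡p)) = inj₁ (v≡p , u≡q)

    edge-refl : ∀ p q → edge p q p q ≡ 1
    edge-refl p q = cong ⟦_⟧ (dec-true (same-edge? p q p q) (inj₁ (refl , refl)))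

    edge-cases : ∀ {p q u v} → edge p q u v ≢ 0 → (u ≡ p × v ≡ q) ⊎ (u ≡ q × v ≡ p)
    edge-cases {p} {q} {u} {v} = witness (same-edge? p q u v)

    edge-absent : ∀ {p q u v} → u ∉ p ∷ q ∷ [] → edge p q u v ≡ 0
    edge-absent {p} {q} {u} {v} u∉ with edge p q u v in eq
    ... | zero  = refl
    ... | suc _ with edge-cases {p} {q} {u} {v} (λ z → 1+n≢0 (trans (sym eq) z))
    ...   | inj₁ (u≡p , _) = contradiction (here u≡p) u∉
    ...   | inj₂ (u≡q , _) = contradiction (there (here u≡q)) u∉

    find-edge : ∀ {p q} → p ≢ q → ∀ C → 1 ≤ ∮ (edge p q) C →
      Link (λ u v → (u ≡ p × v ≡ q) ⊎ (u ≡ q × v ≡ p)) C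
    -- A cycle with a single vertex closes by a loop, which is no edge with two distinct ends.
    find-edge {p} {q} p≢q (x ⟲ []) pos with edge-cases {p} {q} {x} {x} (λ z → <⇒≢ pos (sym z))
    ... | inj₁ (x≡p , x≡q) = contradiction (trans (sym x≡p) x≡q) p≢q
    ... | inj₂ (x≡q , x≡p) = contradiction (trans (sym x≡p) x≡q) p≢q
    find-edge {p} {q} p≢q (x ⟲ m ∷ ms) pos
      with find-link {w = λ _ _ → 0} {edge p q} x m ms (subst (_< ∮ (edge p q) (x ⟲ m ∷ ms)) (sym (along-0 x (m ∷ ms) x)) pos)
    ... | link {u} {v} inner r h = link inner r (edge-cases {p} {q} {u} {v} (λ z → <⇒≢ h (sym z)))

  unique-split : ∀ {A : Set} {c : A} as {as′ bs bs′} → Unique (as ++ c ∷ bs) →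
    as ++ c ∷ bs ≡ as′ ++ c ∷ bs′ → bs ≡ bs′
  unique-split []       {[]}      u        refl = refl
  unique-split []       {_ ∷ as′} (c∉ ∷ _) refl = contradiction refl (All.lookup c∉ (∈-++⁺ʳ as′ (here refl)))
  unique-split (a ∷ as) {[]}      (c∉ ∷ _) refl = contradiction refl (All.lookup c∉ (∈-++⁺ʳ as (here refl)))
  unique-split (a ∷ as) {_ ∷ as′} (_ ∷ u)  eq   = unique-split as u (∷-injectiveʳ eq)

  -- Meant for a path that traverses a chord from d to c: a link removed from it that does not start
  -- at d cannot be the chord.
  no-return : ∀ {A : Set} {c d : A} ps {rs as bs} → Unique (ps ++ d ∷ c ∷ rs) →
    ps ++ d ∷ c ∷ rs ≢ as ++ c ∷ d ∷ bs
  no-return {c = c} {d} ps {rs} {as} {bs} u eq = repeated d∈rs u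
    where
    rs≡ : rs ≡ d ∷ bs
    rs≡ = unique-split (ps ∷ʳ d) (subst Unique (sym (++-assoc ps (d ∷ []) (c ∷ rs))) u)
            (trans (++-assoc ps (d ∷ []) (c ∷ rs)) eq)
    d∈rs : d ∈ rs
    d∈rs = subst (d ∈_) (sym rs≡) (here refl)
    repeated : ∀ {ps} → d ∈ rs → ¬ Unique (ps ++ d ∷ c ∷ rs)
    repeated {[]}     d∈ (d∉ ∷ _) = contradiction refl (All.lookup d∉ (there d∈))
    repeated {_ ∷ ps} d∈ (_ ∷ u)  = repeated {ps} d∈ u

  along-ends-≤ : ∀ {A : Set} (w : A → A → ℕ) c p ps d {ps′ m} → p ∷ ps ≡ ps′ ∷ʳ m →
    w c p + w m d ≤ along w c (p ∷ ps) d
  along-ends-≤ w c p ps d {[]}       refl = ≤-refl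
  along-ends-≤ w c p ps d {_ ∷ ps″} {m} refl = +-monoʳ-≤ (w c p)
    (≤-trans (m≤n+m (w m d) _) (≤-reflexive (sym (along-++ w p ps″ m [] d))))

  -- Dirac's theorem

  module Dirac {n : ℕ} (adj : Fin n → Fin n → Bool)
               (adj-comm : ∀ u v → adj u v ≡ adj v u)
               (adj-irrefl : ∀ v → adj v v ≡ false) where

    bad : Fin n → Fin n → ℕ
    bad u v = ⟦ not (adj u v) ⟧

    deg : Fin n → List (Fin n) → ℕ
    deg v xs = ∑ (λ u → ⟦ adj v u ⟧) xs

    bad-comm : Comm bad
    bad-comm u v = cong (λ b → ⟦ not b ⟧) (adj-comm u v)

    deg-minus : ∀ v Z {xs} → Unique xs →
      deg v xs ≤ ∑ (λ u → ⟦ adj v u ∧ not (mem u Z) ⟧) xs + length Z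
    deg-minus v Z {xs} u = begin
      deg v xs                                                     ≤⟨ ∑-mono (λ z → split (adj v z) (mem z Z)) xs ⟩
      ∑ (λ z → ⟦ adj v z ∧ not (mem z Z) ⟧ + ⟦ mem z Z ⟧) xs        ≡⟨ ∑-+ _ _ xs ⟩
      ∑ (λ z → ⟦ adj v z ∧ not (mem z Z) ⟧) xs + ∑ (λ z → ⟦ mem z Z ⟧) xs
                                                                   ≤⟨ +-monoʳ-≤ _ (∑-mem Z u) ⟩
      ∑ (λ z → ⟦ adj v z ∧ not (mem z Z) ⟧) xs + length Z           ∎
      where
      open ≤-Reasoning
      split : ∀ a b → ⟦ a ⟧ ≤ ⟦ a ∧ not b ⟧ + ⟦ b ⟧
      split true  true  = ≤-refl
      split true  false = ≤-refl
      split false b     = z≤n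

    -- The path x … u v … y, with x ~ v and y ~ u, becomes a cycle when its part x … u is reversed.
    record Reconnection (x : Fin n) (ms : List (Fin n)) (y : Fin n) (Z : List (Fin n)) : Set where
      constructor reconnection
      field
        cycle  : Cycle (Fin n)
        perm   : vertices cycle ↭ x ∷ ms ∷ʳ y
        {u v}  : Fin n
        {before after} : List (Fin n)
        split  : ms ≡ before ++ u ∷ v ∷ after
        x~v    : adj x v ≡ true
        y~u    : adj y u ≡ true
        u∉Z    : mem u Z ≡ false
        change : ∀ w → Comm w →
          ∮ w cycle + w u v ≡ along w x ms y + (w x v + w y u)

    -- Ore's pigeonhole on the interior of the path: the positions u outside Z with y ~ u, against
    -- the positions whose successor is a neighbour of x. Excluding Z costs at most |Z|.
    reconnect : ∀ x ms y Z → Unique ms → 2 + length ms + length Z ≤ deg x ms + deg y ms →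
      Reconnection x ms y Z
    reconnect x ms y Z uniq many
      with crossing-exists (adj x) (λ z → adj y z ∧ not (mem z Z)) ms enough
      where
      enough : 2 + length ms ≤ deg x ms + ∑ (λ z → ⟦ adj y z ∧ not (mem z Z) ⟧) ms
      enough = +-cancelʳ-≤ (length Z) _ _ (≤-trans many (≤-trans
        (+-monoʳ-≤ (deg x ms) (deg-minus y Z uniq)) (≤-reflexive (sym (+-assoc (deg x ms) _ _)))))
    ... | crossing ps {u} {v} qs refl q p = reconnection
      (u ⟲ reverse ps ++ x ∷ v ∷ qs ∷ʳ y) perm refl p (∧-left q) (∧-right {adj y u} q) change
      where
      ∧-left : ∀ {a b} → a ∧ b ≡ true → a ≡ true
      ∧-left {true} _ = refl
      ∧-right : ∀ {a b} → a ∧ not b ≡ true → b ≡ false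
      ∧-right {true} {false} _ = refl
      perm : u ∷ reverse ps ++ x ∷ v ∷ qs ∷ʳ y ↭ x ∷ (ps ++ u ∷ v ∷ qs) ∷ʳ y
      perm = begin
        u ∷ reverse ps ++ x ∷ v ∷ qs ∷ʳ y     ↭⟨ shift x (u ∷ reverse ps) _ ⟩
        x ∷ u ∷ reverse ps ++ v ∷ qs ∷ʳ y     ↭⟨ ↭.++⁺ˡ (x ∷ u ∷ []) (↭.++⁺ʳ _ (↭-reverse ps)) ⟩
        x ∷ u ∷ ps ++ v ∷ qs ∷ʳ y             ↭⟨ ↭.prep x (shift u ps _) ⟨
        x ∷ ps ++ u ∷ v ∷ qs ∷ʳ y             ≡⟨ cong (x ∷_) (++-assoc ps (u ∷ v ∷ qs) (y ∷ [])) ⟨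
        x ∷ (ps ++ u ∷ v ∷ qs) ∷ʳ y           ∎
        where open ↭.PermutationReasoning
      change : ∀ w → Comm w →
        along w u (reverse ps ++ x ∷ v ∷ qs ∷ʳ y) u + w u v
        ≡ along w x (ps ++ u ∷ v ∷ qs) y + (w x v + w y u)
      change w w-comm
        rewrite along-++ w u (reverse ps) x (v ∷ qs ∷ʳ y) u | along-++ w v qs y [] u
              | along-++ w x ps u (v ∷ qs) y | along-reverse w-comm x ps u
        = lemma (along w u (reverse ps) x) (w x v) (along w v qs y) (w y u) (w u v)
        where
        lemma : ∀ a b c d e → (a + (b + (c + d))) + e ≡ (a + (e + c)) + (b + d)
        lemma = solve-∀

    Unique-inner : ∀ {x : Fin n} {ms y} → Unique (x ∷ ms ∷ʳ y) → Unique ms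
    Unique-inner {ms = ms} {y} (_ ∷ u) with Unique-resp-↭ (↭-sym (∷↭∷ʳ y ms)) u
    ... | _ ∷ u′ = u′

    -- For symmetric `w` the condition, read in both orientations, confines `w` to edges with both
    -- ends in Z. Only the first vertex of a removed pair is known to avoid Z, and this already
    -- gives the pair weight 0.
    SupportedOn : List (Fin n) → (Fin n → Fin n → ℕ) → Set
    SupportedOn Z w = ∀ u v → w u v ≢ 0 → adj u v ≡ true × mem u Z ≡ true

    -- Starting from any cyclic order of the vertices, every non-adjacent pair of
    -- neighbours is removed by reversing a segment; edges with an end in Z are never given up.
    module _ (xs Z : List (Fin n)) (e : ℕ) (uniq : Unique xs)
             (deg-≥ : ∀ {v} → v ∈ xs → e ≤ deg v xs)
             (e-large : length xs + length Z ≤ e + e) where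

      private
        Goal : Cycle (Fin n) → Set
        Goal C = ∃ λ D → vertices D ↭ xs × ∮ bad D ≡ 0 ×
          (∀ w → Comm w → SupportedOn Z w → ∮ w C ≤ ∮ w D)

        improve : ∀ k C → vertices C ↭ xs → ∮ bad C ≤ k → Goal C
        improve k C p b≤k with ∮ bad C in b≡
        improve k       C p b≤k       | zero  = C , p , b≡ , λ _ _ _ → ≤-refl
        -- The only vertex has degree 0, so e = 0, against |xs| = 1.
        improve (suc k) (x ⟲ []) p (s≤s b≤k) | suc b = contradiction e-large (<⇒≱ small)
          where
          open ≤-Reasoning
          e≤0 : e ≤ 0
          e≤0 = begin
            e                  ≤⟨ deg-≥ (∈-resp-↭ p (here refl)) ⟩
            deg x xs           ≡⟨ ∑-↭ _ p ⟨
            ⟦ adj x x ⟧ + 0    ≡⟨ cong (λ b → ⟦ b ⟧ + 0) (adj-irrefl x) ⟩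
            0                  ∎
          small : e + e < length xs + length Z
          small = begin-strict
            e + e              ≤⟨ +-mono-≤ e≤0 e≤0 ⟩
            0                  <⟨ s≤s z≤n ⟩
            1 + length Z       ≡⟨ cong (_+ length Z) (↭-length p) ⟩
            length xs + length Z ∎
        improve (suc k) C@(x ⟲ m ∷ ms) p (s≤s b≤k) | suc b
          with find-link {w = λ _ _ → 0} {bad} x m ms
                 (subst₂ _<_ (sym (along-0 x (m ∷ ms) x)) (sym b≡) (s≤s z≤n))
        ... | link {t} {s} inner r st-bad = continue
          where
          s≁t : adj t s ≡ false
          s≁t = not-adjacent (adj t s) st-bad
            where
            not-adjacent : ∀ b → 0 < ⟦ not b ⟧ → b ≡ false
            not-adjacent false _ = refl
          p′ : s ∷ inner ∷ʳ t ↭ xs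
          p′ = ↭-trans (↭-sym (vertices-↭ r)) p
          len : 2 + length inner ≡ length xs
          len = trans (cong suc (trans (+-comm 1 _) (sym (length-++ inner)))) (↭-length p′)
          -- As s and t are not adjacent, all their neighbours are interior to the path and no
          -- degree is lost.
          deg-inner : ∀ v → v ∈ s ∷ inner ∷ʳ t → adj v s ≡ false → adj v t ≡ false → e ≤ deg v inner
          deg-inner v v∈ v≁s v≁t = ≤-trans (deg-≥ (∈-resp-↭ p′ v∈)) (≤-reflexive (begin
            deg v xs                               ≡⟨ ∑-↭ _ p′ ⟨
            ⟦ adj v s ⟧ + deg v (inner ∷ʳ t)       ≡⟨ cong (λ b → ⟦ b ⟧ + deg v (inner ∷ʳ t)) v≁s ⟩
            deg v (inner ∷ʳ t)                     ≡⟨ ∑-∷ʳ _ inner t ⟩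
            deg v inner + ⟦ adj v t ⟧              ≡⟨ cong (λ b → deg v inner + ⟦ b ⟧) v≁t ⟩
            deg v inner + 0                        ≡⟨ +-identityʳ _ ⟩
            deg v inner                            ∎))
            where open ≡-Reasoning
          many : 2 + length inner + length Z ≤ deg s inner + deg t inner
          many = begin
            2 + length inner + length Z ≡⟨ cong (_+ length Z) len ⟩
            length xs + length Z        ≤⟨ e-large ⟩
            e + e                       ≤⟨ +-mono-≤ (deg-inner s (here refl) (adj-irrefl s) (trans (adj-comm s t) s≁t))
                                                    (deg-inner t (∈-resp-↭ (∷↭∷ʳ t (s ∷ inner)) (here refl)) s≁t (adj-irrefl t)) ⟩
            deg s inner + deg t inner   ∎
            where open ≤-Reasoning
          R = reconnect s inner t Z (Unique-inner (Unique-resp-↭ (↭-sym p′) uniq)) many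
          open Reconnection R
          along-C : ∀ w → ∮ w C ≡ along w s inner t + w t s
          along-C w = trans (∮-≡ r w) (along-++ w s inner t [] s)
          -- The two new links are edges of the graph and the link ts that was cut is not, so the
          -- number of bad links drops.
          fewer : ∮ bad cycle ≤ k
          fewer = ≤-trans (≤-trans (m≤m+n _ (bad u v)) (≤-reflexive eq)) (≤-trans (s≤s⁻¹ lt) b≤k)
            where
            eq : ∮ bad cycle + bad u v ≡ along bad s inner t
            eq = trans (change bad bad-comm)
                   (trans (cong₂ (λ p q → along bad s inner t + (⟦ not p ⟧ + ⟦ not q ⟧)) x~v y~u) (+-identityʳ _))
            lt : suc (along bad s inner t) ≤ suc b
            lt = ≤-reflexive (trans (sym (trans (cong (λ q → along bad s inner t + ⟦ not q ⟧) s≁t) (+-comm _ 1)))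
                   (trans (sym (along-C bad)) b≡))
          continue : Goal C
          continue with improve k cycle (↭-trans perm p′) fewer
          ... | D , D↭ , good , kept = D , D↭ , good , λ w w-comm supp →
            ≤-trans (step w w-comm supp) (kept w w-comm supp)
            where
            step : ∀ w → Comm w → SupportedOn Z w → ∮ w C ≤ ∮ w cycle
            step w w-comm supp = begin
              ∮ w C                                         ≡⟨ along-C w ⟩
              along w s inner t + w t s                     ≡⟨ cong (along w s inner t +_) w-ts ⟩
              along w s inner t + 0                         ≤⟨ +-monoʳ-≤ (along w s inner t) z≤n ⟩
              along w s inner t + (w s v + w t u)           ≡⟨ change w w-comm ⟨
              ∮ w cycle + w u v                             ≡⟨ cong (∮ w cycle +_) w-uv ⟩
              ∮ w cycle + 0                                 ≡⟨ +-identityʳ _ ⟩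
              ∮ w cycle                                     ∎
              where
              open ≤-Reasoning
              zero-unless : ∀ a b → ¬ (adj a b ≡ true × mem a Z ≡ true) → w a b ≡ 0
              zero-unless a b ¬s with w a b in eq
              ... | zero  = refl
              ... | suc _ = contradiction (supp a b λ z → 1+n≢0 (trans (sym eq) z)) ¬s
              w-ts : w t s ≡ 0
              w-ts = zero-unless t s λ (a , _) → contradiction (trans (sym a) s≁t) λ ()
              w-uv : w u v ≡ 0
              w-uv = zero-unless u v λ (_ , m) → contradiction (trans (sym m) u∉Z) λ ()

      abstract
        dirac : ∀ C → vertices C ↭ xs → Goal C
        dirac C p = improve (∮ bad C) C p ≤-refl

    module _ (δ : ℕ) (δ-≤ : ∀ v → δ ≤ deg v (allFin n)) where

      abstract
        -- Two neighbourhoods of size at least δ share at least 2δ - n vertices, more than Z can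
        -- cover. With u = v this merely supplies a neighbour outside Z.
        common-neighbour : ∀ u v Z → n + length Z < δ + δ →
          ∃ λ z → adj u z ≡ true × adj v z ≡ true × mem z Z ≡ false
        common-neighbour u v Z small
          with any? (λ z → (adj u z ∧ adj v z ∧ not (mem z Z)) Bool.≟ true)
        ... | yes (z , eq) = z , extract (adj u z) (adj v z) (mem z Z) eq
          where
          extract : ∀ a b c → a ∧ b ∧ not c ≡ true → a ≡ true × b ≡ true × c ≡ false
          extract true true false _ = refl , refl , refl
        ... | no none = contradiction small (≤⇒≯ (begin
          δ + δ                                         ≤⟨ +-mono-≤ (δ-≤ u) (δ-≤ v) ⟩
          deg u xs + deg v xs                           ≡⟨ ∑-+ _ _ xs ⟨
          ∑ (λ z → ⟦ adj u z ⟧ + ⟦ adj v z ⟧) xs        ≤⟨ ∑-mono pointwise xs ⟩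
          ∑ (λ z → 1 + ⟦ mem z Z ⟧) xs                  ≡⟨ ∑-+ _ _ xs ⟩
          ∑ (λ _ → 1) xs + ∑ (λ z → ⟦ mem z Z ⟧) xs     ≤⟨ +-mono-≤ (≤-reflexive (trans (∑-1 xs) (length-tabulate _))) (∑-mem Z (allFin⁺ n)) ⟩
          n + length Z                                  ∎))
          where
          open ≤-Reasoning
          xs : List (Fin n)
          xs = allFin n
          bound : ∀ a b c → a ∧ b ∧ not c ≢ true → ⟦ a ⟧ + ⟦ b ⟧ ≤ 1 + ⟦ c ⟧
          bound true  true  true  _ = ≤-refl
          bound true  true  false h = contradiction refl h
          bound true  false c     _ = s≤s z≤n
          bound false true  c     _ = s≤s z≤n
          bound false false c     _ = z≤n
          pointwise : ∀ z → ⟦ adj u z ⟧ + ⟦ adj v z ⟧ ≤ 1 + ⟦ mem z Z ⟧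
          pointwise z = bound (adj u z) (adj v z) (mem z Z) (λ eq → none (z , eq))

  -- Label sums, rigidity and gadgets

  module Labelled {n : ℕ} (adj : Fin n → Fin n → Bool)
                  (adj-comm : ∀ u v → adj u v ≡ adj v u)
                  (adj-irrefl : ∀ v → adj v v ≡ false)
                  (sgn : Fin n → Fin n → Bool)
                  (sgn-comm : ∀ u v → sgn u v ≡ sgn v u)
                  (δ : ℕ)
                  (δ-≤ : ∀ v → δ ≤ Dirac.deg adj adj-comm adj-irrefl v (allFin n)) where

    open Dirac adj adj-comm adj-irrefl public

    _is_ : Bool → Bool → Bool
    true  is b = b
    false is b = not b

    labelled : Bool → Fin n → Fin n → ℕ
    labelled s u v = ⟦ adj u v ∧ s is sgn u v ⟧

    plus minus : Fin n → Fin n → ℕ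
    plus  = labelled true
    minus = labelled false

    Hamiltonian : Cycle (Fin n) → Set
    Hamiltonian C = vertices C ↭ allFin n × ∮ bad C ≡ 0

    -- |2p - n| ≥ k for a cycle with p edges labelled +, without subtraction.
    Discrepant : ℕ → Cycle (Fin n) → Set
    Discrepant k C = n + k ≤ ∮ plus C + ∮ plus C ⊎ ∮ plus C + ∮ plus C + k ≤ n

    Hit : ℕ → Set
    Hit k = ∃ λ C → Hamiltonian C × Discrepant k C

    length-cycle : ∀ (C : Cycle (Fin n)) → ∮ (λ _ _ → 1) C ≡ length (vertices C)
    length-cycle (x ⟲ xs) = along-1 x xs x

    plus+minus : ∀ C → ∮ bad C ≡ 0 → ∮ plus C + ∮ minus C ≡ length (vertices C)
    plus+minus C good = ≤-antisym upper lower
      where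
      open ≤-Reasoning
      x = Cycle.base C
      xs = Cycle.rest C
      upper : ∮ plus C + ∮ minus C ≤ length (vertices C)
      upper = begin
        ∮ plus C + ∮ minus C                    ≡⟨ along-+ plus minus x xs x ⟨
        ∮ (λ u v → plus u v + minus u v) C      ≤⟨ along-mono (λ u v → one (adj u v) (sgn u v)) x xs x ⟩
        ∮ (λ _ _ → 1) C                         ≡⟨ length-cycle C ⟩
        length (vertices C)                     ∎
        where
        one : ∀ a b → ⟦ a ∧ b ⟧ + ⟦ a ∧ not b ⟧ ≤ 1
        one true  true  = ≤-refl
        one true  false = ≤-refl
        one false b     = z≤n
      lower : length (vertices C) ≤ ∮ plus C + ∮ minus C
      lower = begin
        length (vertices C)                                     ≡⟨ length-cycle C ⟨
        ∮ (λ _ _ → 1) C                                         ≤⟨ along-mono (λ u v → one (adj u v) (sgn u v)) x xs x ⟩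
        ∮ (λ u v → (plus u v + minus u v) + bad u v) C          ≡⟨ along-+ _ bad x xs x ⟩
        ∮ (λ u v → plus u v + minus u v) C + ∮ bad C            ≡⟨ cong₂ _+_ (along-+ plus minus x xs x) good ⟩
        (∮ plus C + ∮ minus C) + 0                              ≡⟨ +-identityʳ _ ⟩
        ∮ plus C + ∮ minus C                                    ∎
        where
        one : ∀ a b → 1 ≤ (⟦ a ∧ b ⟧ + ⟦ a ∧ not b ⟧) + ⟦ not a ⟧
        one true  true  = ≤-refl
        one true  false = ≤-refl
        one false b     = ≤-refl

    ↭allFin⇒length : ∀ {xs} → xs ↭ allFin n → length xs ≡ n
    ↭allFin⇒length p = trans (↭-length p) (length-tabulate _)

    hamiltonian-exists : 0 < n → n ≤ δ + δ → ∃ Hamiltonian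
    hamiltonian-exists n>0 n≤2δ = from (allFin n) refl
      where
      from : ∀ xs → xs ≡ allFin n → ∃ Hamiltonian
      from [] eq = contradiction n>0 (<-irrefl (trans (cong length eq) (length-tabulate _)))
      from (x ∷ xs) eq with dirac (allFin n) [] δ (allFin⁺ n) (λ {v} _ → δ-≤ v)
                        (subst (_≤ δ + δ) (sym (trans (+-identityʳ _) (length-tabulate _))) n≤2δ)
                        (x ⟲ xs) (↭-reflexive eq)
      ... | D , p , good , _ = D , p , good

    record Triangle (v a b : Fin n) : Set where
      constructor triangle
      field
        v~a : adj v a ≡ true
        v~b : adj v b ≡ true
        a~b : adj a b ≡ true

    -- With T = f(va) + f(vb) - f(ab), the change of the label sum when v is inserted between a and b,
    -- this is (T + 3) / 2.
    gain : Fin n → Fin n → Fin n → ℕ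
    gain v a b = ⟦ sgn v a ⟧ + ⟦ sgn v b ⟧ + ⟦ not (sgn a b) ⟧

    swap-triangle : ∀ {v a b} → Triangle v a b → Triangle v b a
    swap-triangle {a = a} {b} (triangle va vb ab) = triangle vb va (trans (adj-comm b a) ab)

    gain-comm : ∀ v a b → gain v a b ≡ gain v b a
    gain-comm v a b = cong₂ (λ x y → x + ⟦ not y ⟧) (+-comm ⟦ sgn v a ⟧ ⟦ sgn v b ⟧) (sgn-comm a b)

    module _ {v a b : Fin n} {ms} {C : Cycle (Fin n)} (r : C ≃ (b ⟲ ms ∷ʳ a))
             (good : ∮ bad C ≡ 0) (t : Triangle v a b) where
      open Triangle t

      private
        D = v ⟲ b ∷ ms ∷ʳ a

      insert-vertices : vertices D ↭ v ∷ vertices C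
      insert-vertices = ↭.prep v (↭-sym (vertices-↭ r))

      insert-good : ∮ bad D ≡ 0
      insert-good = n≤0⇒n≡0 (≤-trans (m≤m+n (∮ bad D) (bad a b)) (≤-reflexive (begin
        ∮ bad D + bad a b              ≡⟨ insert-link v r bad ⟩
        ∮ bad C + (bad a v + bad v b)  ≡⟨ cong₂ (λ x y → x + (⟦ not y ⟧ + bad v b)) good (trans (adj-comm a v) v~a) ⟩
        bad v b                        ≡⟨ cong (λ y → ⟦ not y ⟧) v~b ⟩
        0                              ∎)))
        where open ≡-Reasoning

      -- Losing the edge ab changes the count by -⟦sgn a b⟧ = ⟦not (sgn a b)⟧ - 1, hence the `suc`.
      insert-plus : suc (∮ plus D) ≡ ∮ plus C + gain v a b
      insert-plus = +-cancelʳ-≡ (plus a b) _ _ (begin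
        suc (∮ plus D + plus a b)                 ≡⟨ cong suc (insert-link v r plus) ⟩
        suc (∮ plus C + (plus a v + plus v b))    ≡⟨ final (adj a v) (adj v b) (adj a b) (sgn a v) (sgn v a) (sgn v b) (sgn a b) (∮ plus C)
                                                       (trans (adj-comm a v) v~a) v~b a~b (sgn-comm a v) ⟩
        ∮ plus C + gain v a b + plus a b          ∎)
        where
        open ≡-Reasoning
        final : ∀ av vb ab x x′ y z c → av ≡ true → vb ≡ true → ab ≡ true → x ≡ x′ →
          suc (c + (⟦ av ∧ x ⟧ + ⟦ vb ∧ y ⟧)) ≡ c + (⟦ x′ ⟧ + ⟦ y ⟧ + ⟦ not z ⟧) + ⟦ ab ∧ z ⟧
        final true true true x x y true  c refl refl refl refl = lemma c ⟦ x ⟧ ⟦ y ⟧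
          where
          lemma : ∀ c x y → suc (c + (x + y)) ≡ c + (x + y + 0) + 1
          lemma = solve-∀
        final true true true x x y false c refl refl refl refl = lemma c ⟦ x ⟧ ⟦ y ⟧
          where
          lemma : ∀ c x y → suc (c + (x + y)) ≡ c + (x + y + 1) + 0
          lemma = solve-∀

    Alive : List (Fin n) → Fin n → Set
    Alive X v = mem v X ≡ false

    Rigid : List (Fin n) → Set
    Rigid X = ∀ {v a b c d} → Alive X v → Alive X a → Alive X b → Alive X c → Alive X d →
      Triangle v a b → Triangle v c d → gain v a b ≡ gain v c d

    Monochromatic : List (Fin n) → Bool → Fin n → Set
    Monochromatic X s u = ∀ z → Alive X z → adj u z ≡ true → sgn u z ≡ s

    module _ {X : List (Fin n)} (rigid : Rigid X) (X-small : n + length X < δ + δ) where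

      private
        neighbour : ∀ u v → ∃ λ z → adj u z ≡ true × adj v z ≡ true × Alive X z
        neighbour u v = common-neighbour δ δ-≤ u v X X-small

        -- The gain (T + 3) / 2 of one triangle at v: `neighbour v v` supplies some neighbour a
        -- outside X, and `neighbour v a` closes the triangle.
        τ : Fin n → ℕ
        τ v = let a , _ = neighbour v v ; b , _ = neighbour v a in gain v a b

        τ-gain : ∀ {v a b} → Alive X v → Alive X a → Alive X b → Triangle v a b → τ v ≡ gain v a b
        τ-gain {v} v! a! b! t with neighbour v v
        ... | c , v~c , _ , c! with neighbour v c
        ...   | d , v~d , c~d , d! = rigid v! c! d! a! b! (triangle v~c v~d c~d) t

        -- Both values can be read off one triangle uvz. In T(u) + T(v) the labels of uz and vz
        -- cancel and 2f(uv) remains; after the shift by 3 and the halving this is f(uv) + 3.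
        τ-edge : ∀ {u v} → Alive X u → Alive X v → adj u v ≡ true →
          τ u + τ v ≡ (if sgn u v then 4 else 2)
        τ-edge {u} {v} u! v! u~v with neighbour u v
        ... | z , u~z , v~z , z!
          rewrite τ-gain u! v! z! (triangle u~v u~z v~z)
                | τ-gain v! u! z! (triangle (trans (adj-comm v u) u~v) v~z u~z)
                | sgn-comm v u
          = cases (sgn u v) (sgn u z) (sgn v z)
          where
          cases : ∀ a b c → (⟦ a ⟧ + ⟦ b ⟧ + ⟦ not c ⟧) + (⟦ a ⟧ + ⟦ c ⟧ + ⟦ not b ⟧) ≡ (if a then 4 else 2)
          cases true  true  true  = refl
          cases true  true  false = refl
          cases true  false true  = refl
          cases true  false false = refl
          cases false true  true  = refl
          cases false true  false = refl
          cases false false true  = refl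
          cases false false false = refl

        τ≤3 : ∀ v → τ v ≤ 3
        τ≤3 v = +-mono-≤ (+-mono-≤ (⟦⟧≤1 (sgn v a)) (⟦⟧≤1 (sgn v b))) (⟦⟧≤1 (not (sgn a b)))
          where
          a = proj₁ (neighbour v v)
          b = proj₁ (neighbour v a)

        even : ℕ → Bool
        even zero    = true
        even (suc m) = not (even m)

        same-parity : ∀ s p q → p + q ≡ (if s then 4 else 2) → even p ≡ even q
        same-parity true  0 4 _ = refl
        same-parity true  1 3 _ = refl
        same-parity true  2 2 _ = refl
        same-parity true  3 1 _ = refl
        same-parity true  4 0 _ = refl
        same-parity true  (suc (suc (suc (suc (suc p))))) q ()
        same-parity false 0 2 _ = refl
        same-parity false 1 1 _ = refl
        same-parity false 2 0 _ = refl
        same-parity false (suc (suc (suc p))) q ()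

        parity : ∀ {u v} → Alive X u → Alive X v → even (τ u) ≡ even (τ v)
        parity {u} {v} u! v! with neighbour u v
        ... | z , u~z , v~z , z! = trans (same-parity (sgn u z) (τ u) (τ z) (τ-edge u! z! u~z))
                                    (sym (same-parity (sgn v z) (τ v) (τ z) (τ-edge v! z! v~z)))

        -- A + edge at u would require the value 4 at its other end.
        pure-minus : ∀ {u} → Alive X u → τ u ≡ 0 → Monochromatic X false u
        pure-minus {u} u! τu≡0 z z! u~z with sgn u z | τ-edge u! z! u~z
        ... | false | _  = refl
        ... | true  | eq = contradiction (τ≤3 z) (<⇒≱ (≤-reflexive (trans (sym eq) (cong (_+ τ z) τu≡0))))

        pure-plus : ∀ {u} → Alive X u → τ u ≡ 3 → Monochromatic X true u
        pure-plus {u} u! τu≡3 z z! u~z with sgn u z | τ-edge u! z! u~z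
        ... | true  | _  = refl
        ... | false | eq = contradiction (trans (cong (_+ τ z) (sym τu≡3)) eq) λ ()

      -- Adjacent τ-values sum to 4 or 2 according to the label, so all τ-values have the same parity.
      -- If they are even, the - edges join the value 0 to the value 2; if they are odd, the
      -- + edges join the value 1 to the value 3.
      rigid⇒monochromatic : ∀ {v₀} → Alive X v₀ → ∃ λ s → ∀ {u v} → Alive X u → Alive X v →
        adj u v ≡ true → sgn u v ≡ s → Monochromatic X s u ⊎ Monochromatic X s v
      rigid⇒monochromatic {v₀} v₀! with even (τ v₀) in p₀
      ... | true = false , λ {u} {v} u! v! u~v uv- →
        decide u! v! (trans (parity u! v₀!) p₀) (trans (τ-edge u! v! u~v) (cong (λ s → if s then 4 else 2) uv-))
        where
        decide : ∀ {u v} → Alive X u → Alive X v → even (τ u) ≡ true → τ u + τ v ≡ 2 →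
          Monochromatic X false u ⊎ Monochromatic X false v
        decide {u} {v} u! v! ev eq with τ u in τu
        ... | 0 = inj₁ (pure-minus u! τu)
        ... | 2 = inj₂ (pure-minus v! (suc-injective (suc-injective eq)))
      ... | false = true , λ {u} {v} u! v! u~v uv+ →
        decide u! v! (trans (parity u! v₀!) p₀) (trans (τ-edge u! v! u~v) (cong (λ s → if s then 4 else 2) uv+))
        where
        decide : ∀ {u v} → Alive X u → Alive X v → even (τ u) ≡ false → τ u + τ v ≡ 4 →
          Monochromatic X true u ⊎ Monochromatic X true v
        decide {u} {v} u! v! ev eq with τ u in τu
        ... | 1 = inj₂ (pure-plus v! (suc-injective eq))
        ... | 3 = inj₁ (pure-plus u! τu)
        ... | suc (suc (suc (suc w))) = contradiction (τ≤3 u) (<⇒≱ (subst (3 <_) (sym τu) (s≤s (s≤s (s≤s (s≤s z≤n))))))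

    -- Discrepancy of Hamilton cycles when the labelling is rigid.

    module Balanced (S : Fin n → Bool) (m : ℕ)
      (S-label : ∀ s {v} → S v ≡ true → m ≤ ∑ (λ u → labelled s v u) (allFin n)) where

      alive-neighbour : ∀ X s {v} → length X < m → S v ≡ true →
        ∃ λ u → Alive X u × adj v u ≡ true × s is sgn v u ≡ true
      alive-neighbour X s {v} X<m v∈S
        with any? (λ u → (adj v u ∧ s is sgn v u ∧ not (mem u X)) Bool.≟ true)
      ... | yes (u , eq) = u , extract (adj v u) (s is sgn v u) (mem u X) eq
        where
        extract : ∀ a b c → a ∧ b ∧ not c ≡ true → c ≡ false × a ≡ true × b ≡ true
        extract true true false _ = refl , refl , refl
      ... | no none = contradiction X<m (≤⇒≯ (begin
        m                                        ≤⟨ S-label s v∈S ⟩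
        ∑ (λ u → labelled s v u) (allFin n)      ≤⟨ ∑-mono (λ u → bound (adj v u) (s is sgn v u) (mem u X) (λ eq → none (u , eq))) (allFin n) ⟩
        ∑ (λ u → ⟦ mem u X ⟧) (allFin n)         ≤⟨ ∑-mem X (allFin⁺ n) ⟩
        length X                                 ∎))
        where
        open ≤-Reasoning
        bound : ∀ a b c → a ∧ b ∧ not c ≢ true → ⟦ a ∧ b ⟧ ≤ ⟦ c ⟧
        bound true  true  true  _ = ≤-refl
        bound true  true  false h = contradiction refl h
        bound true  false c     _ = z≤n
        bound false b     c     _ = z≤n

      ∣S∣ : ℕ
      ∣S∣ = ∑ (⟦_⟧ ∘ S) (allFin n)

      -- Every edge labelled s has an end in X or a monochromatic end. The latter lies outside S,
      -- since vertices of S keep alive neighbours of both labels. The cycle has two links at each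
      -- vertex, so at most 2r of its links are labelled s, where r is at most |V - S| + |X|; and 4r
      -- + k ≤ n lets the other label prevail by k.
      rigid⇒hit : ∀ {X k} → Rigid X → n + length X < δ + δ → length X < m →
        3 * n + 4 * length X + k ≤ 4 * ∣S∣ → ∃ (λ v₀ → Alive X v₀) → Hit k
      rigid⇒hit {X} {k} rigid X-small X<m S-large (v₀ , v₀!)
        with rigid⇒monochromatic {X} rigid X-small v₀!
           | hamiltonian-exists (Fin⇒0< v₀) (≤-trans (m≤m+n n _) (<⇒≤ X-small))
      ... | s , mono | C , C↭ , good = C , (C↭ , good) , discrepant s few
        where
        h : Fin n → ℕ
        h u = ⟦ not (S u) ⟧ + ⟦ mem u X ⟧
        r = ∑ h (allFin n)

        s-is-s : ∀ s b → s is b ≡ true → b ≡ s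
        s-is-s true  true  _ = refl
        s-is-s false false _ = refl
        is-≡ : ∀ s → (not s) is s ≡ false
        is-≡ true  = refl
        is-≡ false = refl

        mono⇒∉S : ∀ {u} → Monochromatic X s u → S u ≡ false
        mono⇒∉S {u} mu with S u in u∈S
        ... | false = refl
        ... | true with alive-neighbour X (not s) X<m u∈S
        ...   | z , z! , u~z , other = contradiction
                (trans (sym (trans (cong (not s is_) (mu z z! u~z)) (is-≡ s))) other) λ ()

        touches : ∀ u v → labelled s u v ≤ h u + h v
        touches u v with mem u X in u! | mem v X in v!
        ... | true  | _     = ≤-trans (⟦⟧≤1 (adj u v ∧ s is sgn u v))
                                (≤-trans (m≤n+m 1 ⟦ not (S u) ⟧) (m≤m+n (⟦ not (S u) ⟧ + 1) _))
        ... | false | true  = ≤-trans (⟦⟧≤1 (adj u v ∧ s is sgn u v))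
                                (≤-trans (m≤n+m 1 ⟦ not (S v) ⟧) (m≤n+m (⟦ not (S v) ⟧ + 1) (⟦ not (S u) ⟧ + 0)))
        ... | false | false with adj u v in u~v | s is sgn u v in uv
        ...   | false | _     = z≤n
        ...   | true  | false = z≤n
        ...   | true  | true with mono u! v! u~v (s-is-s s _ uv)
        ...     | inj₁ mu = ≤-trans (≤-reflexive (cong (λ b → ⟦ not b ⟧) (sym (mono⇒∉S mu))))
                              (≤-trans (m≤m+n ⟦ not (S u) ⟧ 0) (m≤m+n _ _))
        ...     | inj₂ mv = ≤-trans (≤-reflexive (cong (λ b → ⟦ not b ⟧) (sym (mono⇒∉S mv))))
                              (≤-trans (m≤m+n ⟦ not (S v) ⟧ 0) (m≤n+m _ (⟦ not (S u) ⟧ + 0)))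

        few : ∮ (labelled s) C ≤ r + r
        few = begin
          ∮ (labelled s) C                         ≤⟨ along-mono touches x xs x ⟩
          ∮ (λ u v → h u + h v) C                  ≡⟨ along-ends h x xs x ⟩
          h x + (∑ h xs + ∑ h xs) + h x            ≡⟨ lemma (h x) (∑ h xs) ⟩
          ∑ h (x ∷ xs) + ∑ h (x ∷ xs)              ≡⟨ cong₂ _+_ (∑-↭ h C↭) (∑-↭ h C↭) ⟩
          r + r                                    ∎
          where
          open ≤-Reasoning
          x = Cycle.base C
          xs = Cycle.rest C
          lemma : ∀ a s → a + (s + s) + a ≡ (a + s) + (a + s)
          lemma = solve-∀

        r+S : r + ∣S∣ ≤ n + length X
        r+S = begin
          r + ∣S∣                                                        ≡⟨ ∑-+ h (⟦_⟧ ∘ S) (allFin n) ⟨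
          ∑ (λ u → h u + ⟦ S u ⟧) (allFin n)                             ≤⟨ ∑-mono (λ u → one (S u) ⟦ mem u X ⟧) (allFin n) ⟩
          ∑ (λ u → 1 + ⟦ mem u X ⟧) (allFin n)                           ≡⟨ ∑-+ _ _ (allFin n) ⟩
          ∑ (λ u → 1) (allFin n) + ∑ (λ u → ⟦ mem u X ⟧) (allFin n)      ≤⟨ +-mono-≤ (≤-reflexive (trans (∑-1 (allFin n)) (length-tabulate _))) (∑-mem X (allFin⁺ n)) ⟩
          n + length X                                                   ∎
          where
          open ≤-Reasoning
          one : ∀ b c → ⟦ not b ⟧ + c + ⟦ b ⟧ ≤ 1 + c
          one true  c = ≤-reflexive (+-comm c 1)
          one false c = ≤-reflexive (+-identityʳ _)

        total : ∮ plus C + ∮ minus C ≡ n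
        total = trans (plus+minus C good) (↭allFin⇒length C↭)

        -- 4r ≤ 4(n + |X|) - 4|S| ≤ n - k
        r-small : 4 * r + k ≤ n
        r-small = ≤-by (4 * ∣S∣ + (3 * n + 4 * length X)) (+-mono-≤ (*-monoʳ-≤ 4 r+S) S-large)
          (lemma r k ∣S∣ n (length X)) (lemma′ n (length X) ∣S∣)
          where
          lemma : ∀ r k s n x → 4 * r + k + (4 * s + (3 * n + 4 * x)) ≡ 4 * (r + s) + (3 * n + 4 * x + k)
          lemma = solve-∀
          lemma′ : ∀ n x s → 4 * (n + x) + 4 * s ≡ n + (4 * s + (3 * n + 4 * x))
          lemma′ = solve-∀

        discrepant : ∀ s → ∮ (labelled s) C ≤ r + r → Discrepant k C
        discrepant true few = inj₂ (begin
          ∮ plus C + ∮ plus C + k     ≤⟨ +-monoˡ-≤ k (+-mono-≤ few few) ⟩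
          (r + r) + (r + r) + k       ≡⟨ lemma r k ⟩
          4 * r + k                   ≤⟨ r-small ⟩
          n                           ∎)
          where
          open ≤-Reasoning
          lemma : ∀ r k → (r + r) + (r + r) + k ≡ 4 * r + k
          lemma = solve-∀
        discrepant false few = inj₁ (≤-by (4 * r + (q + q))
          (+-mono-≤ r-small (+-monoʳ-≤ n (+-mono-≤ few few))) (lemma n k r q)
          (trans (cong (λ n → n + (n + ((r + r) + (r + r)))) (sym total)) (lemma′ p q r)))
          where
          p = ∮ plus C
          q = ∮ minus C
          lemma : ∀ n k r q → n + k + (4 * r + (q + q)) ≡ 4 * r + k + (n + (q + q))
          lemma = solve-∀
          lemma′ : ∀ p q r → (p + q) + ((p + q) + ((r + r) + (r + r))) ≡ p + p + (4 * r + (q + q))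
          lemma′ = solve-∀

    -- Simultaneous insertions and families of disjoint gadgets.

    open DecUnique (_≟_ {n}) using (unique?)

    adj⇒≢ : ∀ {u v} → adj u v ≡ true → u ≢ v
    adj⇒≢ {u} u~v refl = contradiction (trans (sym u~v) (adj-irrefl u)) λ ()

    triangle? : ∀ v a b → Dec (Triangle v a b)
    triangle? v a b with adj v a Bool.≟ true | adj v b Bool.≟ true | adj a b Bool.≟ true
    ... | yes p | yes q | yes r = yes (triangle p q r)
    ... | no ¬p | _     | _     = no (¬p ∘ Triangle.v~a)
    ... | _     | no ¬q | _     = no (¬q ∘ Triangle.v~b)
    ... | _     | _     | no ¬r = no (¬r ∘ Triangle.a~b)

    record Insertion : Set where
      constructor insertion
      field
        {apex p q} : Fin n
        tri        : Triangle apex p q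

      pair : List (Fin n)
      pair = p ∷ q ∷ []

      amount : ℕ
      amount = gain apex p q
    open Insertion using (pair; amount)

    abstract
      -- An insertion removes only its own edge, and no later insertion edge shares an end with it,
      -- so the others are still on the cycle when their turn comes. The term `length ts` collects
      -- one `suc` of `insert-plus` per insertion.
      insert-all : ∀ ts C → ∮ bad C ≡ 0 →
        All (λ t → 1 ≤ ∮ (edge (Insertion.p t) (Insertion.q t)) C) ts →
        AllPairs (λ t t′ → All (_∉ pair t′) (pair t)) ts →
        ∃ λ D → vertices D ↭ map Insertion.apex ts ++ vertices C × ∮ bad D ≡ 0 ×
                ∮ plus D + length ts ≡ ∮ plus C + ∑ amount ts
      insert-all [] C good _ _ = C , ↭-refl , good , refl
      insert-all (insertion {v} {p} {q} t ∷ ts) C good (e ∷ es) (d ∷ ds)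
        with find-edge (adj⇒≢ (Triangle.a~b t)) C e
      ... | link {a} {b} ms r ab = continue (insert-all ts C′ (insert-good r good t′)
                                     (All.zipWith (λ {t} → kept t) (d , es)) ds)
        where
        C′ : Cycle (Fin n)
        C′ = v ⟲ b ∷ ms ∷ʳ a
        orient : (a ≡ p × b ≡ q) ⊎ (a ≡ q × b ≡ p) →
          Triangle v a b × gain v a b ≡ gain v p q × (∀ {P : Fin n → Set} → All P (p ∷ q ∷ []) → P a)
        orient (inj₁ (refl , refl)) = t , refl , λ { (x ∷ _) → x }
        orient (inj₂ (refl , refl)) = swap-triangle t , gain-comm v q p , λ { (_ ∷ x ∷ _) → x }
        t′ : Triangle v a b
        t′ = proj₁ (orient ab)
        kept : ∀ s → All (_∉ pair s) (p ∷ q ∷ []) × 1 ≤ ∮ (edge (Insertion.p s) (Insertion.q s)) C →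
          1 ≤ ∮ (edge (Insertion.p s) (Insertion.q s)) C′
        kept s (d , e) = begin
          1                            ≤⟨ e ⟩
          ∮ w C                        ≤⟨ m≤m+n (∮ w C) _ ⟩
          ∮ w C + (w a v + w v b)      ≡⟨ insert-link v r w ⟨
          ∮ w C′ + w a b               ≡⟨ cong (∮ w C′ +_) (edge-absent {p = Insertion.p s} {Insertion.q s} {a} {b} (proj₂ (proj₂ (orient ab)) d)) ⟩
          ∮ w C′ + 0                   ≡⟨ +-identityʳ _ ⟩
          ∮ w C′                       ∎
          where
          open ≤-Reasoning
          w : Fin n → Fin n → ℕ
          w = edge (Insertion.p s) (Insertion.q s)
        continue :
          (∃ λ D → vertices D ↭ map Insertion.apex ts ++ vertices C′ × ∮ bad D ≡ 0 ×
                   ∮ plus D + length ts ≡ ∮ plus C′ + ∑ amount ts) →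
          ∃ λ D → vertices D ↭ v ∷ map Insertion.apex ts ++ vertices C × ∮ bad D ≡ 0 ×
                  ∮ plus D + suc (length ts) ≡ ∮ plus C + (gain v p q + ∑ amount ts)
        continue (D , D↭ , D-good , D-plus) = D
          , ↭-trans D↭ (↭-trans (↭.++⁺ˡ (map Insertion.apex ts) (insert-vertices r good t′))
                                (shift v (map Insertion.apex ts) (vertices C)))
          , D-good
          , (begin
              ∮ plus D + suc (length ts)                     ≡⟨ +-suc _ _ ⟩
              suc (∮ plus D + length ts)                     ≡⟨ cong suc D-plus ⟩
              suc (∮ plus C′) + ∑ amount ts                  ≡⟨ cong (_+ ∑ amount ts) (insert-plus r good t′) ⟩
              ∮ plus C + gain v a b + ∑ amount ts            ≡⟨ cong (λ g → ∮ plus C + g + ∑ amount ts) (proj₁ (proj₂ (orient ab))) ⟩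
              ∮ plus C + gain v p q + ∑ amount ts            ≡⟨ +-assoc (∮ plus C) _ _ ⟩
              ∮ plus C + (gain v p q + ∑ amount ts)          ∎)
          where open ≡-Reasoning

    record Gadget : Set where
      constructor gadget
      field
        {apex a b c d} : Fin n
        low            : Triangle apex a b
        high           : Triangle apex c d
        low<high       : gain apex a b < gain apex c d

      ends : List (Fin n)
      ends = a ∷ b ∷ c ∷ d ∷ []
    open Gadget using (ends)

    abstract
      -- Gadgets have disjoint edges, but rigidity concerns any two triangles at v. Triangles that
      -- may share a corner are compared through a third one disjoint from both; avoiding their four
      -- corners besides X accounts for the 4 in the degree condition.
      find-gadget : ∀ X → (∃ λ g → All (Alive X) (Gadget.apex g ∷ ends g) × Unique (ends g))
                        ⊎ (n + (length X + 4) < δ + δ → Rigid X)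
      find-gadget X with any? (λ v → any? (λ a → any? (λ b → any? (λ c → any? (λ d →
        (triangle? v a b ×-dec triangle? v c d ×-dec (gain v a b <? gain v c d))
        ×-dec All.all? (λ z → mem z X Bool.≟ false) (v ∷ a ∷ b ∷ c ∷ d ∷ [])
        ×-dec unique? (a ∷ b ∷ c ∷ d ∷ []))))))
      ... | yes (_ , _ , _ , _ , _ , (low , high , lt) , alive , uniq) = inj₁ (gadget low high lt , alive , uniq)
      ... | no none = inj₂ rigid
        where
        disjoint : ∀ {v a b x y} → Alive X v → Alive X a → Alive X b → Alive X x → Alive X y →
          a ≢ x → a ≢ y → b ≢ x → b ≢ y → Triangle v a b → Triangle v x y → gain v a b ≡ gain v x y
        disjoint v! a! b! x! y! a≢x a≢y b≢x b≢y ab xy = ≤-antisym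
          (≮⇒≥ λ lt → none (_ , _ , _ , _ , _ , (xy , ab , lt) , (v! ∷ x! ∷ y! ∷ a! ∷ b! ∷ []) ,
            ((adj⇒≢ (Triangle.a~b xy) ∷ (a≢x ∘ sym) ∷ (b≢x ∘ sym) ∷ []) ∷ ((a≢y ∘ sym) ∷ (b≢y ∘ sym) ∷ []) ∷
             (adj⇒≢ (Triangle.a~b ab) ∷ []) ∷ [] ∷ [])))
          (≮⇒≥ λ lt → none (_ , _ , _ , _ , _ , (ab , xy , lt) , (v! ∷ a! ∷ b! ∷ x! ∷ y! ∷ []) ,
            ((adj⇒≢ (Triangle.a~b ab) ∷ a≢x ∷ a≢y ∷ []) ∷ (b≢x ∷ b≢y ∷ []) ∷
             (adj⇒≢ (Triangle.a~b xy) ∷ []) ∷ [] ∷ [])))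
        rigid : n + (length X + 4) < δ + δ → Rigid X
        rigid small {v} {a} {b} {c} {d} v! a! b! c! d! ab cd =
          let Y = a ∷ b ∷ c ∷ d ∷ []
              small′ = subst (λ l → n + l < δ + δ) (sym (length-++ X)) small
              x , v~x , _ , x∉ = common-neighbour δ δ-≤ v v (X ++ Y) small′
              y , v~y , x~y , y∉ = common-neighbour δ δ-≤ v x (X ++ Y) small′
              x! , x∉Y = ∨-false {mem x X} {mem x Y} (trans (sym (mem-++ x X Y)) x∉)
              y! , y∉Y = ∨-false {mem y X} {mem y Y} (trans (sym (mem-++ y X Y)) y∉)
              xy = triangle v~x v~y x~y
              x∉ = mem-false {Z = Y} x∉Y
              y∉ = mem-false {Z = Y} y∉Y
          in trans (disjoint v! a! b! x! y! (λ e → x∉ (here (sym e))) (λ e → y∉ (here (sym e)))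
                     (λ e → x∉ (there (here (sym e)))) (λ e → y∉ (there (here (sym e)))) ab xy)
                   (sym (disjoint v! c! d! x! y!
                     (λ e → x∉ (there (there (here (sym e))))) (λ e → y∉ (there (there (here (sym e)))))
                     (λ e → x∉ (there (there (there (here (sym e))))))
                     (λ e → y∉ (there (there (there (here (sym e)))))) cd xy))

    apexes all-ends : List Gadget → List (Fin n)
    apexes   = map Gadget.apex
    all-ends = concatMap ends

    record Family (k : ℕ) : Set where
      constructor family
      field
        members  : List Gadget
        size     : length members ≡ k
        disjoint : AllPairs (λ g g′ → All (_∉ ends g′) (ends g)) members
        unique   : Unique (apexes members ++ all-ends members)

    length-all-ends : ∀ gs → length (all-ends gs) ≡ 4 * length gs
    length-all-ends []       = refl
    length-all-ends (g ∷ gs) = trans (cong (4 +_) (length-all-ends gs)) (sym (*-suc 4 (length gs)))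

    length-vertices : ∀ gs → length (apexes gs ++ all-ends gs) ≡ 5 * length gs
    length-vertices gs = trans (length-++ (apexes gs)) (cong₂ _+_ (length-map Gadget.apex gs) (length-all-ends gs))

    -- Greedy choice: a gadget occupies five vertices, so a search that stops before k gadgets
    -- leaves a blocking set of at most 5k vertices.
    gather : ∀ k → Family k ⊎ ∃ λ X → length X ≤ 5 * k × (n + (length X + 4) < δ + δ → Rigid X)
    gather zero = inj₁ (family [] refl [] [])
    gather (suc k) with gather k
    ... | inj₂ (X , X≤ , rigid) = inj₂ (X , ≤-trans X≤ (*-monoʳ-≤ 5 (n≤1+n k)) , rigid)
    ... | inj₁ (family gs refl disj uniq) with find-gadget (apexes gs ++ all-ends gs)
    ...   | inj₂ rigid = inj₂ (apexes gs ++ all-ends gs , ≤-trans (≤-reflexive (length-vertices gs)) (*-monoʳ-≤ 5 (n≤1+n k)) , rigid)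
    ...   | inj₁ (g , alive , ends-unique) = inj₁ (family (g ∷ gs) refl
              (All.tabulate (λ g′∈ → All.map (λ z! z∈ → mem-false z! (∈-++⁺ʳ (apexes gs) (∈-concatMap⁺ ends (lose g′∈ z∈)))) (All.tail alive)) ∷ disj)
              (Unique-resp-↭ perm
                ((adj⇒≢ v~a ∷ adj⇒≢ v~b ∷ adj⇒≢ v~c ∷ adj⇒≢ v~d ∷ fresh (All.head alive))
                 ∷ prepend (All.tail alive) ends-unique)))
      where
      Y = apexes gs ++ all-ends gs
      open Triangle (Gadget.low g) using (v~a; v~b)
      open Triangle (Gadget.high g) using () renaming (v~a to v~c; v~b to v~d)
      fresh : ∀ {z} → Alive Y z → All (z ≢_) Y
      fresh z! = All.tabulate λ { y∈ refl → mem-false z! y∈ }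
      prepend : ∀ {zs} → All (Alive Y) zs → Unique zs → Unique (zs ++ Y)
      prepend []         []         = uniq
      prepend (z! ∷ zs!) (z∉ ∷ us)  = All.++⁺ z∉ (fresh z!) ∷ prepend zs! us
      perm : Gadget.apex g ∷ ends g ++ Y ↭ Gadget.apex g ∷ apexes gs ++ ends g ++ all-ends gs
      perm = ↭.prep (Gadget.apex g) (shifts (ends g) (apexes gs))

    ∑-gains : ∀ gs →
      ∑ amount (map (insertion ∘ Gadget.low) gs) + length gs ≤ ∑ amount (map (insertion ∘ Gadget.high) gs)
    ∑-gains []       = z≤n
    ∑-gains (g ∷ gs) = ≤-trans (≤-reflexive (lemma (amount (insertion (Gadget.low g))) (∑ amount (map (insertion ∘ Gadget.low) gs)) (length gs))) (+-mono-≤ (Gadget.low<high g) (∑-gains gs))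
      where
      lemma : ∀ a s l → a + s + suc l ≡ suc a + (s + l)
      lemma = solve-∀

    -- The label sums 2p - n differ by at least 2k and cannot both lie strictly between -k and k.
    gap⇒discrepant : ∀ {k C D} → ∮ plus C + k ≤ ∮ plus D → Discrepant k C ⊎ Discrepant k D
    gap⇒discrepant {k} {C} {D} gap with n + k ≤? ∮ plus D + ∮ plus D
    ... | yes le = inj₂ (inj₁ le)
    ... | no ¬le = inj₁ (inj₂ (≤-by k (≤-trans (+-mono-≤ gap gap) (<⇒≤ (≰⇒> ¬le))) (lemma (∮ plus C) k) refl))
      where
      lemma : ∀ c k → c + c + k + k ≡ (c + k) + (c + k)
      lemma = solve-∀

    -- Deleting `as` lowers degrees by at most |as|, and |xs| = n - |as|; the hypothesis is
    -- therefore Dirac's condition |xs| + |Z| ≤ 2(δ - |as|).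
    remaining-cycle : ∀ {as xs Z} → allFin n ↭ as ++ xs → n + length as + length Z ≤ δ + δ →
      ∀ C → vertices C ↭ xs → ∃ λ D → vertices D ↭ xs × ∮ bad D ≡ 0 ×
        (∀ w → Comm w → SupportedOn Z w → ∮ w C ≤ ∮ w D)
    remaining-cycle {as} {xs} {Z} all↭ large C C↭ =
      dirac xs Z (δ ∸ length as) (unique-suffix as (Unique-resp-↭ all↭ (allFin⁺ n))) (λ {v} _ → δ-bound v) e-large C C↭
      where
      unique-suffix : ∀ as {bs : List (Fin n)} → Unique (as ++ bs) → Unique bs
      unique-suffix []       u       = u
      unique-suffix (_ ∷ as) (_ ∷ u) = unique-suffix as u

      n≡ : n ≡ length as + length xs
      n≡ = trans (sym (↭allFin⇒length ↭-refl)) (trans (↭-length all↭) (length-++ as))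

      δ-bound : ∀ v → δ ∸ length as ≤ deg v xs
      δ-bound v = m≤n+o⇒m∸n≤o δ (length as) (begin
        δ                        ≤⟨ δ-≤ v ⟩
        deg v (allFin n)         ≡⟨ ∑-↭ _ all↭ ⟩
        deg v (as ++ xs)         ≡⟨ ∑-++ _ as xs ⟩
        deg v as + deg v xs      ≤⟨ +-monoˡ-≤ (deg v xs) (≤-trans (∑-mono (λ u → ⟦⟧≤1 (adj v u)) as) (≤-reflexive (∑-1 as))) ⟩
        length as + deg v xs     ∎)
        where open ≤-Reasoning

      e-large : length xs + length Z ≤ (δ ∸ length as) + (δ ∸ length as)
      e-large = ≤-by (length as + length as)
        (≤-trans large (+-mono-≤ (m≤n+m∸n δ (length as)) (m≤n+m∸n δ (length as))))
        (trans (lemma (length xs) (length Z) (length as)) (cong (λ l → l + length as + length Z) (sym n≡)))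
        (lemma′ (length as) (δ ∸ length as))
        where
        lemma : ∀ l z a → l + z + (a + a) ≡ a + l + a + z
        lemma = solve-∀
        lemma′ : ∀ K e → K + e + (K + e) ≡ e + e + (K + K)
        lemma′ = solve-∀

    edge-supported : ∀ {p q Z} → p ∈ Z → q ∈ Z → adj p q ≡ true → SupportedOn Z (edge p q)
    edge-supported {p} {q} p∈ q∈ p~q u v ne with edge-cases {p = p} {q} {u} {v} ne
    ... | inj₁ (refl , refl) = p~q , ∈⇒mem p∈
    ... | inj₂ (refl , refl) = trans (adj-comm q p) p~q , ∈⇒mem q∈

    split-ends : ∀ gs {g as p q bs} → g ∈ gs → ends g ≡ as ++ p ∷ q ∷ bs →
      ∃₂ λ ps qs → all-ends gs ≡ ps ++ p ∷ q ∷ qs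
    split-ends (g ∷ gs) {as = as} {p} {q} {bs} (here refl) eq =
      as , bs ++ all-ends gs , trans (cong (_++ all-ends gs) eq) (++-assoc as (p ∷ q ∷ bs) (all-ends gs))
    split-ends (g ∷ gs) {p = p} {q} (there g∈) eq with split-ends gs g∈ eq
    ... | ps , qs , eq′ = ends g ++ ps , qs ,
      trans (cong (ends g ++_) eq′) (sym (++-assoc (ends g) ps (p ∷ q ∷ qs)))

    kept-edge : ∀ Z rest {C D ps p q qs} → vertices C ≡ Z ++ rest →
      (∀ w → Comm w → SupportedOn Z w → ∮ w C ≤ ∮ w D) →
      Z ≡ ps ++ p ∷ q ∷ qs → adj p q ≡ true → 1 ≤ ∮ (edge p q) D
    kept-edge Z rest {x ⟲ xs} {D} {ps} {p} {q} {qs} C≡ kept Z≡ p~q = begin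
      1                    ≡⟨ edge-refl p q ⟨
      edge p q p q         ≤⟨ along-consecutive (edge p q) x ps (qs ++ rest)
                                (trans C≡ (trans (cong (_++ rest) Z≡) (++-assoc ps (p ∷ q ∷ qs) rest))) ⟩
      ∮ (edge p q) (x ⟲ xs) ≤⟨ kept (edge p q) (edge-comm p q) (edge-supported
                                (subst (p ∈_) (sym Z≡) (∈-++⁺ʳ ps (here refl)))
                                (subst (q ∈_) (sym Z≡) (∈-++⁺ʳ ps (there (here refl)))) p~q) ⟩
      ∮ (edge p q) D       ∎
      where open ≤-Reasoning

    lows highs : List Gadget → List Insertion
    lows  = map (insertion ∘ Gadget.low)
    highs = map (insertion ∘ Gadget.high)

    HasEdges : Cycle (Fin n) → List Insertion → Set
    HasEdges C = All (λ t → 1 ≤ ∮ (edge (Insertion.p t) (Insertion.q t)) C)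

    flip-gadgets : ∀ gs {xs} C → allFin n ↭ apexes gs ++ xs → vertices C ↭ xs → ∮ bad C ≡ 0 →
      HasEdges C (lows gs) → HasEdges C (highs gs) →
      AllPairs (λ g g′ → All (_∉ ends g′) (ends g)) gs → Hit (length gs)
    flip-gadgets gs {xs} C all↭ C↭ good low-edges high-edges disj
      with insert-all (lows gs) C good low-edges
             (AllPairs.map⁺ (AllPairs.map (λ { (p ∷ q ∷ _) → (p ∘ first) ∷ (q ∘ first) ∷ [] }) disj))
         | insert-all (highs gs) C good high-edges
             (AllPairs.map⁺ (AllPairs.map (λ { (_ ∷ _ ∷ p ∷ q ∷ _) → (p ∘ there ∘ there) ∷ (q ∘ there ∘ there) ∷ [] }) disj))
      where
      first : ∀ {z a b c d : Fin n} → z ∈ a ∷ b ∷ [] → z ∈ a ∷ b ∷ c ∷ d ∷ []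
      first (here e)         = here e
      first (there (here e)) = there (here e)
    ... | L , L↭ , L-good , L-plus | H , H↭ , H-good , H-plus = hit (gap⇒discrepant {k} {L} {H} gap)
      where
      k = length gs
      to-allFin : ∀ {D as} → vertices D ↭ as ++ vertices C → as ≡ apexes gs → vertices D ↭ allFin n
      to-allFin D↭ refl = ↭-trans D↭ (↭-trans (↭.++⁺ˡ (apexes gs) C↭) (↭-sym all↭))
      gap : ∮ plus L + k ≤ ∮ plus H
      gap = ≤-by k (+-monoʳ-≤ (∮ plus C) (∑-gains gs))
        (trans (cong (λ l → ∮ plus L + l + k) (sym (length-map (insertion ∘ Gadget.low) gs)))
          (trans (cong (_+ k) L-plus) (+-assoc (∮ plus C) _ k)))
        (trans (sym H-plus) (cong (∮ plus H +_) (length-map (insertion ∘ Gadget.high) gs)))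
      hit : Discrepant k L ⊎ Discrepant k H → Hit k
      hit (inj₁ disc) = L , (to-allFin L↭ (sym (map-∘ gs)) , L-good) , disc
      hit (inj₂ disc) = H , (to-allFin H↭ (sym (map-∘ gs)) , H-good) , disc

    family⇒hit : ∀ k → n + 5 * suc k ≤ δ + δ → Family (suc k) → Hit (suc k)
    family⇒hit k large (family gs@(g ∷ gs′) refl disj uniq)
      with complement (apexes gs ++ all-ends gs) uniq (All.tabulate λ _ → ∈-allFin _)
    ... | rest , comp = connect (remaining-cycle {apexes gs} {all-ends gs ++ rest} {all-ends gs} all↭ large′ C₀ ↭-refl)
      where
      -- This initial order need not be a Hamilton cycle. It lists the ends of the gadgets first, as
      -- a, b, c, d, so that every ab and cd is a link from the start and only has to be kept.
      C₀ = Gadget.a g ⟲ Gadget.b g ∷ Gadget.c g ∷ Gadget.d g ∷ all-ends gs′ ++ rest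
      all↭ : allFin n ↭ apexes gs ++ (all-ends gs ++ rest)
      all↭ = ↭-trans comp (↭-reflexive (++-assoc (apexes gs) (all-ends gs) rest))
      large′ : n + length (apexes gs) + length (all-ends gs) ≤ δ + δ
      large′ = ≤-trans (≤-reflexive (trans (+-assoc n _ _) (cong (n +_) (trans (sym (length-++ (apexes gs))) (length-vertices gs))))) large
      connect : (∃ λ D → vertices D ↭ all-ends gs ++ rest × ∮ bad D ≡ 0 ×
                  (∀ w → Comm w → SupportedOn (all-ends gs) w → ∮ w C₀ ≤ ∮ w D)) → Hit (suc k)
      connect (D , D↭ , good , kept) = flip-gadgets gs D all↭ D↭ good
        (All.map⁺ (All.tabulate λ {g′} g′∈ → has {g′} [] g′∈ (Triangle.a~b (Gadget.low g′)) refl))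
        (All.map⁺ (All.tabulate λ {g′} g′∈ → has {g′} (_ ∷ _ ∷ []) g′∈ (Triangle.a~b (Gadget.high g′)) refl)) disj
        where
        has : ∀ {g′ p q bs} as → g′ ∈ gs → adj p q ≡ true → ends g′ ≡ as ++ p ∷ q ∷ bs → 1 ≤ ∮ (edge p q) D
        has as g′∈ p~q eq with split-ends gs {as = as} g′∈ eq
        ... | ps , qs , eq′ = kept-edge (all-ends gs) rest {C₀} {D} {ps} refl kept eq′ p~q

    -- The conditions are those of a failing search, where |X| ≤ 5(k + 1): four further corners must
    -- be avoidable, m must exceed |X|, and X enters the final count four times. The first also pays
    -- for the apexes and protected ends of a family.
    many-gadgets : ∀ (S : Fin n → Bool) m
      (S-label : ∀ s {v} → S v ≡ true → m ≤ ∑ (λ u → labelled s v u) (allFin n)) →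
      ∀ k → n + (5 * suc k + 4) < δ + δ → 5 * suc k < m →
      3 * n + 4 * (5 * suc k) + suc k ≤ 4 * ∑ (⟦_⟧ ∘ S) (allFin n) → Fin n → Hit (suc k)
    many-gadgets S m S-label k δ-large m-large S-large u with gather (suc k)
    ... | inj₁ fam = family⇒hit k (≤-trans (+-monoʳ-≤ n (m≤m+n _ 4)) (<⇒≤ δ-large)) fam
    ... | inj₂ (X , X≤ , rigid) = Balanced.rigid⇒hit S m S-label {X} (rigid (≤-<-trans (+-monoʳ-≤ n (+-monoˡ-≤ 4 X≤)) δ-large))
      X-small (≤-<-trans X≤ m-large)
      (≤-trans (+-monoˡ-≤ (suc k) (+-monoʳ-≤ (3 * n) (*-monoʳ-≤ 4 X≤))) S-large)
      (let z , _ , _ , z! = common-neighbour δ δ-≤ u u X X-small in z , z!)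
      where
      X-small : n + length X < δ + δ
      X-small = ≤-<-trans (+-monoʳ-≤ n (≤-trans X≤ (m≤m+n _ 4))) δ-large
    unequal⇒hit : ∀ {C} → Hamiltonian C → ∮ plus C + ∮ plus C ≢ n → Hit 1
    unequal⇒hit {C} ham ne with ≤-total (∮ plus C + ∮ plus C) n
    ... | inj₁ le = C , ham , inj₂ (≤-trans (≤-reflexive (+-comm _ 1)) (≤∧≢⇒< le ne))
    ... | inj₂ ge = C , ham , inj₁ (≤-trans (≤-reflexive (+-comm n 1)) (≤∧≢⇒< ge (ne ∘ sym)))

    -- Minimum degree n/2 + 1

    module Exchange (δ-large : n + 2 ≤ δ + δ) where

      -- All cycles below are Hamiltonian cycles of G - v; K stands for the number of + edges of the
      -- first of them.  An edge ab inside N(v) is neutral if inserting v there would balance that cycle.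
      module _ (v : Fin n) {xs} (all↭ : allFin n ↭ v ∷ xs) (K : ℕ) where

        n≡ : n ≡ suc (length xs)
        n≡ = trans (sym (↭allFin⇒length ↭-refl)) (↭-length all↭)

        -- Inserting v with gain g into a cycle with k edges labelled + leaves p = k + g - 1 of
        -- them, and the label sum vanishes when 2p = n.
        Neutral : ℕ → ℕ → Set
        Neutral k g = k + g + (k + g) ≡ n + 2

        neutral? : ∀ k g → Dec (Neutral k g)
        neutral? k g = (k + g + (k + g)) ℕ.≟ (n + 2)

        neutral-injective : ∀ k {g h} → Neutral k g → Neutral k h → g ≡ h
        neutral-injective k {g} {h} p q = +-cancelˡ-≡ k g h (double-injective (trans p (sym q)))
          where
          double-injective : ∀ {a b} → a + a ≡ b + b → a ≡ b
          double-injective {a} {b} eq with ≤-total a b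
          ... | inj₁ a≤b = ≤-antisym a≤b (≮⇒≥ λ a<b → <⇒≢ (+-mono-< a<b a<b) eq)
          ... | inj₂ b≤a = ≤-antisym (≮⇒≥ λ b<a → <⇒≢ (+-mono-< b<a b<a) (sym eq)) b≤a

        inside neutral : Fin n → Fin n → ℕ
        inside  a b = ⟦ adj v a ∧ adj v b ∧ adj a b ⟧
        neutral a b = ⟦ adj v a ∧ adj v b ∧ adj a b ∧ does (neutral? K (gain v a b)) ⟧

        neutral-comm : Comm neutral
        neutral-comm a b = trans (cong (λ g → ⟦ adj v a ∧ adj v b ∧ adj a b ∧ does (neutral? K g) ⟧) (gain-comm v a b))
          (trans (cong (λ e → ⟦ adj v a ∧ adj v b ∧ e ∧ does (neutral? K (gain v b a)) ⟧) (adj-comm a b))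
            (swap (adj v a) (adj v b) _))
          where
          swap : ∀ x y z → ⟦ x ∧ y ∧ z ⟧ ≡ ⟦ y ∧ x ∧ z ⟧
          swap true  true  z = refl
          swap true  false z = refl
          swap false true  z = refl
          swap false false z = refl

        neutral≤1 : ∀ a b → neutral a b ≤ 1
        neutral≤1 a b = ⟦⟧≤1 (adj v a ∧ adj v b ∧ adj a b ∧ does (neutral? K (gain v a b)))

        neutral≤inside : ∀ a b → neutral a b ≤ inside a b
        neutral≤inside a b with adj v a | adj v b | adj a b
        ... | true  | true  | true  = ⟦⟧≤1 (does (neutral? K (gain v a b)))
        ... | true  | true  | false = z≤n
        ... | true  | false | _     = z≤n
        ... | false | _     | _     = z≤n

        neutral⁻ : ∀ {a b} → 0 < neutral a b → Triangle v a b × Neutral K (gain v a b)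
        neutral⁻ {a} {b} pos =
          let va , vb , ab , e = conjuncts (adj v a) (adj v b) (adj a b) pos
          in triangle va vb ab , witness (neutral? K (gain v a b)) e
          where
          conjuncts : ∀ x y z {t} → 0 < ⟦ x ∧ y ∧ z ∧ t ⟧ → x ≡ true × y ≡ true × z ≡ true × ⟦ t ⟧ ≢ 0
          conjuncts true true true pos = refl , refl , refl , n>0⇒n≢0 pos

        inside⁺ : ∀ {a b} → Triangle v a b → inside a b ≡ 1
        inside⁺ (triangle va vb ab) rewrite va | vb | ab = refl

        ¬neutral⇒0 : ∀ {a b} → ¬ Neutral K (gain v a b) → neutral a b ≡ 0
        ¬neutral⇒0 {a} {b} ¬e with neutral a b in eq
        ... | zero  = refl
        ... | suc _ = contradiction (proj₂ (neutral⁻ {a} {b} (subst (0 <_) (sym eq) (s≤s z≤n)))) ¬e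

        try-insertion : ∀ {D a b ms} → vertices D ↭ xs → ∮ bad D ≡ 0 → D ≃ (b ⟲ ms ∷ʳ a) →
          Triangle v a b → Hit 1 ⊎ Neutral (∮ plus D) (gain v a b)
        try-insertion {D} {a} {b} {ms} D↭ good r t with neutral? (∮ plus D) (gain v a b)
        ... | yes e = inj₂ e
        ... | no ¬e = inj₁ (unequal⇒hit
                (↭-trans (insert-vertices r good t) (↭-trans (↭.prep v D↭) (↭-sym all↭)) , insert-good r good t)
                λ eq → ¬e (subst (λ p → p + p ≡ n + 2) (insert-plus r good t)
                  (trans (cong suc (+-suc _ _)) (trans (cong (2 +_) eq) (+-comm 2 n)))))

        -- The number of + edges of D may differ from K. Still, a gain that is neutral for K and one
        -- that is not are different, and at most one of them balances D.
        two-gains⇒hit : ∀ {D c d} → vertices D ↭ xs → ∮ bad D ≡ 0 →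
          Triangle v c d → ¬ Neutral K (gain v c d) →
          1 ≤ ∮ (edge c d) D → 1 ≤ ∮ neutral D → Hit 1
        two-gains⇒hit {D} {c} {d} D↭ good cd ¬e has-cd has-neutral
          with find-edge (adj⇒≢ (Triangle.a~b cd)) D has-cd
        ... | link {a} {b} ms r ab = conclude (find-neutral D has-neutral)
          where
          find-neutral : ∀ C → 1 ≤ ∮ neutral C → Link (λ a b → Triangle v a b × Neutral K (gain v a b)) C
          find-neutral (x ⟲ []) pos = contradiction (adj⇒≢ (Triangle.a~b (proj₁ (neutral⁻ {x} {x} pos)))) λ ne → ne refl
          find-neutral (x ⟲ m ∷ ms) pos
            with find-link {w = λ _ _ → 0} {neutral} x m ms (subst (_< ∮ neutral (x ⟲ m ∷ ms)) (sym (along-0 x (m ∷ ms) x)) pos)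
          ... | link {a} {b} inner r h = link inner r (neutral⁻ {a} {b} h)
          oriented : (a ≡ c × b ≡ d) ⊎ (a ≡ d × b ≡ c) → Triangle v a b × gain v a b ≡ gain v c d
          oriented (inj₁ (refl , refl)) = cd , refl
          oriented (inj₂ (refl , refl)) = swap-triangle cd , gain-comm v d c
          t : Triangle v a b
          t = proj₁ (oriented ab)
          conclude : Link (λ a b → Triangle v a b × Neutral K (gain v a b)) D → Hit 1
          conclude (link ms′ r′ (t′ , e′)) with try-insertion D↭ good r t | try-insertion D↭ good r′ t′
          ... | inj₁ hit | _        = hit
          ... | inj₂ _   | inj₁ hit = hit
          ... | inj₂ e₁  | inj₂ e₂  = contradiction
            (subst (Neutral K) (trans (neutral-injective (∮ plus D) e₂ e₁) (proj₂ (oriented ab))) e′) ¬e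

        module _ (uniq : Unique xs) where

          deg-xs : ∀ u → δ ≤ suc (deg u xs)
          deg-xs u = ≤-trans (δ-≤ u) (≤-trans (≤-reflexive (∑-↭ _ all↭)) (+-monoˡ-≤ (deg u xs) (⟦⟧≤1 (adj u v))))

          -- Replacing the links cp and dq of the cycle c p … d q … by the chord cd gives a path
          -- p … d c … q, which one reconnection closes up again.
          chord : ∀ c p ps d q qs → let C = c ⟲ p ∷ ps ++ d ∷ q ∷ qs in
            vertices C ↭ xs → ∮ bad C ≡ 0 → 3 ≤ ∮ neutral C →
            Triangle v c d → ¬ Neutral K (gain v c d) →
            Hit 1 ⊎ (neutral c p ≡ 1 × neutral d q ≡ 1 × ∮ neutral C ≤ 3)
          chord c p ps d q qs C↭ good three cd ¬e = by-adjacency (adj q p) refl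
            where
            C = c ⟲ p ∷ ps ++ d ∷ q ∷ qs
            ms = ps ++ d ∷ c ∷ reverse qs
            c~d = Triangle.a~b cd

            path↭ : p ∷ ms ∷ʳ q ↭ xs
            path↭ = ↭-trans (begin
              p ∷ ms ∷ʳ q                             ≡⟨ cong (p ∷_) (++-assoc ps _ (q ∷ [])) ⟩
              (p ∷ ps ++ d ∷ c ∷ (reverse qs ∷ʳ q))   ≡⟨ cong (λ l → p ∷ ps ++ d ∷ c ∷ l) (unfold-reverse q qs) ⟨
              (p ∷ ps) ++ d ∷ c ∷ reverse (q ∷ qs)    ↭⟨ ↭.++⁺ˡ (p ∷ ps) (↭.prep d (↭.prep c (↭-reverse (q ∷ qs)))) ⟩
              (p ∷ ps) ++ d ∷ c ∷ (q ∷ qs)            ↭⟨ ↭.++⁺ˡ (p ∷ ps) (↭.swap d c ↭-refl) ⟩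
              (p ∷ ps) ++ c ∷ d ∷ (q ∷ qs)            ↭⟨ shift c (p ∷ ps) _ ⟩
              c ∷ p ∷ ps ++ d ∷ q ∷ qs                ∎) C↭
              where open ↭.PermutationReasoning

            along-path : ∀ w → Comm w → along w p ms q + (w c p + w d q) ≡ ∮ w C + w d c
            along-path w w-comm
              rewrite along-++ w p ps d (c ∷ reverse qs) q | along-++ w p ps d (q ∷ qs) c
                    | sym (along-reverse w-comm q qs c)
              = lemma (along w p ps d) (w d c) (along w q qs c) (w c p) (w d q)
              where
              lemma : ∀ a b e f g → a + (b + e) + (f + g) ≡ f + (a + (g + e)) + b
              lemma = solve-∀

            path-good : along bad p ms q ≡ 0
            path-good = n≤0⇒n≡0 (≤-trans (m≤m+n _ (bad c p + bad d q)) (≤-reflexive (trans (along-path bad bad-comm)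
              (cong₂ _+_ good (trans (bad-comm d c) (cong (λ b → ⟦ not b ⟧) c~d))))))

            path-edge : 1 ≤ along (edge c d) p ms q
            path-edge = ≤-trans (≤-reflexive (sym (trans (edge-comm c d d c) (edge-refl c d))))
              (along-consecutive (edge c d) q (p ∷ ps) (reverse qs) refl)

            path-neutral : ∮ neutral C ≤ along neutral p ms q + (neutral c p + neutral d q)
            path-neutral = ≤-trans (m≤m+n _ (neutral d c)) (≤-reflexive (sym (along-path neutral neutral-comm)))

            by-adjacency : ∀ b → adj q p ≡ b → Hit 1 ⊎ (neutral c p ≡ 1 × neutral d q ≡ 1 × ∮ neutral C ≤ 3)
            -- The path closes by the edge qp. Of at least three neutral links only cp and dq were
            -- given up.
            by-adjacency true q~p = inj₁ (two-gains⇒hit {D} path↭ D-good cd ¬e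
              (≤-trans path-edge (≤-trans (m≤m+n _ (edge c d q p)) (≤-reflexive (sym (∮-D (edge c d))))))
              (≤-trans one (≤-trans (m≤m+n _ (neutral q p)) (≤-reflexive (sym (∮-D neutral))))))
              where
              D = p ⟲ ms ∷ʳ q
              ∮-D : ∀ w → ∮ w D ≡ along w p ms q + w q p
              ∮-D w = along-++ w p ms q [] p
              D-good : ∮ bad D ≡ 0
              D-good = trans (∮-D bad) (cong₂ _+_ path-good (cong (λ b → ⟦ not b ⟧) q~p))
              one : 1 ≤ along neutral p ms q
              one = +-cancelʳ-≤ 2 1 _ (≤-trans three (≤-trans path-neutral
                      (+-monoʳ-≤ (along neutral p ms q) (+-mono-≤ (neutral≤1 c p) (neutral≤1 d q)))))
            -- The path traverses the chord from d to c, so it suffices that the removed link does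
            -- not start at d. Protecting c as well is not affordable: with |ms| = n - 3 the count
            -- for one protected vertex is n ≤ 2(δ - 1), exactly the degree hypothesis.
            by-adjacency false q≁p = close (reconnect p ms q (d ∷ []) (Unique-inner path-unique) many)
              where
              path-unique : Unique (p ∷ ms ∷ʳ q)
              path-unique = Unique-resp-↭ (↭-sym path↭) uniq
              p≁q : adj p q ≡ false
              p≁q = trans (adj-comm p q) q≁p
              deg-ms : ∀ u → adj u p ≡ false → adj u q ≡ false → δ ≤ suc (deg u ms)
              deg-ms u u≁p u≁q = ≤-trans (deg-xs u) (s≤s (≤-reflexive (begin
                deg u xs                            ≡⟨ ∑-↭ _ path↭ ⟨
                ⟦ adj u p ⟧ + deg u (ms ∷ʳ q)       ≡⟨ cong (λ b → ⟦ b ⟧ + deg u (ms ∷ʳ q)) u≁p ⟩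
                deg u (ms ∷ʳ q)                     ≡⟨ ∑-∷ʳ _ ms q ⟩
                deg u ms + ⟦ adj u q ⟧              ≡⟨ cong (λ b → deg u ms + ⟦ b ⟧) u≁q ⟩
                deg u ms + 0                        ≡⟨ +-identityʳ _ ⟩
                deg u ms                            ∎)))
                where open ≡-Reasoning
              many : 2 + length ms + 1 ≤ deg p ms + deg q ms
              many = ≤-by 2 (≤-trans δ-large (+-mono-≤ (deg-ms p (adj-irrefl p) p≁q) (deg-ms q q≁p (adj-irrefl q))))
                (cong (_+ 2) (trans (lemma (length ms)) (sym (trans n≡ (cong suc (trans (sym (↭-length path↭))
                  (cong suc (length-++ ms))))))))
                (lemma′ (deg p ms) (deg q ms))
                where
                lemma : ∀ l → 2 + l + 1 ≡ suc (suc (l + 1))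
                lemma = solve-∀
                lemma′ : ∀ a b → suc a + suc b ≡ a + b + 2
                lemma′ = solve-∀
              close : Reconnection p ms q (d ∷ []) → Hit 1 ⊎ (neutral c p ≡ 1 × neutral d q ≡ 1 × ∮ neutral C ≤ 3)
              close R = by-neutral (∮ neutral cycle) refl
                where
                open Reconnection R renaming (u to y; v to z)
                D↭ : vertices cycle ↭ xs
                D↭ = ↭-trans perm path↭
                D-good : ∮ bad cycle ≡ 0
                D-good = n≤0⇒n≡0 (≤-trans (m≤m+n _ (bad y z)) (≤-reflexive (trans (change bad bad-comm)
                  (cong₂ _+_ path-good (cong₂ (λ a b → ⟦ not a ⟧ + ⟦ not b ⟧) x~v y~u)))))
                y≢d : y ≢ d
                y≢d y≡d = mem-false {Z = d ∷ []} u∉Z (here y≡d)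
                lost : edge c d y z ≡ 0
                lost with edge c d y z in eq
                ... | zero  = refl
                ... | suc _ with edge-cases {p = c} {d} {y} {z} (λ e → 1+n≢0 (trans (sym eq) e))
                ...   | inj₂ (y≡d , _) = contradiction y≡d y≢d
                ...   | inj₁ (y≡c , z≡d) = contradiction
                          (trans split (cong₂ (λ a b → before ++ a ∷ b ∷ after) y≡c z≡d))
                          (no-return ps (Unique-inner path-unique))
                has-cd : 1 ≤ ∮ (edge c d) cycle
                has-cd = ≤-trans path-edge (≤-trans (m≤m+n _ _) (≤-reflexive
                  (trans (sym (change (edge c d) (edge-comm c d))) (trans (cong (∮ (edge c d) cycle +_) lost) (+-identityʳ _)))))
                by-neutral : ∀ k → ∮ neutral cycle ≡ k →
                  Hit 1 ⊎ (neutral c p ≡ 1 × neutral d q ≡ 1 × ∮ neutral C ≤ 3)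
                by-neutral (suc k) eq = inj₁ (two-gains⇒hit {cycle} D↭ D-good cd ¬e has-cd (subst (1 ≤_) (sym eq) (s≤s z≤n)))
                -- No neutral link survives, so those of C were all among cp, dq and yz; being at
                -- least three, they are exactly these.
                by-neutral zero    eq = let cp , dq = tight (neutral≤1 c p) (neutral≤1 d q) (≤-trans three upper) in
                  inj₂ (cp , dq , ≤-trans upper (s≤s (+-mono-≤ (neutral≤1 c p) (neutral≤1 d q))))
                  where
                  few : along neutral p ms q ≤ 1
                  few = ≤-trans (m≤m+n _ _) (≤-trans (≤-reflexive (trans (sym (change neutral neutral-comm))
                          (cong (_+ neutral y z) eq))) (neutral≤1 y z))
                  upper : ∮ neutral C ≤ 1 + (neutral c p + neutral d q)
                  upper = ≤-trans path-neutral (+-monoˡ-≤ _ few)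
                  tight : ∀ {a b} → a ≤ 1 → b ≤ 1 → 3 ≤ 1 + (a + b) → a ≡ 1 × b ≡ 1
                  tight {1} {1} _ _ _ = refl , refl
                  tight {0} {0} _ _ (s≤s ())
                  tight {0} {1} _ _ (s≤s (s≤s ()))
                  tight {1} {0} _ _ (s≤s (s≤s ()))
                  tight {suc (suc a)} (s≤s ()) _ _
                  tight {0} {suc (suc b)} _ (s≤s ()) _
                  tight {1} {suc (suc b)} _ (s≤s ()) _

        -- Count the ends in N(v) over the n - 1 links of the cycle: the total is 2 deg v ≥ n + 2, a
        -- link inside N(v) contributes 2 and any other at most 1.
        inside-≥3 : ∀ {C} → vertices C ↭ xs → ∮ bad C ≡ 0 → 3 ≤ ∮ inside C
        inside-≥3 {x ⟲ ys} C↭ good = ≤-by (length xs) (≤-trans δ-large (≤-trans (+-mono-≤ deg-v deg-v) double))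
          (trans (lemma (length xs)) (cong (_+ 2) (sym n≡))) refl
          where
          open ≤-Reasoning
          C = x ⟲ ys
          lemma : ∀ l → 3 + l ≡ suc l + 2
          lemma = solve-∀
          h : Fin n → ℕ
          h u = ⟦ adj v u ⟧
          deg-v : δ ≤ deg v xs
          deg-v = begin
            δ                        ≤⟨ δ-≤ v ⟩
            deg v (allFin n)         ≡⟨ ∑-↭ h all↭ ⟩
            ⟦ adj v v ⟧ + deg v xs   ≡⟨ cong (λ b → ⟦ b ⟧ + deg v xs) (adj-irrefl v) ⟩
            deg v xs                 ∎
          rearrange : ∀ a s → a + s + (a + s) ≡ a + (s + s) + a
          rearrange = solve-∀
          pointwise : ∀ x y z → ⟦ x ⟧ + ⟦ y ⟧ ≤ ⟦ x ∧ y ∧ z ⟧ + (1 + ⟦ not z ⟧)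
          pointwise true  true  true  = ≤-refl
          pointwise true  true  false = ≤-refl
          pointwise true  false z     = s≤s z≤n
          pointwise false true  z     = s≤s z≤n
          pointwise false false z     = z≤n
          double : deg v xs + deg v xs ≤ ∮ inside C + length xs
          double = begin
            deg v xs + deg v xs                               ≡⟨ cong₂ _+_ (∑-↭ h C↭) (∑-↭ h C↭) ⟨
            h x + ∑ h ys + (h x + ∑ h ys)                     ≡⟨ rearrange (h x) (∑ h ys) ⟩
            h x + (∑ h ys + ∑ h ys) + h x                     ≡⟨ along-ends h x ys x ⟨
            ∮ (λ a b → h a + h b) C                           ≤⟨ along-mono (λ a b → pointwise (adj v a) (adj v b) (adj a b)) x ys x ⟩
            ∮ (λ a b → inside a b + (1 + bad a b)) C          ≡⟨ along-+ inside _ x ys x ⟩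
            ∮ inside C + ∮ (λ a b → 1 + bad a b) C            ≡⟨ cong (∮ inside C +_) (along-+ (λ _ _ → 1) bad x ys x) ⟩
            ∮ inside C + (∮ (λ _ _ → 1) C + ∮ bad C)          ≡⟨ cong (∮ inside C +_) (cong₂ _+_ (along-1 x ys x) good) ⟩
            ∮ inside C + (suc (length ys) + 0)                ≡⟨ cong (∮ inside C +_) (trans (+-identityʳ _) (↭-length C↭)) ⟩
            ∮ inside C + length xs                            ∎

        rotate-to : ∀ {c : Fin n} C → c ∈ vertices C → ∃ λ cs → C ≃ (c ⟲ cs)
        rotate-to (x ⟲ xs) (here refl) = xs , ≃-refl
        rotate-to (x ⟲ xs) (there c∈) with ∈-∃++ c∈
        ... | ys , zs , refl = zs ++ x ∷ ys , rotate x ys _ zs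

        -- If c and d are consecutive on C, then cd is a link inside N(v) that is not neutral, which
        -- is excluded. Otherwise the rerouting of C fails only if the links leaving c and d are
        -- neutral and C has at most three neutral links, and that of its mirror image only if the
        -- links entering them are neutral too: four in all.
        chord⇒hit : Unique xs → ∀ {C c d} → vertices C ↭ xs → ∮ bad C ≡ 0 → ∮ inside C ≤ ∮ neutral C →
          c ∈ xs → d ∈ xs → Triangle v c d → ¬ Neutral K (gain v c d) → Hit 1
        chord⇒hit uniq {C} {c} {d} C↭ good inside≤neutral c∈ d∈ cd ¬e =
          let cs , r = rotate-to C (∈-resp-↭ (↭-sym C↭) c∈)
              c∷cs↭ = ↭-trans (↭-sym (vertices-↭ r)) C↭
              ps , qs , cs≡ = ∈-∃++ (other (∈-resp-↭ (↭-sym c∷cs↭) d∈))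
          in arcs ps qs (subst (λ l → C ≃ (c ⟲ l)) cs≡ r)
          where
          c≢d = adj⇒≢ (Triangle.a~b cd)
          other : ∀ {l} → d ∈ c ∷ l → d ∈ l
          other (here d≡c) = contradiction (sym d≡c) c≢d
          other (there d∈) = d∈
          cd-0 : neutral c d ≡ 0
          cd-0 = ¬neutral⇒0 ¬e
          absurd : ∀ {D} → C ≃ D → ∮ neutral D < ∮ inside D → Hit 1
          absurd r lt = contradiction inside≤neutral (<⇒≱ (subst₂ _<_ (sym (∮-≡ r neutral)) (sym (∮-≡ r inside)) lt))
          three : 3 ≤ ∮ neutral C
          three = ≤-trans (inside-≥3 {C} C↭ good) inside≤neutral

          arcs : ∀ ps qs → C ≃ (c ⟲ ps ++ d ∷ qs) → Hit 1
          arcs [] qs r = absurd r (+-mono-<-≤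
            (≤-reflexive (trans (cong suc cd-0) (sym (inside⁺ cd)))) (along-mono neutral≤inside d qs c))
          arcs (p ∷ ps) [] r = absurd r (subst₂ _<_ (sym (along-++ neutral c (p ∷ ps) d [] c)) (sym (along-++ inside c (p ∷ ps) d [] c))
            (+-mono-≤-< (along-mono neutral≤inside c (p ∷ ps) d)
              (≤-reflexive (trans (cong suc (trans (neutral-comm d c) cd-0)) (sym (inside⁺ (swap-triangle cd)))))))
          arcs (p ∷ ps) (q ∷ qs) r with chord uniq c p ps d q qs (↭-trans (↭-sym (vertices-↭ r)) C↭)
                                          (trans (sym (∮-≡ r bad)) good) (≤-trans three (≤-reflexive (∮-≡ r neutral))) cd ¬e
          ... | inj₁ hit = hit
          ... | inj₂ (cp , dq , ≤3) = mirrored (p ∷ ps) (q ∷ qs) refl refl (initLast (p ∷ ps)) (initLast (q ∷ qs))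
            where
            -- The arcs are named again so that their last vertices m and l can be split off. Read
            -- backwards, C leaves c towards l, passes d, and continues with m.
            mirrored : ∀ P Q → P ≡ p ∷ ps → Q ≡ q ∷ qs → InitLast P → InitLast Q → Hit 1
            mirrored _ _ P≡ Q≡ (ps′ ∷ʳ′ m) (qs′ ∷ʳ′ l)
              with chord uniq c l (reverse qs′) d m (reverse ps′) perm (trans (flip-∮ bad bad-comm) (trans (sym (∮-≡ r bad)) good))
                     (≤-trans three (≤-reflexive (trans (∮-≡ r neutral) (sym (flip-∮ neutral neutral-comm))))) cd ¬e
              where
              last-first : ∀ (x : Fin n) ys → reverse (ys ∷ʳ x) ≡ x ∷ reverse ys
              last-first x ys = reverse-++ ys (x ∷ [])
              flipped≡ : l ∷ reverse qs′ ++ d ∷ m ∷ reverse ps′ ≡ reverse (q ∷ qs) ++ d ∷ reverse (p ∷ ps)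
              flipped≡ = cong₂ (λ x y → x ++ d ∷ y)
                (trans (sym (last-first l qs′)) (cong reverse Q≡)) (trans (sym (last-first m ps′)) (cong reverse P≡))
              perm : c ∷ l ∷ reverse qs′ ++ d ∷ m ∷ reverse ps′ ↭ xs
              perm = ↭-trans (↭.prep c (begin
                l ∷ reverse qs′ ++ d ∷ m ∷ reverse ps′    ≡⟨ flipped≡ ⟩
                reverse (q ∷ qs) ++ d ∷ reverse (p ∷ ps)  ↭⟨ ↭.++⁺ (↭-reverse (q ∷ qs)) (↭.prep d (↭-reverse (p ∷ ps))) ⟩
                (q ∷ qs) ++ d ∷ p ∷ ps                    ↭⟨ shift d (q ∷ qs) (p ∷ ps) ⟩
                d ∷ (q ∷ qs) ++ (p ∷ ps)                  ↭⟨ ++-comm (d ∷ q ∷ qs) (p ∷ ps) ⟩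
                (p ∷ ps) ++ d ∷ q ∷ qs                    ∎)) (↭-trans (↭-sym (vertices-↭ r)) C↭)
                where open ↭.PermutationReasoning
              flip-∮ : ∀ w → Comm w → ∮ w (c ⟲ l ∷ reverse qs′ ++ d ∷ m ∷ reverse ps′) ≡ ∮ w (c ⟲ p ∷ ps ++ d ∷ q ∷ qs)
              flip-∮ w w-comm = begin
                along w c (l ∷ reverse qs′ ++ d ∷ m ∷ reverse ps′) c              ≡⟨ cong (λ l → along w c l c) flipped≡ ⟩
                along w c (reverse (q ∷ qs) ++ d ∷ reverse (p ∷ ps)) c            ≡⟨ along-++ w c (reverse (q ∷ qs)) d (reverse (p ∷ ps)) c ⟩
                along w c (reverse (q ∷ qs)) d + along w d (reverse (p ∷ ps)) c   ≡⟨ cong₂ _+_ (along-reverse w-comm d (q ∷ qs) c) (along-reverse w-comm c (p ∷ ps) d) ⟨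
                along w d (q ∷ qs) c + along w c (p ∷ ps) d                       ≡⟨ +-comm _ (along w c (p ∷ ps) d) ⟩
                along w c (p ∷ ps) d + along w d (q ∷ qs) c                       ≡⟨ along-++ w c (p ∷ ps) d (q ∷ qs) c ⟨
                along w c (p ∷ ps ++ d ∷ q ∷ qs) c                                ∎
                where open ≡-Reasoning
            ... | inj₁ hit = hit
            ... | inj₂ (cl , dm , _) = contradiction ≤3 (<⇒≱ (begin
                4                                                       ≡⟨ cong₂ _+_ (cong₂ _+_ cp (trans (neutral-comm m d) dm)) (cong₂ _+_ dq (trans (neutral-comm l c) cl)) ⟨
                (neutral c p + neutral m d) + (neutral d q + neutral l c) ≤⟨ +-mono-≤ (along-ends-≤ neutral c p ps d (sym P≡)) (along-ends-≤ neutral d q qs c (sym Q≡)) ⟩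
                along neutral c (p ∷ ps) d + along neutral d (q ∷ qs) c ≡⟨ along-++ neutral c (p ∷ ps) d (q ∷ qs) c ⟨
                ∮ neutral (c ⟲ p ∷ ps ++ d ∷ q ∷ qs)                    ∎))
              where open ≤-Reasoning

        in-xs : ∀ {z} → adj v z ≡ true → z ∈ xs
        in-xs {z} v~z with ∈-resp-↭ all↭ (∈-allFin z)
        ... | here refl = contradiction refl (adj⇒≢ v~z)
        ... | there z∈  = z∈

        -- Here K belongs to C itself, so inserting v into an inside link that is not neutral
        -- already unbalances the labels. If all inside links are neutral, one of ab and cd has
        -- another gain and serves as the chord.
        unequal-gains : Unique xs → ∀ {C} → vertices C ↭ xs → ∮ bad C ≡ 0 → ∮ plus C ≡ K →
          ∀ {a b c d} → Triangle v a b → Triangle v c d → gain v a b ≢ gain v c d → Hit 1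
        unequal-gains uniq {C} C↭ good plus≡ {a} {b} {c} {d} ab cd ne with ∮ neutral C <? ∮ inside C
        ... | yes lt = off-balance C C↭ good plus≡ lt
          where
          off-balance : ∀ C → vertices C ↭ xs → ∮ bad C ≡ 0 → ∮ plus C ≡ K → ∮ neutral C < ∮ inside C → Hit 1
          off-balance (x ⟲ []) C↭ good plus≡ lt rewrite adj-irrefl x with adj v x
          ... | true  = contradiction lt λ ()
          ... | false = contradiction lt λ ()
          off-balance C@(x ⟲ m ∷ ms) C↭ good plus≡ lt with find-link x m ms lt
          ... | link {s} {t} inner r h = conclude (try-insertion {C} C↭ good r tri)
            where
            tri : Triangle v s t
            tri = extract (adj v s) (adj v t) (adj s t) refl refl refl (≤-trans (s≤s z≤n) h)
              where
              extract : ∀ x y z → adj v s ≡ x → adj v t ≡ y → adj s t ≡ z → 0 < ⟦ x ∧ y ∧ z ⟧ → Triangle v s t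
              extract true true true vs vt st _ = triangle vs vt st
            conclude : Hit 1 ⊎ Neutral (∮ plus C) (gain v s t) → Hit 1
            conclude (inj₁ hit) = hit
            conclude (inj₂ e) = contradiction h (≤⇒≯ (≤-trans (≤-reflexive (inside⁺ tri))
              (≤-reflexive (sym (neutral⁺ tri (subst (λ k → Neutral k (gain v s t)) plus≡ e))))))
              where
              neutral⁺ : ∀ {a b} → Triangle v a b → Neutral K (gain v a b) → neutral a b ≡ 1
              neutral⁺ {a} {b} (triangle va vb ab) e rewrite va | vb | ab = cong ⟦_⟧ (dec-true (neutral? K (gain v a b)) e)
        ... | no ¬lt with neutral? K (gain v a b)
        ...   | no ¬e = chord⇒hit uniq {C} C↭ good (≮⇒≥ ¬lt) (in-xs (Triangle.v~a ab)) (in-xs (Triangle.v~b ab)) ab ¬e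
        ...   | yes e = chord⇒hit uniq {C} C↭ good (≮⇒≥ ¬lt) (in-xs (Triangle.v~a cd)) (in-xs (Triangle.v~b cd)) cd
                          λ e′ → ne (neutral-injective K e e′)

      unequal-gains⇒hit : ∀ {v a b c d} → Triangle v a b → Triangle v c d → gain v a b ≢ gain v c d → Hit 1
      unequal-gains⇒hit {v} {a} ab cd ne with complement (v ∷ []) ([] ∷ []) (∈-allFin v ∷ [])
      ... | [] , all↭ = contradiction (∈-resp-↭ all↭ (∈-allFin a)) λ { (here refl) → adj⇒≢ (Triangle.v~a ab) refl }
      ... | x ∷ xs , all↭ with remaining-cycle {v ∷ []} {x ∷ xs} {[]} all↭ large (x ⟲ xs) ↭-refl
        where
        large : n + 1 + 0 ≤ δ + δ
        large = ≤-trans (≤-trans (≤-reflexive (+-identityʳ _)) (+-monoʳ-≤ n (s≤s z≤n))) δ-large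
      ...   | C , C↭ , good , _ = unequal-gains v all↭ (∮ plus C) (unique-tail (Unique-resp-↭ all↭ (allFin⁺ n))) {C} C↭ good refl ab cd ne
        where
        unique-tail : ∀ {x : Fin n} {xs} → Unique (x ∷ xs) → Unique xs
        unique-tail (_ ∷ u) = u

    one-hit : ∀ (S : Fin n → Bool) m
      (S-label : ∀ s {v} → S v ≡ true → m ≤ ∑ (λ u → labelled s v u) (allFin n)) →
      n < δ + δ → 0 < m → 3 * n < 4 * ∑ (⟦_⟧ ∘ S) (allFin n) → Fin n → Hit 1
    one-hit S m S-label δ-large m>0 S-large v₀ with n + 2 ≤? δ + δ
    ... | no ¬large = let C , ham = hamiltonian-exists (Fin⇒0< v₀) (<⇒≤ δ-large) in unequal⇒hit ham λ eq → odd δ (∮ plus C) (trans 2δ≡ (cong suc (sym eq)))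
      where
      2δ≡ : δ + δ ≡ suc n
      2δ≡ = ≤-antisym (s≤s⁻¹ (≤-trans (≰⇒> ¬large) (≤-reflexive (+-comm n 2)))) δ-large
      odd : ∀ a b → a + a ≢ suc (b + b)
      odd (suc a) (suc b) eq = odd a b (suc-injective (suc-injective
        (trans (cong suc (sym (+-suc a a))) (trans eq (cong (2 +_) (+-suc b b))))))
      odd (suc a) zero eq = contradiction (trans (sym (+-suc a a)) (suc-injective eq)) λ ()
    ... | yes large
      with any? (λ v → any? (λ a → any? (λ b → any? (λ c → any? (λ d →
        triangle? v a b ×-dec triangle? v c d ×-dec ¬? (gain v a b ℕ.≟ gain v c d))))))
    ...   | yes (_ , _ , _ , _ , _ , ab , cd , ne) =
              Exchange.unequal-gains⇒hit large ab cd ne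
    -- The search compared any two triangles at a vertex, overlapping or not, so the whole graph is
    -- rigid and no vertex has to be deleted.
    ...   | no none = Balanced.rigid⇒hit S m S-label {[]}
              (λ {v} {a} {b} {c} {d} _ _ _ _ _ ab cd → decidable-stable
                (gain v a b ℕ.≟ gain v c d) λ ne → none (v , a , b , c , d , ab , cd , ne))
              (≤-trans (≤-reflexive (cong suc (+-identityʳ n))) δ-large) m>0
              (≤-trans (≤-reflexive (trans (+-comm _ 1) (cong suc (+-identityʳ (3 * n))))) S-large) (v₀ , refl)

  -- From lists to Hamilton cycles

  -- With the base point of a cycle as the default value, nth closes the cycle.
  nth : ∀ {A : Set} → A → List A → ℕ → A
  nth d []       _       = d
  nth d (x ∷ xs) zero    = x
  nth d (x ∷ xs) (suc k) = nth d xs k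

  nth-∈ : ∀ {A : Set} (d : A) xs {k} → k < length xs → nth d xs k ∈ xs
  nth-∈ d (x ∷ xs) {zero}  _         = here refl
  nth-∈ d (x ∷ xs) {suc k} (s≤s k<l) = there (nth-∈ d xs k<l)

  nth-injective : ∀ {A : Set} (d : A) {xs} → Unique xs → ∀ {j k} → j < length xs → k < length xs →
    nth d xs j ≡ nth d xs k → j ≡ k
  nth-injective d (x∉ ∷ u) {zero}  {zero}  _         _         eq = refl
  nth-injective d (x∉ ∷ u) {zero}  {suc k} _         (s≤s k<l) eq = contradiction eq (All.lookup x∉ (nth-∈ d _ k<l))
  nth-injective d (x∉ ∷ u) {suc j} {zero}  (s≤s j<l) _         eq = contradiction (sym eq) (All.lookup x∉ (nth-∈ d _ j<l))
  nth-injective d (x∉ ∷ u) {suc j} {suc k} (s≤s j<l) (s≤s k<l) eq = cong suc (nth-injective d u j<l k<l eq)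

  nth-end : ∀ {A : Set} (d : A) xs → nth d xs (length xs) ≡ d
  nth-end d []       = refl
  nth-end d (x ∷ xs) = nth-end d xs

  nth-wrap : ∀ {A : Set} (x : A) xs m k .{{_ : NonZero m}} → suc (length xs) ≡ m → k < m →
    nth x (x ∷ xs) (suc k % m) ≡ nth x xs k
  nth-wrap x xs m k refl k<m with suc k <? m
  ... | yes sk<m = cong (nth x (x ∷ xs)) (m<n⇒m%n≡m sk<m)
  ... | no ¬sk<m = begin
    nth x (x ∷ xs) (suc k % m)     ≡⟨ cong (λ j → nth x (x ∷ xs) (j % m)) (≤-antisym k<m (≮⇒≥ ¬sk<m)) ⟩
    nth x (x ∷ xs) (m % m)         ≡⟨ cong (nth x (x ∷ xs)) (n%n≡0 m) ⟩
    x                              ≡⟨ nth-end x xs ⟨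
    nth x xs (length xs)           ≡⟨ cong (nth x xs) (suc-injective (≤-antisym k<m (≮⇒≥ ¬sk<m))) ⟨
    nth x xs k                     ∎
    where open ≡-Reasoning

  along-≡0-nth : ∀ {A : Set} (w : A → A → ℕ) y ys x → along w y ys x ≡ 0 →
    ∀ {k} → k < suc (length ys) → w (nth x (y ∷ ys) k) (nth x ys k) ≡ 0
  along-≡0-nth w y []       x eq {zero}  _         = eq
  along-≡0-nth w y []       x eq {suc k} (s≤s ())
  along-≡0-nth w y (z ∷ zs) x eq {zero}  _         = m+n≡0⇒m≡0 (w y z) eq
  along-≡0-nth w y (z ∷ zs) x eq {suc k} (s≤s k<l) = along-≡0-nth w z zs x (m+n≡0⇒n≡0 (w y z) eq) k<l

  sum-along : ∀ {A : Set} (w w′ : A → A → ℕ) y ys x m → suc (length ys) ≡ m →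
    sumℤ {m} (λ i → ℤ.+ w (nth x (y ∷ ys) (toℕ i)) (nth x ys (toℕ i)) ℤ.- ℤ.+ w′ (nth x (y ∷ ys) (toℕ i)) (nth x ys (toℕ i)))
    ≡ ℤ.+ along w y ys x ℤ.- ℤ.+ along w′ y ys x
  sum-along w w′ y []       x _ refl = ℤ.+-identityʳ _
  sum-along w w′ y (z ∷ zs) x _ refl = trans (cong (λ s → (ℤ.+ w y z ℤ.- ℤ.+ w′ y z) ℤ.+ s) (sum-along w w′ z zs x _ refl))
    (trans (regroup (ℤ.+ w y z) (ℤ.+ w′ y z) (ℤ.+ along w z zs x) (ℤ.+ along w′ z zs x))
      (cong₂ ℤ._-_ (sym (ℤ.pos-+ (w y z) _)) (sym (ℤ.pos-+ (w′ y z) _))))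
    where
    regroup : ∀ a b c d → (a ℤ.- b) ℤ.+ (c ℤ.- d) ≡ (a ℤ.+ c) ℤ.- (b ℤ.+ d)
    regroup = ℤ-Solver.solve-∀

  length-filter : ∀ {A : Set} {P : U.Pred A 0ℓ} (P? : U.Decidable P) xs →
    length (filter P? xs) ≡ ∑ (λ x → ⟦ does (P? x) ⟧) xs
  length-filter P? []       = refl
  length-filter P? (x ∷ xs) with does (P? x)
  ... | true  = cong suc (length-filter P? xs)
  ... | false = length-filter P? xs

  -- With p + q = n the difference p - q equals 2p - n.
  ∣-∣-≥ : ∀ {p q n k} → p + q ≡ n → (n + k ≤ p + p) ⊎ (p + p + k ≤ n) → k ≤ ℤ.∣ ℤ.+ p ℤ.- ℤ.+ q ∣
  ∣-∣-≥ {p} {q} {n} {k} refl (inj₁ le) = ≤-trans (m+n≤o⇒n≤o∸m q (≤-by p le (lemma q k p) refl))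
    (≤-reflexive (sym (cong ℤ.∣_∣ (trans (ℤ.[+m]-[+n]≡m⊖n p q) (ℤ.⊖-≥ q≤p)))))
    where
    lemma : ∀ q k p → q + k + p ≡ p + q + k
    lemma = solve-∀
    q+k≤p : q + k ≤ p
    q+k≤p = ≤-by p le (lemma q k p) refl
    q≤p : q ≤ p
    q≤p = ≤-trans (m≤m+n q k) q+k≤p
    m+n≤o⇒n≤o∸m : ∀ m {n o} → m + n ≤ o → n ≤ o ∸ m
    m+n≤o⇒n≤o∸m m {n} {o} le = ≤-trans (≤-reflexive (sym (m+n∸m≡n m n))) (∸-monoˡ-≤ m le)
  ∣-∣-≥ {p} {q} {n} {k} refl (inj₂ le) = ≤-trans (≤-trans (≤-reflexive (sym (m+n∸m≡n p k))) (∸-monoˡ-≤ p p+k≤q))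
    (≤-reflexive (sym (trans (cong ℤ.∣_∣ (ℤ.[+m]-[+n]≡m⊖n p q)) (trans (ℤ.∣m⊖n∣≡∣n⊖m∣ p q) (cong ℤ.∣_∣ (ℤ.⊖-≥ (≤-trans (m≤m+n p k) p+k≤q)))))))
    where
    lemma : ∀ p k → p + k + p ≡ p + p + k
    lemma = solve-∀
    p+k≤q : p + k ≤ q
    p+k≤q = ≤-by p le (lemma p k) (+-comm p q)

  +≢- : Sign.+ ≢ Sign.-
  +≢- ()

  module FromGraph {n : ℕ} (G : Graph n) (f : Labelling G) where

    -- `label` takes a proof of adjacency, whereas `sgn` is total and `false` on non-edges; hence
    -- `labelled` conjoins it with `adj`.
    adj sgn : Fin n → Fin n → Bool
    adj u v = does (adj? G u v)
    sgn u v = does (hasLabel? f Sign.+ u v)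

    adj-comm : ∀ u v → adj u v ≡ adj v u
    adj-comm u v = does-⇔ (mk⇔ (adj-sym G) (adj-sym G)) (adj? G u v) (adj? G v u)

    adj-irrefl : ∀ v → adj v v ≡ false
    adj-irrefl v = dec-false (adj? G v v) (no-loop G v)

    sgn-comm : ∀ u v → sgn u v ≡ sgn v u
    sgn-comm u v = does-⇔ (mk⇔ flip-label flip-label) (hasLabel? f Sign.+ u v) (hasLabel? f Sign.+ v u)
      where
      flip-label : ∀ {u v} → HasLabel f Sign.+ u v → HasLabel f Sign.+ v u
      flip-label {u} {v} (p , e) = adj-sym G p , trans (sym (label-sym f u v p (adj-sym G p))) e

    δ : ℕ
    δ = Defs.δ G

    δ-≤ : ∀ v → δ ≤ Dirac.deg adj adj-comm adj-irrefl v (allFin n)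
    δ-≤ v = ≤-trans (min≤v⁺ n (map (degree G) (allFin n)) (inj₂ (map⁺ (lose (∈-allFin v) ≤-refl))))
                    (≤-reflexive (length-filter (adj? G v) (allFin n)))

    open Labelled adj adj-comm adj-irrefl sgn sgn-comm δ δ-≤ public

    label-irrelevant : ∀ {u v} (p q : Adj G u v) → label f u v p ≡ label f u v q
    label-irrelevant {u} {v} p q = trans (label-sym f u v p (adj-sym G q)) (sym (label-sym f u v q (adj-sym G q)))

    label-value : ∀ {u v} (p : Adj G u v) → label f u v p ℤ.◃ 1 ≡ ℤ.+ plus u v ℤ.- ℤ.+ minus u v
    label-value {u} {v} p rewrite dec-true (adj? G u v) p = by-label (label f u v p) refl
      where
      by-label : ∀ s → label f u v p ≡ s → s ℤ.◃ 1 ≡ ℤ.+ ⟦ sgn u v ⟧ ℤ.- ℤ.+ ⟦ not (sgn u v) ⟧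
      by-label Sign.+ e rewrite dec-true (hasLabel? f Sign.+ u v) (p , e) = refl
      by-label Sign.- e rewrite dec-false (hasLabel? f Sign.+ u v)
        (λ (q , e′) → +≢- (trans (sym e′) (trans (label-irrelevant q p) e))) = refl

    label-degree : ∀ v m → m ≤ labelDegree f Sign.+ v → m ≤ labelDegree f Sign.- v →
      ∀ s → m ≤ ∑ (λ u → labelled s v u) (allFin n)
    label-degree v m m≤+ m≤- true = ≤-trans m≤+ (≤-trans (≤-reflexive (length-filter (hasLabel? f Sign.+ v) (allFin n))) (∑-mono pointwise (allFin n)))
      where
      pointwise : ∀ u → ⟦ sgn v u ⟧ ≤ plus v u
      pointwise u with hasLabel? f Sign.+ v u
      ... | no _        = z≤n
      ... | yes (p , _) rewrite dec-true (adj? G v u) p = ≤-refl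
    label-degree v m m≤+ m≤- false = ≤-trans m≤- (≤-trans (≤-reflexive (length-filter (hasLabel? f Sign.- v) (allFin n))) (∑-mono pointwise (allFin n)))
      where
      pointwise : ∀ u → ⟦ does (hasLabel? f Sign.- v u) ⟧ ≤ minus v u
      pointwise u with hasLabel? f Sign.- v u
      ... | no _        = z≤n
      ... | yes (p , e) rewrite dec-true (adj? G v u) p
            | dec-false (hasLabel? f Sign.+ v u) (λ (q , e′) → +≢- (trans (sym e′) (trans (label-irrelevant q p) e))) = ≤-refl

    to-cycle : ∀ C → Hamiltonian C → 3 ≤ n → Σ (HamiltonCycle G) λ H →
      discrepancy f H ≡ ℤ.∣ ℤ.+ ∮ plus C ℤ.- ℤ.+ ∮ minus C ∣
    to-cycle (x ⟲ xs) (C↭ , good) 3≤n = H , cong ℤ.∣_∣ (trans (sum-cong-≗ pointwise) (sum-along plus minus x xs x n len))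
      where
      len : suc (length xs) ≡ n
      len = ↭allFin⇒length C↭
      at : Fin n → Fin n
      at i = nth x (x ∷ xs) (toℕ i)
      in-range : ∀ (i : Fin n) → toℕ i < suc (length xs)
      in-range i = subst (toℕ i <_) (sym len) (toℕ<n i)
      at-next : ∀ i → at (next i) ≡ nth x xs (toℕ i)
      at-next i = trans (cong (nth x (x ∷ xs)) (toℕ-fromℕ< (m%n<n (suc (toℕ i)) n {{nonZeroIndex i}})))
                        (nth-wrap x xs n (toℕ i) {{nonZeroIndex i}} len (toℕ<n i))
      adjacent-at : ∀ i → Adj G (at i) (at (next i))
      -- A non-adjacent pair has weight 1 in `bad`, whose total over the cycle is 0; only the `yes`
      -- case remains.
      adjacent-at i rewrite at-next i
        with adj? G (nth x (x ∷ xs) (toℕ i)) (nth x xs (toℕ i)) | along-≡0-nth bad x xs x good (in-range i)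
      ... | yes p | _ = p
      H : HamiltonCycle G
      H = record
        { 3≤n       = 3≤n
        ; order     = at
        ; injective = λ {i} {j} eq → toℕ-injective
            (nth-injective x (Unique-resp-↭ (↭-sym C↭) (allFin⁺ n)) (in-range i) (in-range j) eq)
        ; adjacent  = adjacent-at
        }
      pointwise : ∀ i → label f (at i) (at (next i)) (adjacent-at i) ℤ.◃ 1
                      ≡ ℤ.+ plus (at i) (nth x xs (toℕ i)) ℤ.- ℤ.+ minus (at i) (nth x xs (toℕ i))
      pointwise i = trans (label-value (adjacent-at i))
        (cong (λ v → ℤ.+ plus (at i) v ℤ.- ℤ.+ minus (at i) v) (at-next i))

    hit⇒cycle : ∀ {k} → 3 ≤ n → Hit k → Σ (HamiltonCycle G) λ H → k ≤ discrepancy f H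
    hit⇒cycle 3≤n (C , ham@(C↭ , good) , disc) with to-cycle C ham 3≤n
    ... | H , eq = H , ≤-trans (∣-∣-≥ {∮ plus C} {∮ minus C} (trans (plus+minus C good) (↭allFin⇒length C↭)) disc) (≤-reflexive (sym eq))

    -- Since δ ≤ n - 1, the hypothesis gives n + 1 ≤ 2n - 2.
    n≥3 : Fin n → n < δ + δ → 3 ≤ n
    n≥3 v large with complement (v ∷ []) ([] ∷ []) (∈-allFin v ∷ [])
    ... | xs , all↭ = ≤-by n (≤-trans (s≤s (s≤s large)) (≤-trans (≤-reflexive (cong suc (sym (+-suc δ δ)))) (+-mono-≤ δ<n δ<n))) refl refl
      where
      δ<n : δ < n
      δ<n = begin-strict
        δ                          ≤⟨ δ-≤ v ⟩
        deg v (allFin n)           ≡⟨ ∑-↭ _ all↭ ⟩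
        ⟦ adj v v ⟧ + deg v xs     ≡⟨ cong (λ b → ⟦ b ⟧ + deg v xs) (adj-irrefl v) ⟩
        deg v xs                   ≤⟨ ∑-mono (λ u → ⟦⟧≤1 (adj v u)) xs ⟩
        ∑ (λ _ → 1) xs             ≡⟨ ∑-1 xs ⟩
        length xs                  <⟨ ≤-refl ⟩
        suc (length xs)            ≡⟨ ↭-length all↭ ⟨
        length (allFin n)          ≡⟨ length-tabulate _ ⟩
        n                          ∎
        where open ≤-Reasoning

  -- From integer surpluses to the number of gadgets.

  ∣∣-∑ : ∀ {n} (S : Subset n) → ∣ S ∣ ≡ ∑ (⟦_⟧ ∘ Vec.lookup S) (allFin n)
  ∣∣-∑ []          = refl
  ∣∣-∑ {suc n} (b ∷ S) = trans (head b) (cong (⟦ b ⟧ +_) (trans (∣∣-∑ S) (cong sum (trans (map-tabulate id (⟦_⟧ ∘ Vec.lookup S))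
                     (sym (map-tabulate suc (⟦_⟧ ∘ Vec.lookup (b ∷ S))))))))
    where
    head : ∀ b → ∣ b ∷ S ∣ ≡ ⟦ b ⟧ + ∣ S ∣
    head true  = refl
    head false = refl

  -- The first case takes ⌊q/25⌋ gadgets, at least one, so rounding loses less than a factor 2. For
  -- k gadgets, 25k covers the 5k + 5 asked of the degrees, the 5k + 1 asked of m, and the 4 * 5k +
  -- k asked of S.
  choose : ∀ q → (∃ λ k → 25 * suc k ≤ q × q < 50 * suc k) ⊎ q < 50 * 1
  choose q with q / 25 | m≡m%n+[m/n]*n q 25 | m%n<n q 25
  ... | zero  | eq | r< = inj₂ (≤-trans (s≤s (≤-reflexive (trans eq (+-identityʳ _)))) (≤-trans r< (m≤m+n 25 25)))
  ... | suc k | eq | r< = inj₁ (k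
        , ≤-trans (≤-trans (≤-reflexive (*-comm 25 (suc k))) (m≤n+m _ (q % 25))) (≤-reflexive (sym eq))
        , (begin-strict
            q                          ≡⟨ eq ⟩
            q % 25 + suc k * 25        <⟨ +-monoˡ-< (suc k * 25) r< ⟩
            25 + suc k * 25            ≤⟨ +-monoˡ-≤ (suc k * 25) (m≤m+n 25 (k * 25)) ⟩
            suc k * 25 + suc k * 25    ≡⟨ double (suc k) ⟩
            50 * suc k                 ∎))
    where
    open ≤-Reasoning
    double : ∀ k → k * 25 + k * 25 ≡ 50 * k
    double = solve-∀

  module _ {n : ℕ} (G : Graph n) (f : Labelling G) where
    open FromGraph G f

    label-bound : ∀ (S : Subset n) m →
      (∀ {v} → v ∈ˢ S → m ≤ labelDegree f Sign.+ v × m ≤ labelDegree f Sign.- v) →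
      ∀ s {v} → Vec.lookup S v ≡ true → m ≤ ∑ (λ u → labelled s v u) (allFin n)
    label-bound S m S-labels s {v} v∈ = let m≤+ , m≤- = S-labels (lookup⇒[]= v S v∈) in label-degree v m m≤+ m≤- s

    discrepant-cycle : ∀ (S : Subset n) m q →
      (∀ {v} → v ∈ˢ S → m ≤ labelDegree f Sign.+ v × m ≤ labelDegree f Sign.- v) →
      n < δ + δ → 0 < m → 3 * n < 4 * ∣ S ∣ →
      n + q ≤ δ + δ → 3 * n + q ≤ 4 * ∣ S ∣ → q ≤ m → Fin n →
      ∃ λ k → q < 50 * k × Σ (HamiltonCycle G) λ H → k ≤ discrepancy f H
    discrepant-cycle S m q S-labels n<2δ m>0 S-large q≤D q≤E q≤m v with choose q
    ... | inj₂ q<50 = 1 , q<50 , hit⇒cycle (n≥3 v n<2δ) (one-hit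
            (Vec.lookup S) m (label-bound S m S-labels) n<2δ m>0 (subst (λ s → 3 * n < 4 * s) (∣∣-∑ S) S-large) v)
    ... | inj₁ (k , 25k≤q , q<50k) = suc k , q<50k , hit⇒cycle (n≥3 v n<2δ) (many-gadgets
            (Vec.lookup S) m (label-bound S m S-labels) k
            (≤-trans (s≤s (+-monoʳ-≤ n (+-monoʳ-≤ (5 * suc k) (m≤m+n 4 0)))) (≤-trans (≤-trans (≤-reflexive (sym (+-suc n _))) (+-monoʳ-≤ n (≤-trans gadgets≤25 25k≤q))) q≤D))
            (≤-trans (≤-trans five<25 25k≤q) q≤m)
            (subst (λ s → 3 * n + 4 * (5 * suc k) + suc k ≤ 4 * s) (∣∣-∑ S)
              (≤-trans (≤-reflexive (+-assoc (3 * n) _ _)) (≤-trans (+-monoʳ-≤ (3 * n) (≤-trans twenty-one≤25 25k≤q)) q≤E))) v)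
      where
      gadgets≤25 : suc (5 * suc k + (4 + 0)) ≤ 25 * suc k
      gadgets≤25 = ≤-trans (m≤m+n _ (15 + 20 * k)) (≤-reflexive (lemma k))
        where
        lemma : ∀ k → suc (5 * suc k + (4 + 0)) + (15 + 20 * k) ≡ 25 * suc k
        lemma = solve-∀
      five<25 : 5 * suc k < 25 * suc k
      five<25 = ≤-trans (m≤m+n _ (19 + 20 * k)) (≤-reflexive (lemma k))
        where
        lemma : ∀ k → suc (5 * suc k) + (19 + 20 * k) ≡ 25 * suc k
        lemma = solve-∀
      twenty-one≤25 : 4 * (5 * suc k) + suc k ≤ 25 * suc k
      twenty-one≤25 = ≤-trans (m≤m+n _ (4 * suc k)) (≤-reflexive (lemma k))
        where
        lemma : ∀ k → 4 * (5 * suc k) + suc k + 4 * suc k ≡ 25 * suc k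
        lemma = solve-∀

    label-degrees : Subset n → List ℕ
    label-degrees S = map (labelDegree f Sign.+) vs ++ map (labelDegree f Sign.-) vs
      where
      vs : List (Fin n)
      vs = filter (_∈ˢ? S) (allFin n)

    -- The order of the reals is not decidable, so νn is not rounded to an integer. The least label
    -- degree over S takes its place: it is one of finitely many degrees or the default n, and so
    -- inherits the real inequality P.
    least-label-degree : ∀ (S : Subset n) (P : ℕ → Set) → P n →
      (∀ {v} → v ∈ˢ S → P (labelDegree f Sign.+ v) × P (labelDegree f Sign.- v)) →
      ∃ λ m → m ≤ n × P m × (∀ {v} → v ∈ˢ S → m ≤ labelDegree f Sign.+ v × m ≤ labelDegree f Sign.- v)
    least-label-degree S P Pn PS = min n ds , min≤⊤ n ds , argmin-all id Pn all-P , below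
      where
      vs = filter (_∈ˢ? S) (allFin n)
      ds = label-degrees S
      in-S : ∀ {v} → v ∈ vs → v ∈ˢ S
      in-S = proj₂ ∘ ∈-filter⁻ (_∈ˢ? S) {xs = allFin n}
      in-vs : ∀ {v} → v ∈ˢ S → v ∈ vs
      in-vs v∈ = ∈-filter⁺ (_∈ˢ? S) (∈-allFin _) v∈
      all-P : All.All P ds
      all-P = All.++⁺ (All.map⁺ (All.tabulate (proj₁ ∘ PS ∘ in-S))) (All.map⁺ (All.tabulate (proj₂ ∘ PS ∘ in-S)))
      below : ∀ {v} → v ∈ˢ S → min n ds ≤ labelDegree f Sign.+ v × min n ds ≤ labelDegree f Sign.- v
      below v∈ = All.lookup (min≤xs n ds) (∈-++⁺ˡ (∈-map⁺ _ (in-vs v∈)))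
               , All.lookup (min≤xs n ds) (∈-++⁺ʳ (map (labelDegree f Sign.+) vs) (∈-map⁺ _ (in-vs v∈)))

-- Real hypotheses, evaluated at late indices of the Cauchy sequences.

module Reals where

  import Defs as D
  open D using (ℝ; seq; cauchy; fromℚ; fromℕ)
  open import Data.Empty using (⊥)
  open import Data.Integer as ℤ using (+_)
  open import Data.Nat as ℕ using (ℕ; suc; z≤n; s≤s)
  import Data.Nat.Properties as ℕ
  open import Data.Product using (∃; _×_; _,_; proj₁; proj₂)
  open import Data.Rational
  open import Data.Rational.Properties
  open import Data.Rational.Solver using (module +-*-Solver)
  open import Data.Rational.Unnormalised as ℚᵘ using (mkℚᵘ; *≡*)
  import Data.Rational.Unnormalised.Properties as ℚᵘ
  open import Data.Sum using (inj₁; inj₂)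
  open import Relation.Binary.PropositionalEquality
  open import Relation.Nullary.Decidable using (toWitness)
  open +-*-Solver using (solve; _:+_; _:*_; _:=_; :-_; con)

  ι : ℕ → ℚ
  ι k = + k / 1

  private
    toℚᵘ-ι : ∀ k → toℚᵘ (ι k) ℚᵘ.≃ mkℚᵘ (+ k) 0
    toℚᵘ-ι k = toℚᵘ-fromℚᵘ (mkℚᵘ (+ k) 0)

  ι-+ : ∀ a b → ι (a ℕ.+ b) ≡ ι a + ι b
  ι-+ a b = toℚᵘ-injective (ℚᵘ.≃-trans (toℚᵘ-ι (a ℕ.+ b)) (ℚᵘ.≃-sym (ℚᵘ.≃-trans (toℚᵘ-homo-+ (ι a) (ι b))
    (ℚᵘ.≃-trans (ℚᵘ.+-cong (toℚᵘ-ι a) (toℚᵘ-ι b)) (*≡* (cong (ℤ._* + 1) (cong₂ ℤ._+_ (ℤ.*-identityʳ (+ a)) (ℤ.*-identityʳ (+ b)))))))))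

  ι-* : ∀ a b → ι (a ℕ.* b) ≡ ι a * ι b
  ι-* a b = toℚᵘ-injective (ℚᵘ.≃-trans (toℚᵘ-ι (a ℕ.* b)) (ℚᵘ.≃-sym (ℚᵘ.≃-trans (toℚᵘ-homo-* (ι a) (ι b))
    (ℚᵘ.≃-trans (ℚᵘ.*-cong (toℚᵘ-ι a) (toℚᵘ-ι b)) (*≡* (cong (ℤ._* + 1) (sym (ℤ.pos-* a b))))))))

  ι-cancel-< : ∀ {a b} → ι a < ι b → a ℕ.< b
  ι-cancel-< {a} {b} lt = ℤ.drop‿+<+ (subst₂ ℤ._<_ (ℤ.*-identityʳ (+ a)) (ℤ.*-identityʳ (+ b))
    (ℚᵘ.drop-*<* (ℚᵘ.<-respˡ-≃ (toℚᵘ-ι a) (ℚᵘ.<-respʳ-≃ (toℚᵘ-ι b) (toℚᵘ-mono-< lt)))))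

  ι-mono-≤ : ∀ {a b} → a ℕ.≤ b → ι a ≤ ι b
  ι-mono-≤ {a} {b} le = ≮⇒≥ λ lt → ℕ.<⇒≱ (ι-cancel-< lt) le

  <-by : ∀ {x y a b} m → a < b → x + m ≡ a → b ≡ y + m → x < y
  <-by {x} {y} m a<b refl refl = subst₂ _<_ (cancel x m) (cancel y m) (+-monoˡ-< (- m) a<b)
    where
    cancel : ∀ x m → x + m + - m ≡ x
    cancel x m = trans (+-assoc x m (- m)) (trans (cong (_+_ x) (+-inverseʳ m)) (+-identityʳ x))

  private
    third : ∀ ε → ε * (+ 1 / 3) + ε * (+ 1 / 3) + ε * (+ 1 / 3) ≡ ε
    third = solve 1 (λ ε → ε :* con (+ 1 / 3) :+ ε :* con (+ 1 / 3) :+ ε :* con (+ 1 / 3) := ε) refl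

    p≤∣p∣ : ∀ p → p ≤ ∣ p ∣
    p≤∣p∣ p with ≤-total 0ℚ p
    ... | inj₁ 0≤p = ≤-reflexive (sym (0≤p⇒∣p∣≡p 0≤p))
    ... | inj₂ p≤0 = ≤-trans p≤0 (0≤∣p∣ p)

    within : ∀ {a b η} → ∣ a - b ∣ < η → a < b + η
    within {a} {b} {η} lt = <-by (- b) (≤-<-trans (p≤∣p∣ (a - b)) lt) refl (lemma b η)
      where
      lemma : ∀ b η → η ≡ b + η + - b
      lemma = solve 2 (λ b η → η := b :+ η :+ :- b) refl

  -- An index at which x exceeds y by ε, a third of which bounds the later oscillation of both
  -- sequences, would separate the two reals.
  eventually-≤ : ∀ {x y} → x D.≤ y → ∀ ε → 0ℚ < ε → ∃ λ N → ∀ i → N ℕ.≤ i → seq x i < seq y i + ε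
  eventually-≤ {x} {y} x≤y ε 0<ε = M ℕ.⊔ N , λ i i≥ → ≰⇒> λ far → x≤y (η , 0<η , M ℕ.⊔ N , λ j j≥ →
      <⇒≤ (apart i j far (within {seq y j} {seq y i} (near-y j i (right j≥) (right i≥)))
                         (within {seq x i} {seq x j} (near-x i j (left i≥) (left j≥)))))
    where
    η = ε * (+ 1 / 3)
    0<η : 0ℚ < η
    0<η = subst (_< η) (*-zeroˡ (+ 1 / 3)) (*-monoˡ-<-pos (+ 1 / 3) 0<ε)
    M = proj₁ (cauchy x η 0<η)
    N = proj₁ (cauchy y η 0<η)
    near-x = proj₂ (cauchy x η 0<η)
    near-y = proj₂ (cauchy y η 0<η)
    left : ∀ {i} → M ℕ.⊔ N ℕ.≤ i → M ℕ.≤ i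
    left = ℕ.m⊔n≤o⇒m≤o M N
    right : ∀ {i} → M ℕ.⊔ N ℕ.≤ i → N ℕ.≤ i
    right = ℕ.m⊔n≤o⇒n≤o M N
    apart : ∀ i j → seq y i + ε ≤ seq x i → seq y j < seq y i + η → seq x i < seq x j + η → seq y j + η < seq x j
    apart i j far y< x< = <-by (η + η) (begin-strict
      seq y j + (η + η + η)          <⟨ +-monoˡ-< (η + η + η) y< ⟩
      seq y i + η + (η + η + η)      ≡⟨ cong (λ e → seq y i + η + e) (third ε) ⟩
      seq y i + η + ε                ≡⟨ swap (seq y i) η ε ⟩
      seq y i + ε + η                ≤⟨ +-monoˡ-≤ η far ⟩
      seq x i + η                    <⟨ +-monoˡ-< η x< ⟩
      seq x j + η + η                ∎) (assoc (seq y j) η) (+-assoc (seq x j) η η)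
      where
      open ≤-Reasoning
      swap : ∀ a b c → a + b + c ≡ a + c + b
      swap = solve 3 (λ a b c → a :+ b :+ c := a :+ c :+ b) refl
      assoc : ∀ a η → a + η + (η + η) ≡ a + (η + η + η)
      assoc = solve 2 (λ a η → a :+ η :+ (η :+ η) := a :+ (η :+ η :+ η)) refl

  -- The two hypotheses on the reals, at an index of the sequences: 4a < c + η with 0 < η ≤ a gives
  -- 3a < c, and one of the three a N then absorbs the error η.
  threshold : ∀ {h c a s η N} → 1ℚ ≤ N → 0ℚ < η → η ≤ a → a + a + a + a < c + η → (h + c) * N < s + η →
    h * N + (a * N + a * N) < s
  threshold {h} {c} {a} {s} {η} {N} 1≤N 0<η η≤a c-large s-large = <-by (a * N) (begin-strict
      h * N + (a * N + a * N) + a * N   ≡⟨ collect h a N ⟩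
      (h + (a + a + a)) * N             ≤⟨ *-monoʳ-≤-nonNeg N {{N-nonNeg}} (+-monoʳ-≤ h (<⇒≤ 3a<c)) ⟩
      (h + c) * N                       <⟨ s-large ⟩
      s + η                             ≤⟨ +-monoʳ-≤ s η≤aN ⟩
      s + a * N                         ∎) refl refl
    where
    open ≤-Reasoning
    collect : ∀ h a N → h * N + (a * N + a * N) + a * N ≡ (h + (a + a + a)) * N
    collect = solve 3 (λ h a N → h :* N :+ (a :* N :+ a :* N) :+ a :* N := (h :+ (a :+ a :+ a)) :* N) refl
    N-nonNeg : NonNegative N
    N-nonNeg = nonNegative (≤-trans (<⇒≤ (positive⁻¹ 1ℚ)) 1≤N)
    a-nonNeg : NonNegative a
    a-nonNeg = nonNegative (≤-trans (<⇒≤ 0<η) η≤a)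
    3a<c : a + a + a < c
    3a<c = <-by a (<-≤-trans c-large (+-monoʳ-≤ c η≤a)) refl refl
    η≤aN : η ≤ a * N
    η≤aN = ≤-trans η≤a (≤-trans (≤-reflexive (sym (*-identityʳ a))) (*-monoˡ-≤-nonNeg a {{a-nonNeg}} 1≤N))

  -- Here a is a late term of ν. From aN < n + 1 ≤ 2N follows a < 2, whence aaN / 500 ≤ 2 * 50k /
  -- 500 = k / 5.
  product-bound : ∀ {a N} n k → N ≡ ι n → 1ℚ ≤ N → 0ℚ ≤ a → a * N < ι (suc n) → a * N < ι (50 ℕ.* k) →
    (+ 1 / 500) * (a * a * N) ≤ ι k
  product-bound {a} {N} n k N≡ 1≤N 0≤a a<n+1 aN<50k = begin
    (+ 1 / 500) * (a * a * N)               ≡⟨ cong ((+ 1 / 500) *_) (*-assoc a a N) ⟩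
    (+ 1 / 500) * (a * (a * N))             ≤⟨ *-monoˡ-≤-nonNeg (+ 1 / 500) (*-monoʳ-≤-nonNeg (a * N) {{nonNegative 0≤aN}} (<⇒≤ a<2)) ⟩
    (+ 1 / 500) * ((1ℚ + 1ℚ) * (a * N))     ≤⟨ *-monoˡ-≤-nonNeg (+ 1 / 500) (*-monoˡ-≤-nonNeg (1ℚ + 1ℚ) (<⇒≤ aN<50k)) ⟩
    (+ 1 / 500) * ((1ℚ + 1ℚ) * ι (50 ℕ.* k)) ≡⟨ cong (λ q → (+ 1 / 500) * ((1ℚ + 1ℚ) * q)) (ι-* 50 k) ⟩
    (+ 1 / 500) * ((1ℚ + 1ℚ) * (ι 50 * ι k)) ≡⟨ simplify (ι k) ⟩
    (+ 1 / 5) * ι k                         ≤⟨ *-monoʳ-≤-nonNeg (ι k) {{nonNegative (ι-mono-≤ {0} {k} z≤n)}} {+ 1 / 5} {1ℚ} (toWitness {a? = (+ 1 / 5) ≤? 1ℚ} _) ⟩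
    1ℚ * ι k                                ≡⟨ *-identityˡ (ι k) ⟩
    ι k                                     ∎
    where
    open ≤-Reasoning
    0<N : 0ℚ < N
    0<N = <-≤-trans (positive⁻¹ 1ℚ) 1≤N
    0≤aN : 0ℚ ≤ a * N
    0≤aN = ≤-trans (≤-reflexive (sym (*-zeroˡ N))) (*-monoʳ-≤-nonNeg N {{nonNegative (<⇒≤ 0<N)}} 0≤a)
    simplify : ∀ x → (+ 1 / 500) * ((1ℚ + 1ℚ) * (ι 50 * x)) ≡ (+ 1 / 5) * x
    simplify = solve 1 (λ x → con (+ 1 / 500) :* ((con 1ℚ :+ con 1ℚ) :* (con (ι 50) :* x)) := con (+ 1 / 5) :* x) refl
    a<2 : a < 1ℚ + 1ℚ
    a<2 = *-cancelʳ-<-nonNeg N {{nonNegative (<⇒≤ 0<N)}} (begin-strict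
      a * N                 <⟨ a<n+1 ⟩
      ι (suc n)             ≡⟨ ι-+ 1 n ⟩
      1ℚ + ι n              ≡⟨ cong (λ q → 1ℚ + q) N≡ ⟨
      1ℚ + N                ≤⟨ +-monoˡ-≤ N 1≤N ⟩
      N + N                 ≡⟨ double N ⟩
      (1ℚ + 1ℚ) * N         ∎)
      where
      double : ∀ N → N + N ≡ (1ℚ + 1ℚ) * N
      double = solve 1 (λ N → N :+ N := (con 1ℚ :+ con 1ℚ) :* N) refl
  Eventually : (ℕ → Set) → Set
  Eventually P = ∃ λ N → ∀ i → N ℕ.≤ i → P i

  infixr 6 _∧ᵉ_
  _∧ᵉ_ : ∀ {P Q} → Eventually P → Eventually Q → Eventually (λ i → P i × Q i)
  (M , p) ∧ᵉ (N , q) = M ℕ.⊔ N , λ i i≥ → p i (ℕ.m⊔n≤o⇒m≤o M N i≥) , q i (ℕ.m⊔n≤o⇒n≤o M N i≥)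

  module Hypotheses (c d ν : ℝ) (0<ν : fromℕ 0 D.< ν) (8ν≤c : fromℕ 8 D.* ν D.≤ c) (4ν≤d : fromℕ 4 D.* ν D.≤ d)
           (n : ℕ) (n>0 : 0 ℕ.< n) (δ s : ℕ)
           (δ-large : (fromℚ ½ D.+ c) D.* fromℕ n D.≤ fromℕ δ)
           (s-large : (fromℚ (+ 3 / 4) D.+ d) D.* fromℕ n D.≤ fromℕ s) where

    private
      N η : ℚ
      N = ι n
      -- The gap between 0 and ν is also the tolerance for the other hypotheses: late terms a of ν
      -- have η ≤ a, so the errors are absorbed by multiples of a and of aN.
      η = proj₁ 0<ν
      0<η : 0ℚ < η
      0<η = proj₁ (proj₂ 0<ν)
      1≤N : 1ℚ ≤ N
      1≤N = ι-mono-≤ {1} {n} n>0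

      N-nonNeg : NonNegative N
      N-nonNeg = nonNegative (≤-trans (<⇒≤ (positive⁻¹ 1ℚ)) 1≤N)

      Bounds : ℚ → Set
      Bounds a = 0ℚ < a * N × η ≤ a × N + a * N < ι (δ ℕ.+ δ) × ι (3 ℕ.* n) + a * N < ι (4 ℕ.* s)

      at-index : ∀ {a c d} → 0ℚ + η ≤ a → ι 8 * a < c + η → ι 4 * a < d + η →
        (½ + c) * N < ι δ + η → ((+ 3 / 4) + d) * N < ι s + η → Bounds a
      at-index {a} {c} {d} η≤a′ 8a< 4a< δ> s> = <-≤-trans 0<η η≤aN , η≤a , δ-bound , s-bound
        where
        open ≤-Reasoning
        η≤a : η ≤ a
        η≤a = ≤-trans (≤-reflexive (sym (+-identityˡ η))) η≤a′
        a-nonNeg : NonNegative a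
        a-nonNeg = nonNegative (≤-trans (<⇒≤ 0<η) η≤a)
        η≤aN : η ≤ a * N
        η≤aN = ≤-trans η≤a (≤-trans (≤-reflexive (sym (*-identityʳ a))) (*-monoˡ-≤-nonNeg a {{a-nonNeg}} 1≤N))
        0≤aN : 0ℚ ≤ a * N
        0≤aN = ≤-trans (<⇒≤ 0<η) η≤aN
        weaken : ∀ x {y} k → 0ℚ ≤ k → x + k < y → x < y
        weaken x k 0≤k lt = ≤-<-trans (≤-trans (≤-reflexive (sym (+-identityʳ x))) (+-monoʳ-≤ x 0≤k)) lt
        four : ∀ a → ι 4 * a ≡ a + a + a + a
        four = solve 1 (λ a → con (ι 4) :* a := a :+ a :+ a :+ a) refl
        4a≤8a : ι 4 * a ≤ ι 8 * a
        4a≤8a = *-monoʳ-≤-nonNeg a {{a-nonNeg}} (ι-mono-≤ {4} {8} (ℕ.m≤m+n 4 4))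
        half : ½ * N + (a * N + a * N) < ι δ
        half = threshold {½} {c} {a} {ι δ} {η} {N} 1≤N 0<η η≤a (subst (_< c + η) (four a) (≤-<-trans 4a≤8a 8a<)) δ>
        three-quarters : (+ 3 / 4) * N + (a * N + a * N) < ι s
        three-quarters = threshold {+ 3 / 4} {d} {a} {ι s} {η} {N} 1≤N 0<η η≤a (subst (_< d + η) (four a) 4a<) s>
        δ-bound : N + a * N < ι (δ ℕ.+ δ)
        δ-bound = weaken (N + a * N) (a * N + a * N + a * N) (+-mono-≤ (+-mono-≤ 0≤aN 0≤aN) 0≤aN) (begin-strict
          N + a * N + (a * N + a * N + a * N)                                     ≡⟨ lemma N (a * N) ⟩
          ½ * N + (a * N + a * N) + (½ * N + (a * N + a * N))                     <⟨ +-mono-< half half ⟩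
          ι δ + ι δ                                                               ≡⟨ ι-+ δ δ ⟨
          ι (δ ℕ.+ δ)                                                             ∎)
          where
          lemma : ∀ N x → N + x + (x + x + x) ≡ ½ * N + (x + x) + (½ * N + (x + x))
          lemma = solve 2 (λ N x → N :+ x :+ (x :+ x :+ x) :=
            con ½ :* N :+ (x :+ x) :+ (con ½ :* N :+ (x :+ x))) refl
        s-bound : ι (3 ℕ.* n) + a * N < ι (4 ℕ.* s)
        s-bound = weaken (ι (3 ℕ.* n) + a * N) (ι 7 * (a * N))
          (≤-trans (≤-reflexive (sym (*-zeroʳ (ι 7)))) (*-monoˡ-≤-nonNeg (ι 7) 0≤aN)) (begin-strict
          ι (3 ℕ.* n) + a * N + ι 7 * (a * N)              ≡⟨ cong (λ t → t + a * N + ι 7 * (a * N)) (ι-* 3 n) ⟩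
          ι 3 * N + a * N + ι 7 * (a * N)                  ≡⟨ lemma N (a * N) ⟩
          ι 4 * ((+ 3 / 4) * N + (a * N + a * N))          <⟨ *-monoʳ-<-pos (ι 4) three-quarters ⟩
          ι 4 * ι s                                        ≡⟨ ι-* 4 s ⟨
          ι (4 ℕ.* s)                                      ∎)
          where
          lemma : ∀ N x → ι 3 * N + x + ι 7 * x ≡ ι 4 * ((+ 3 / 4) * N + (x + x))
          lemma = solve 2 (λ N x → con (ι 3) :* N :+ x :+ con (ι 7) :* x :=
            con (ι 4) :* (con (+ 3 / 4) :* N :+ (x :+ x))) refl

      bounds : Eventually (λ i → Bounds (seq ν i))
      bounds =
        let M , h = proj₂ (proj₂ 0<ν)
              ∧ᵉ eventually-≤ {fromℕ 8 D.* ν} {c} 8ν≤c η 0<η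
              ∧ᵉ eventually-≤ {fromℕ 4 D.* ν} {d} 4ν≤d η 0<η
              ∧ᵉ eventually-≤ {(fromℚ ½ D.+ c) D.* fromℕ n} {fromℕ δ} δ-large η 0<η
              ∧ᵉ eventually-≤ {(fromℚ (+ 3 / 4) D.+ d) D.* fromℕ n} {fromℕ s} s-large η 0<η
        in M , λ i i≥ → let p , q , r , t , u = h i i≥ in at-index {seq ν i} {seq c i} {seq d i} p q r t u

      -- The successor gives this bound the shape of aN < m + 1, which is what `νn≤m` yields at a
      -- single index with tolerance 1.
      drop-sum : ∀ {a} p b → ι p + a * N < ι b → p ℕ.≤ b → a * N < ι (suc (b ℕ.∸ p))
      drop-sum {a} p b lt p≤b = <-≤-trans (<-by (ι p) lt (+-comm (a * N) (ι p)) (begin-equality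
          ι b                        ≡⟨ cong ι (ℕ.m+[n∸m]≡n p≤b) ⟨
          ι (p ℕ.+ (b ℕ.∸ p))        ≡⟨ ι-+ p (b ℕ.∸ p) ⟩
          ι p + ι (b ℕ.∸ p)          ≡⟨ +-comm (ι p) _ ⟩
          ι (b ℕ.∸ p) + ι p          ∎)) (ι-mono-≤ {b ℕ.∸ p} (ℕ.n≤1+n _))
        where open ≤-Reasoning

    n<2δ : n ℕ.< δ ℕ.+ δ
    n<2δ = let M , h = bounds ; 0<aN , _ , lt , _ = h M ℕ.≤-refl in
      ι-cancel-< {n} {δ ℕ.+ δ} (≤-<-trans (≤-trans (≤-reflexive (sym (+-identityʳ N))) (+-monoʳ-≤ N (<⇒≤ 0<aN))) lt)

    3n<4s : 3 ℕ.* n ℕ.< 4 ℕ.* s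
    3n<4s = let M , h = bounds ; 0<aN , _ , _ , lt = h M ℕ.≤-refl in
      ι-cancel-< {3 ℕ.* n} {4 ℕ.* s} (≤-<-trans (≤-trans (≤-reflexive (sym (+-identityʳ _))) (+-monoʳ-≤ (ι (3 ℕ.* n)) (<⇒≤ 0<aN))) lt)

    -- Covers the default value n of the least label degree. If νn exceeded n, then n + νn < 2δ
    -- would force 2δ > 2n.
    νn≤n : δ ℕ.≤ n → ν D.* fromℕ n D.≤ fromℕ n
    νn≤n δ≤n (ε , 0<ε , M , far) = let K , h = bounds ∧ᵉ (M , far) ; (_ , _ , lt , _) , N+ε≤aN = h K ℕ.≤-refl in
      <-irrefl refl (begin-strict
        N + N                     ≤⟨ +-monoʳ-≤ N (≤-trans (≤-trans (≤-reflexive (sym (+-identityʳ N))) (+-monoʳ-≤ N (<⇒≤ 0<ε))) N+ε≤aN) ⟩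
        N + seq ν K * N           <⟨ lt ⟩
        ι (δ ℕ.+ δ)               ≤⟨ ι-mono-≤ {δ ℕ.+ δ} {n ℕ.+ n} (ℕ.+-mono-≤ δ≤n δ≤n) ⟩
        ι (n ℕ.+ n)               ≡⟨ ι-+ n n ⟩
        N + N                     ∎)
      where open ≤-Reasoning

    module _ {m : ℕ} (νn≤m : ν D.* fromℕ n D.≤ fromℕ m) where

      m>0 : 0 ℕ.< m
      m>0 = let K , h = bounds ∧ᵉ eventually-≤ {ν D.* fromℕ n} {fromℕ m} νn≤m η 0<η
                (_ , η≤a , _ , _) , aN<m+η = h K ℕ.≤-refl
            in ι-cancel-< {0} {m} (<-by η (≤-<-trans (η≤aN η≤a) aN<m+η) (+-identityˡ η) refl)
        where
        η≤aN : ∀ {a} → η ≤ a → η ≤ a * N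
        η≤aN {a} η≤a = ≤-trans η≤a (≤-trans (≤-reflexive (sym (*-identityʳ a)))
          (*-monoˡ-≤-nonNeg a {{nonNegative (≤-trans (<⇒≤ 0<η) η≤a)}} 1≤N))

      private
        D E : ℕ
        D = δ ℕ.+ δ ℕ.∸ n
        E = 4 ℕ.* s ℕ.∸ 3 ℕ.* n

        least : ∀ {t x y} → t < ι (suc x) → t < ι (suc y) → t < ι (suc (x ℕ.⊓ y))
        least {t} {x} {y} p q with ℕ.⊓-sel x y
        ... | inj₁ eq = subst (λ z → t < ι (suc z)) (sym eq) p
        ... | inj₂ eq = subst (λ z → t < ι (suc z)) (sym eq) q

        below-50k : ∀ {a} k → Bounds a → a * N < ι m + 1ℚ → D ℕ.⊓ E ℕ.⊓ m ℕ.< 50 ℕ.* k → m ℕ.≤ n →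
          (+ 1 / 500) * (a * a * N) ≤ ι k
        below-50k {a} k (_ , η≤a , δ-bound , s-bound) aN<m+1 q<50k m≤n =
          product-bound n k refl 1≤N (≤-trans (<⇒≤ 0<η) η≤a)
            (<-≤-trans aN<1+m (ι-mono-≤ {suc m} {suc n} (s≤s m≤n)))
            (<-≤-trans (least {a * N} {D ℕ.⊓ E} {m} (least {a * N} {D} {E}
                (drop-sum {a} n (δ ℕ.+ δ) δ-bound (ℕ.<⇒≤ n<2δ))
                (drop-sum {a} (3 ℕ.* n) (4 ℕ.* s) s-bound (ℕ.<⇒≤ 3n<4s))) aN<1+m)
              (ι-mono-≤ {suc (D ℕ.⊓ E ℕ.⊓ m)} {50 ℕ.* k} q<50k))
          where
          aN<1+m : a * N < ι (suc m)
          aN<1+m = <-≤-trans aN<m+1 (≤-reflexive (trans (+-comm (ι m) 1ℚ) (sym (ι-+ 1 m))))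

        no-gap : ∀ {x k disc ε} → 0ℚ < ε → k ℕ.≤ disc → x ≤ ι k → ι disc + ε ≤ x → ⊥
        no-gap {x} {k} {disc} {ε} 0<ε k≤disc x≤k far = <-irrefl refl (begin-strict
          ι disc            ≡⟨ +-identityʳ (ι disc) ⟨
          ι disc + 0ℚ       <⟨ +-monoʳ-< (ι disc) 0<ε ⟩
          ι disc + ε        ≤⟨ far ⟩
          x                 ≤⟨ x≤k ⟩
          ι k               ≤⟨ ι-mono-≤ {k} {disc} k≤disc ⟩
          ι disc            ∎)
          where open ≤-Reasoning

      conclusion : m ℕ.≤ n → ∀ k disc → k ℕ.≤ disc →
        (δ ℕ.+ δ ℕ.∸ n) ℕ.⊓ (4 ℕ.* s ℕ.∸ 3 ℕ.* n) ℕ.⊓ m ℕ.< 50 ℕ.* k →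
        fromℚ (+ 1 / 500) D.* (ν D.* ν D.* fromℕ n) D.≤ fromℕ disc
      -- The goal is a negation. Its assumption keeps the discrepancy ε below the bound from index M
      -- on, and one index late enough for all estimates refutes it.
      conclusion m≤n k disc k≤disc q<50k (ε , 0<ε , M , far) =
        let K , h = bounds ∧ᵉ eventually-≤ {ν D.* fromℕ n} {fromℕ m} νn≤m 1ℚ (positive⁻¹ 1ℚ) ∧ᵉ (M , far)
            b , aN<m+1 , far-K = h K ℕ.≤-refl
        in no-gap {(+ 1 / 500) * (seq ν K * seq ν K * N)} {k} {disc} {ε} 0<ε k≤disc
             (below-50k {seq ν K} k b aN<m+1 q<50k m≤n) far-K

open Combinatorics using (least-label-degree; discrepant-cycle)

open import Defs
open import Data.Nat using (ℕ; NonZero)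
open import Data.Integer using (+_)
open import Data.Product using (∃; _,_)
open import Data.Rational using (½; _/_)

theorem1p2 : (c d ν : ℝ) →
    fromℕ 0 < c → fromℕ 0 < d → fromℕ 0 < ν →
    fromℕ 8 * ν ≤ c → fromℕ 4 * ν ≤ d →
    (n : ℕ) → .{{_ : NonZero n}} →
    (G : Graph n) →
    (fromℚ ½ + c) * fromℕ n ≤ fromℕ (δ G) →
    (f : Labelling G) →
    AtLeast ((fromℚ (+ 3 / 4) + d) * fromℕ n) (Balanced f ν) →
    ∃ λ (H : HamiltonCycle G) →
    fromℚ (+ 1 / 500) * (ν * ν * fromℕ n) ≤ fromℕ (discrepancy f H)
theorem1p2 c d ν 0<c 0<d 0<ν 8ν≤c 4ν≤d n G δ-large f (S , balanced , S-large) =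
  let m , m≤n , νn≤m , S-labels = least-label-degree G f S (λ m → ν * fromℕ n ≤ fromℕ m) (R.νn≤n δ≤n) balanced
      k , q<50k , H , k≤disc = discrepant-cycle G f S m (D ⊓ E ⊓ m) S-labels R.n<2δ (R.m>0 νn≤m) R.3n<4s
        (below R.n<2δ (≤-trans (m⊓n≤m (D ⊓ E) m) (m⊓n≤m D E)))
        (below R.3n<4s (≤-trans (m⊓n≤m (D ⊓ E) m) (m⊓n≤n D E)))
        (m⊓n≤n (D ⊓ E) m) (fromℕ< n>0)
  in H , R.conclusion νn≤m m≤n k (discrepancy f H) k≤disc q<50k
  where
  open import Data.Fin using (fromℕ<)
  open import Data.Fin.Subset using (∣_∣)
  open import Data.List using (map; allFin)
  open import Data.List.Extrema.Nat using (min≤⊤)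
  open import Data.Nat as ℕ using (_⊓_; _∸_)
  open import Data.Nat.Properties using (≤-trans; m⊓n≤m; m⊓n≤n; m+[n∸m]≡n; +-monoʳ-≤; ≤-reflexive; <⇒≤)
  n>0 : 0 ℕ.< n
  n>0 = ℕ.>-nonZero⁻¹ n
  module R = Reals.Hypotheses c d ν 0<ν 8ν≤c 4ν≤d n n>0 (δ G) ∣ S ∣ δ-large S-large
  δ≤n : δ G ℕ.≤ n
  δ≤n = min≤⊤ n (map (degree G) (allFin n))
  -- The surpluses in the degrees and in the number of balanced vertices; both are positive, so
  -- truncated subtraction is exact.
  D E : ℕ
  D = δ G ℕ.+ δ G ∸ n
  E = 4 ℕ.* ∣ S ∣ ∸ 3 ℕ.* n
  below : ∀ {p q x} → p ℕ.< q → x ℕ.≤ q ∸ p → p ℕ.+ x ℕ.≤ q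
  below {p} p<q le = ≤-trans (+-monoʳ-≤ p le) (≤-reflexive (m+[n∸m]≡n (<⇒≤ p<q)))
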